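{- $$\sum_{m,n=1}^\infty\ \lim_{X\rightarrow \infty}\frac{1}{X}\sum_{x=1}^X \frac{\mu(m)\mu(n)}{mn}\left(\left\{\frac{x}{n}\right\}\left\{\frac{x}{m}\right\}-\left\{\frac{2x}{n}\right\}\left\{\frac{x}{m}\right\}-\left\{\frac{x}{n}\right\}\left\{\frac{2x}{m}\right\}+\left\{\frac{2x}{n}\right\}\left\{\frac{2x}{m}\right\}\right)=\frac{1}{6\zeta(2)}-\frac{1}{6\zeta(2)^2},$$ where for each pair $(m,n)$ the limit over positive integers $X$ is taken first (the inner sum being over integers $x$), and the sum over all pairs of positive integers $(m,n)$ is taken afterwards.
   Context: $\mu$ is the Möbius function on positive integers, $\zeta$ is the Riemann zeta function, and $\{y\}=y-[y]$ denotes the fractional part of a real number $y$, with $[y]$ the integer part (floor). -}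

module Defs where

open import Data.Bool.Base using (if_then_else_)
open import Data.Integer.Base as ℤ using (ℤ; +_; 0ℤ; 1ℤ; -1ℤ)
open import Data.List.Base using (List; foldr; map; length)
open import Data.List.Relation.Binary.Subset.Propositional using (_⊆_)
open import Data.List.Relation.Unary.Unique.Propositional using (Unique)
open import Data.Nat.Base as ℕ using (ℕ; zero; suc; NonZero; z≤n; s≤s)
import Data.Nat.Properties as ℕ
open import Data.List.Relation.Unary.Unique.DecPropositional ℕ._≟_ using (unique?)
open import Data.Nat.Primality.Factorisation using (factorise; factors)
open import Data.Product.Base using (∃-syntax; _×_; _,_)
open import Data.Rational.Base as ℚ using (ℚ; mkℚ; 0ℚ; 1ℚ; ½; Positive; floor; _/_)
import Data.Rational.Properties as ℚ
open import Data.Rational.Solver using (module +-*-Solver)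
import Data.Rational.Unnormalised.Base as ℚᵘ
import Data.Rational.Unnormalised.Properties as ℚᵘ
open import Data.Sum.Base using (inj₁; inj₂)
open import Relation.Binary.PropositionalEquality
open import Relation.Nullary using (does; yes; no; contradiction)

open +-*-Solver using (solve; _:+_; _:*_; _:-_; :-_; _:=_; con)

-- Real numbers: Cauchy sequences of rationals with a modulus of convergence.
-- Operations act pointwise; order and apartness ignore finitely many terms.

IsCauchy : (ℕ → ℚ) → Set
IsCauchy f = ∀ ε .{{_ : Positive ε}} →
  ∃[ N ] (∀ i j → N ℕ.≤ i → N ℕ.≤ j → ℚ.∣ f i ℚ.- f j ∣ ℚ.≤ ε)

record ℝ : Set where
  no-eta-equality
  constructor mkℝ
  field
    seq    : ℕ → ℚ
    cauchy : IsCauchy seq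

open ℝ public

infix  4 _≤_
infixl 6 _+_ _-_
infixl 7 _*_
infix  8 -_

_≤_ : ℝ → ℝ → Set
x ≤ y = ∀ ε .{{_ : Positive ε}} → ∃[ N ] (∀ n → N ℕ.≤ n → seq x n ℚ.≤ seq y n ℚ.+ ε)

fromℚ : ℚ → ℝ
seq    (fromℚ q) _ = q
cauchy (fromℚ q) ε = 0 , λ _ _ _ _ → subst (ℚ._≤ ε)
  (cong ℚ.∣_∣ (sym (ℚ.+-inverseʳ q))) (ℚ.<⇒≤ (ℚ.positive⁻¹ ε))

half-pos : ∀ ε .{{_ : Positive ε}} → Positive (½ ℚ.* ε)
half-pos ε = ℚ.pos*pos⇒pos ½ ε

half+half : ∀ ε → ½ ℚ.* ε ℚ.+ ½ ℚ.* ε ≡ ε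
half+half = solve 1 (λ e → con ½ :* e :+ con ½ :* e := e) refl

+-cauchy : ∀ {f g} → IsCauchy f → IsCauchy g → IsCauchy (λ n → f n ℚ.+ g n)
+-cauchy {f} {g} cf cg ε =
  let instance _ = half-pos ε
      (M , p) = cf (½ ℚ.* ε)
      (N , q) = cg (½ ℚ.* ε)
  in M ℕ.⊔ N , λ i j le le′ →
    let open ℚ.≤-Reasoning in begin
    ℚ.∣ (f i ℚ.+ g i) ℚ.- (f j ℚ.+ g j) ∣
      ≡⟨ cong ℚ.∣_∣ (solve 4 (λ a b c d → (a :+ b) :- (c :+ d) := (a :- c) :+ (b :- d))
           refl (f i) (g i) (f j) (g j)) ⟩
    ℚ.∣ (f i ℚ.- f j) ℚ.+ (g i ℚ.- g j) ∣
      ≤⟨ ℚ.∣p+q∣≤∣p∣+∣q∣ (f i ℚ.- f j) (g i ℚ.- g j) ⟩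
    ℚ.∣ f i ℚ.- f j ∣ ℚ.+ ℚ.∣ g i ℚ.- g j ∣
      ≤⟨ ℚ.+-mono-≤
           (p i j (ℕ.m⊔n≤o⇒m≤o M N le) (ℕ.m⊔n≤o⇒m≤o M N le′))
           (q i j (ℕ.m⊔n≤o⇒n≤o M N le) (ℕ.m⊔n≤o⇒n≤o M N le′)) ⟩
    ½ ℚ.* ε ℚ.+ ½ ℚ.* ε
      ≡⟨ half+half ε ⟩
    ε ∎

neg-cauchy : ∀ {f} → IsCauchy f → IsCauchy (λ n → ℚ.- f n)
neg-cauchy {f} cf ε = let (N , p) = cf ε in N , λ i j le le′ → subst (ℚ._≤ ε)
  (trans (sym (ℚ.∣-p∣≡∣p∣ (f i ℚ.- f j)))
    (cong ℚ.∣_∣ (solve 2 (λ a b → :- (a :- b) := :- a :- :- b) refl (f i) (f j))))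
  (p i j le le′)

cauchy⇒bounded : ∀ {f} → IsCauchy f →
  ∃[ B ] (Positive B × ∃[ N ] (∀ n → N ℕ.≤ n → ℚ.∣ f n ∣ ℚ.≤ B))
cauchy⇒bounded {f} cf =
  let (N , p) = cf 1ℚ
  in ℚ.∣ f N ∣ ℚ.+ 1ℚ
   , ℚ.nonNeg+pos⇒pos ℚ.∣ f N ∣ {{ℚ.∣-∣-nonNeg (f N)}} 1ℚ
   , N , λ n le → let open ℚ.≤-Reasoning in begin
      ℚ.∣ f n ∣
        ≡⟨ cong ℚ.∣_∣ (solve 2 (λ a b → a := b :+ (a :- b)) refl (f n) (f N)) ⟩
      ℚ.∣ f N ℚ.+ (f n ℚ.- f N) ∣
        ≤⟨ ℚ.∣p+q∣≤∣p∣+∣q∣ (f N) (f n ℚ.- f N) ⟩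
      ℚ.∣ f N ∣ ℚ.+ ℚ.∣ f n ℚ.- f N ∣
        ≤⟨ ℚ.+-monoʳ-≤ ℚ.∣ f N ∣ (p n N le ℕ.≤-refl) ⟩
      ℚ.∣ f N ∣ ℚ.+ 1ℚ ∎

∣*∣-mono : ∀ {a b c d} → ℚ.∣ a ∣ ℚ.≤ c → ℚ.∣ b ∣ ℚ.≤ d → ℚ.∣ a ℚ.* b ∣ ℚ.≤ c ℚ.* d
∣*∣-mono {a} {b} {c} {d} p q = let open ℚ.≤-Reasoning in begin
  ℚ.∣ a ℚ.* b ∣         ≡⟨ ℚ.∣p*q∣≡∣p∣*∣q∣ a b ⟩
  ℚ.∣ a ∣ ℚ.* ℚ.∣ b ∣   ≤⟨ ℚ.*-monoʳ-≤-nonNeg ℚ.∣ b ∣ {{ℚ.∣-∣-nonNeg b}} p ⟩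
  c ℚ.* ℚ.∣ b ∣         ≤⟨ ℚ.*-monoˡ-≤-nonNeg c
                             {{ℚ.nonNegative (ℚ.≤-trans (ℚ.0≤∣p∣ a) p)}} q ⟩
  c ℚ.* d ∎

cancel-1/ : ∀ b .{{_ : ℚ.NonZero b}} e → b ℚ.* (ℚ.1/ b ℚ.* e) ≡ e
cancel-1/ b e = trans (sym (ℚ.*-assoc b (ℚ.1/ b) e))
  (trans (cong (ℚ._* e) (ℚ.*-inverseʳ b)) (ℚ.*-identityˡ e))

scaled : ∀ b .{{_ : Positive b}} ε .{{_ : Positive ε}} → ∃[ δ ] (Positive δ × b ℚ.* δ ≡ ε)
scaled b ε = (ℚ.1/ b) ℚ.* ε , ℚ.pos*pos⇒pos (ℚ.1/ b) {{ℚ.1/pos⇒pos b}} ε , cancel-1/ b ε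
  where instance b≢0 : ℚ.NonZero b
                 b≢0 = ℚ.pos⇒nonZero b

*-diff : ∀ a b c d → a ℚ.* b ℚ.- c ℚ.* d ≡ a ℚ.* (b ℚ.- d) ℚ.+ (a ℚ.- c) ℚ.* d
*-diff = solve 4 (λ a b c d → a :* b :- c :* d := a :* (b :- d) :+ (a :- c) :* d) refl

∣*-diff∣ : ∀ {a b c d A B δ δ′} →
  ℚ.∣ a ∣ ℚ.≤ A → ℚ.∣ d ∣ ℚ.≤ B → ℚ.∣ a ℚ.- c ∣ ℚ.≤ δ → ℚ.∣ b ℚ.- d ∣ ℚ.≤ δ′ →
  ℚ.∣ a ℚ.* b ℚ.- c ℚ.* d ∣ ℚ.≤ A ℚ.* δ′ ℚ.+ δ ℚ.* B
∣*-diff∣ {a} {b} {c} {d} {A} {B} {δ} {δ′} a≤A d≤B a-c≤δ b-d≤δ′ = begin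
  ℚ.∣ a ℚ.* b ℚ.- c ℚ.* d ∣
    ≡⟨ cong ℚ.∣_∣ (*-diff a b c d) ⟩
  ℚ.∣ a ℚ.* (b ℚ.- d) ℚ.+ (a ℚ.- c) ℚ.* d ∣
    ≤⟨ ℚ.∣p+q∣≤∣p∣+∣q∣ (a ℚ.* (b ℚ.- d)) ((a ℚ.- c) ℚ.* d) ⟩
  ℚ.∣ a ℚ.* (b ℚ.- d) ∣ ℚ.+ ℚ.∣ (a ℚ.- c) ℚ.* d ∣
    ≤⟨ ℚ.+-mono-≤ (∣*∣-mono {a} {b ℚ.- d} {A} {δ′} a≤A b-d≤δ′)
                  (∣*∣-mono {a ℚ.- c} {d} {δ} {B} a-c≤δ d≤B) ⟩
  A ℚ.* δ′ ℚ.+ δ ℚ.* B ∎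
  where open ℚ.≤-Reasoning

*-cauchy : ∀ {f g} → IsCauchy f → IsCauchy g → IsCauchy (λ n → f n ℚ.* g n)
*-cauchy {f} {g} cf cg ε =
  let (A , A>0 , K , ∣f∣≤A) = cauchy⇒bounded {f} cf
      (B , B>0 , L , ∣g∣≤B) = cauchy⇒bounded {g} cg
      (δ , δ>0 , B*δ)       = scaled B {{B>0}} (½ ℚ.* ε) {{half-pos ε}}
      (δ′ , δ′>0 , A*δ′)    = scaled A {{A>0}} (½ ℚ.* ε) {{half-pos ε}}
      (M , p)               = cf δ {{δ>0}}
      (N , q)               = cg δ′ {{δ′>0}}
      total : A ℚ.* δ′ ℚ.+ δ ℚ.* B ≡ ε
      total = trans (cong₂ ℚ._+_ A*δ′ (trans (ℚ.*-comm δ B) B*δ)) (half+half ε)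
  in (K ℕ.⊔ L) ℕ.⊔ (M ℕ.⊔ N) , λ i j le le′ →
     let KL≤i = ℕ.m⊔n≤o⇒m≤o (K ℕ.⊔ L) (M ℕ.⊔ N) le
         MN≤i = ℕ.m⊔n≤o⇒n≤o (K ℕ.⊔ L) (M ℕ.⊔ N) le
         KL≤j = ℕ.m⊔n≤o⇒m≤o (K ℕ.⊔ L) (M ℕ.⊔ N) le′
         MN≤j = ℕ.m⊔n≤o⇒n≤o (K ℕ.⊔ L) (M ℕ.⊔ N) le′
     in subst (ℚ.∣ f i ℚ.* g i ℚ.- f j ℚ.* g j ∣ ℚ.≤_) total
       (∣*-diff∣ {f i} {g i} {f j} {g j} {A} {B} {δ} {δ′}
         (∣f∣≤A i (ℕ.m⊔n≤o⇒m≤o K L KL≤i))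
         (∣g∣≤B j (ℕ.m⊔n≤o⇒n≤o K L KL≤j))
         (p i j (ℕ.m⊔n≤o⇒m≤o M N MN≤i) (ℕ.m⊔n≤o⇒m≤o M N MN≤j))
         (q i j (ℕ.m⊔n≤o⇒n≤o M N MN≤i) (ℕ.m⊔n≤o⇒n≤o M N MN≤j)))

∣a∣-∣b∣≤∣a-b∣ : ∀ a b → ℚ.∣ a ∣ ℚ.- ℚ.∣ b ∣ ℚ.≤ ℚ.∣ a ℚ.- b ∣
∣a∣-∣b∣≤∣a-b∣ a b = let open ℚ.≤-Reasoning in begin
  ℚ.∣ a ∣ ℚ.- ℚ.∣ b ∣
    ≡⟨ cong (λ z → ℚ.∣ z ∣ ℚ.- ℚ.∣ b ∣) (solve 2 (λ a b → a := (a :- b) :+ b) refl a b) ⟩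
  ℚ.∣ (a ℚ.- b) ℚ.+ b ∣ ℚ.- ℚ.∣ b ∣
    ≤⟨ ℚ.+-monoˡ-≤ (ℚ.- ℚ.∣ b ∣) (ℚ.∣p+q∣≤∣p∣+∣q∣ (a ℚ.- b) b) ⟩
  ℚ.∣ a ℚ.- b ∣ ℚ.+ ℚ.∣ b ∣ ℚ.- ℚ.∣ b ∣
    ≡⟨ solve 2 (λ x y → x :+ y :- y := x) refl ℚ.∣ a ℚ.- b ∣ ℚ.∣ b ∣ ⟩
  ℚ.∣ a ℚ.- b ∣ ∎

∣a-b∣≡∣b-a∣ : ∀ a b → ℚ.∣ a ℚ.- b ∣ ≡ ℚ.∣ b ℚ.- a ∣
∣a-b∣≡∣b-a∣ a b = trans (sym (ℚ.∣-p∣≡∣p∣ (a ℚ.- b)))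
  (cong ℚ.∣_∣ (solve 2 (λ a b → :- (a :- b) := b :- a) refl a b))

∣∣a∣-∣b∣∣≤∣a-b∣ : ∀ a b → ℚ.∣ ℚ.∣ a ∣ ℚ.- ℚ.∣ b ∣ ∣ ℚ.≤ ℚ.∣ a ℚ.- b ∣
∣∣a∣-∣b∣∣≤∣a-b∣ a b with ℚ.∣p∣≡p∨∣p∣≡-p (ℚ.∣ a ∣ ℚ.- ℚ.∣ b ∣)
... | inj₁ eq = subst (ℚ._≤ ℚ.∣ a ℚ.- b ∣) (sym eq) (∣a∣-∣b∣≤∣a-b∣ a b)
... | inj₂ eq = subst₂ ℚ._≤_
  (trans (solve 2 (λ x y → y :- x := :- (x :- y)) refl ℚ.∣ a ∣ ℚ.∣ b ∣) (sym eq))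
  (∣a-b∣≡∣b-a∣ b a) (∣a∣-∣b∣≤∣a-b∣ b a)

∣∣-cauchy : ∀ {f} → IsCauchy f → IsCauchy (λ n → ℚ.∣ f n ∣)
∣∣-cauchy {f} cf ε = let (N , p) = cf ε in N , λ i j le le′ →
  ℚ.≤-trans (∣∣a∣-∣b∣∣≤∣a-b∣ (f i) (f j)) (p i j le le′)

_+_ : ℝ → ℝ → ℝ
seq    (x + y) n = seq x n ℚ.+ seq y n
cauchy (x + y)   = +-cauchy {seq x} {seq y} (cauchy x) (cauchy y)

-_ : ℝ → ℝ
seq    (- x) n = ℚ.- seq x n
cauchy (- x)   = neg-cauchy {seq x} (cauchy x)

_-_ : ℝ → ℝ → ℝ
x - y = x + (- y)

_*_ : ℝ → ℝ → ℝ
seq    (x * y) n = seq x n ℚ.* seq y n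
cauchy (x * y)   = *-cauchy {seq x} {seq y} (cauchy x) (cauchy y)

∣_∣ : ℝ → ℝ
seq    ∣ x ∣ n = ℚ.∣ seq x n ∣
cauchy ∣ x ∣   = ∣∣-cauchy {seq x} (cauchy x)

-- Apartness from zero, needed to invert a real constructively.
record _#0 (x : ℝ) : Set where
  field
    bound    : ℚ
    positive : Positive bound
    away     : ∃[ N ] (∀ n → N ℕ.≤ n → bound ℚ.≤ ℚ.∣ seq x n ∣)

open _#0

-- Extended by 0⁻¹ = 0, so that finitely many vanishing terms of a sequence
-- apart from zero do no harm.
inv₀ : ℚ → ℚ
inv₀ q with q ℚ.≟ 0ℚ
... | yes _   = 0ℚ
... | no  q≢0 = ℚ.1/_ q {{ℚ.≢-nonZero q≢0}}

inv₀-inverseˡ : ∀ {c} q .{{_ : Positive c}} → c ℚ.≤ ℚ.∣ q ∣ → inv₀ q ℚ.* q ≡ 1ℚ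
inv₀-inverseˡ {c} q c≤ with q ℚ.≟ 0ℚ
... | no  q≢0  = ℚ.*-inverseˡ q {{ℚ.≢-nonZero q≢0}}
... | yes refl = contradiction (ℚ.<-≤-trans (ℚ.positive⁻¹ c) c≤) (ℚ.<-irrefl refl)

*-diff′ : ∀ a b u v → a ℚ.* b ℚ.* (u ℚ.- v) ≡ (u ℚ.* a) ℚ.* b ℚ.- (v ℚ.* b) ℚ.* a
*-diff′ = solve 4 (λ a b u v → a :* b :* (u :- v) := (u :* a) :* b :- (v :* b) :* a) refl

inv₀-diff : ∀ {c} a b ε .{{_ : Positive c}} → c ℚ.≤ ℚ.∣ a ∣ → c ℚ.≤ ℚ.∣ b ∣ →
  ℚ.∣ b ℚ.- a ∣ ℚ.≤ c ℚ.* c ℚ.* ε → ℚ.∣ inv₀ a ℚ.- inv₀ b ∣ ℚ.≤ ε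
inv₀-diff {c} a b ε c≤a c≤b b-a≤ = ℚ.*-cancelˡ-≤-pos (c ℚ.* c) {{ℚ.pos*pos⇒pos c c}} (begin
  c ℚ.* c ℚ.* ℚ.∣ u ℚ.- v ∣
    ≤⟨ ℚ.*-monoʳ-≤-nonNeg ℚ.∣ u ℚ.- v ∣ {{ℚ.∣-∣-nonNeg (u ℚ.- v)}} cc≤ab ⟩
  ℚ.∣ a ∣ ℚ.* ℚ.∣ b ∣ ℚ.* ℚ.∣ u ℚ.- v ∣
    ≡⟨ cong (ℚ._* ℚ.∣ u ℚ.- v ∣) (ℚ.∣p*q∣≡∣p∣*∣q∣ a b) ⟨
  ℚ.∣ a ℚ.* b ∣ ℚ.* ℚ.∣ u ℚ.- v ∣
    ≡⟨ ℚ.∣p*q∣≡∣p∣*∣q∣ (a ℚ.* b) (u ℚ.- v) ⟨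
  ℚ.∣ a ℚ.* b ℚ.* (u ℚ.- v) ∣
    ≡⟨ cong ℚ.∣_∣ (*-diff′ a b u v) ⟩
  ℚ.∣ (u ℚ.* a) ℚ.* b ℚ.- (v ℚ.* b) ℚ.* a ∣
    ≡⟨ cong₂ (λ s t → ℚ.∣ s ℚ.* b ℚ.- t ℚ.* a ∣) (inv₀-inverseˡ a c≤a) (inv₀-inverseˡ b c≤b) ⟩
  ℚ.∣ 1ℚ ℚ.* b ℚ.- 1ℚ ℚ.* a ∣
    ≡⟨ cong₂ (λ s t → ℚ.∣ s ℚ.- t ∣) (ℚ.*-identityˡ b) (ℚ.*-identityˡ a) ⟩
  ℚ.∣ b ℚ.- a ∣
    ≤⟨ b-a≤ ⟩
  c ℚ.* c ℚ.* ε ∎)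
  where
  open ℚ.≤-Reasoning
  u v : ℚ
  u = inv₀ a
  v = inv₀ b
  cc≤ab : c ℚ.* c ℚ.≤ ℚ.∣ a ∣ ℚ.* ℚ.∣ b ∣
  cc≤ab = ℚ.≤-trans (ℚ.*-monoʳ-≤-nonNeg c {{ℚ.pos⇒nonNeg c}} c≤a)
                    (ℚ.*-monoˡ-≤-nonNeg ℚ.∣ a ∣ {{ℚ.∣-∣-nonNeg a}} c≤b)

inv₀-cauchy : ∀ x → x #0 → IsCauchy (λ n → inv₀ (seq x n))
inv₀-cauchy x x#0 ε =
  let c = bound x#0
      c>0 = positive x#0
      (M , far) = away x#0
      (N , p) = cauchy x (c ℚ.* c ℚ.* ε)
        {{ℚ.pos*pos⇒pos (c ℚ.* c) {{ℚ.pos*pos⇒pos c {{c>0}} c {{c>0}}}} ε}}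
  in M ℕ.⊔ N , λ i j le le′ → inv₀-diff {c} (seq x i) (seq x j) ε {{c>0}}
       (far i (ℕ.m⊔n≤o⇒m≤o M N le)) (far j (ℕ.m⊔n≤o⇒m≤o M N le′))
       (p j i (ℕ.m⊔n≤o⇒n≤o M N le′) (ℕ.m⊔n≤o⇒n≤o M N le))

1/_ : (x : ℝ) {{_ : x #0}} → ℝ
seq    (1/ x) n         = inv₀ (seq x n)
cauchy ((1/ x) {{x#0}}) = inv₀-cauchy x x#0

instance
  fromℚ-#0 : ∀ {q} {{_ : Positive q}} → fromℚ q #0
  bound    (fromℚ-#0 {q})          = q
  positive (fromℚ-#0 {{q>0}})      = q>0
  away     (fromℚ-#0 {q} {{q>0}}) = 0 , λ _ _ →
    ℚ.≤-reflexive (sym (ℚ.0≤p⇒∣p∣≡p (ℚ.<⇒≤ (ℚ.positive⁻¹ q {{q>0}}))))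

  *-#0 : ∀ {x y} {{_ : x #0}} {{_ : y #0}} → (x * y) #0
  bound    (*-#0 {{x#0}} {{y#0}}) = bound x#0 ℚ.* bound y#0
  positive (*-#0 {{x#0}} {{y#0}}) =
    ℚ.pos*pos⇒pos (bound x#0) {{positive x#0}} (bound y#0) {{positive y#0}}
  away     (*-#0 {x} {y} {{x#0}} {{y#0}}) =
    let (M , p) = away x#0
        (N , q) = away y#0
    in M ℕ.⊔ N , λ n le → subst (bound x#0 ℚ.* bound y#0 ℚ.≤_)
      (sym (ℚ.∣p*q∣≡∣p∣*∣q∣ (seq x n) (seq y n)))
      (ℚ.≤-trans
        (ℚ.*-monoʳ-≤-nonNeg (bound y#0) {{ℚ.pos⇒nonNeg (bound y#0) {{positive y#0}}}}
          (p n (ℕ.m⊔n≤o⇒m≤o M N le)))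
        (ℚ.*-monoˡ-≤-nonNeg ℚ.∣ seq x n ∣ {{ℚ.∣-∣-nonNeg (seq x n)}}
          (q n (ℕ.m⊔n≤o⇒n≤o M N le))))

-- Limit of a sequence indexed by the positive integers.
infix 4 _⟶_
_⟶_ : ((X : ℕ) .{{_ : NonZero X}} → ℝ) → ℝ → Set
a ⟶ l = ∀ ε .{{_ : Positive ε}} →
  ∃[ N ] (∀ X .{{_ : NonZero X}} → N ℕ.≤ X → ∣ a X - l ∣ ≤ fromℚ ε)

-- Sum of a family over a (possibly infinite) index set, independently of any
-- ordering of the indices: the limit of the finite subsums, where a finite set
-- is a list without repetitions.
HasSum : {I : Set} → (I → ℝ) → ℝ → Set
HasSum {I} a s = ∀ ε .{{_ : Positive ε}} → ∃[ F ] (∀ (G : List I) → Unique G → F ⊆ G →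
  ∣ foldr _+_ (fromℚ 0ℚ) (map a G) - s ∣ ≤ fromℚ ε)

-- ∑ X f = f 1 + ⋯ + f X
∑ : ℕ → ((x : ℕ) .{{_ : NonZero x}} → ℚ) → ℚ
∑ zero    f = 0ℚ
∑ (suc X) f = ∑ X f ℚ.+ f (suc X)

1/_^_ : (n s : ℕ) .{{_ : NonZero n}} → ℚ
1/ n ^ s = ℚ._/_ 1ℤ (n ℕ.^ s) {{ℕ.m^n≢0 n s}}

∑1/n^ : ℕ → ℕ → ℚ
∑1/n^ s N = ∑ N (λ n → 1/ n ^ s)

/-nonNeg : ∀ p .{{_ : NonZero p}} → ℚ.NonNegative (1ℤ ℚ./ p)
/-nonNeg p = ℚ.normalize-nonNeg 1 p

cross-≤ : ∀ k p → suc k ℕ.* suc k ℕ.≤ p →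
  (1 ℕ.* suc k ℕ.+ 1 ℕ.* p) ℕ.* k ℕ.≤ 1 ℕ.* (p ℕ.* suc k)
cross-≤ k p le = begin
  (1 ℕ.* suc k ℕ.+ 1 ℕ.* p) ℕ.* k
    ≡⟨ cong (ℕ._* k) (cong₂ ℕ._+_ (ℕ.*-identityˡ (suc k)) (ℕ.*-identityˡ p)) ⟩
  (suc k ℕ.+ p) ℕ.* k           ≡⟨ ℕ.*-distribʳ-+ k (suc k) p ⟩
  suc k ℕ.* k ℕ.+ p ℕ.* k       ≤⟨ ℕ.+-monoˡ-≤ (p ℕ.* k) (ℕ.*-monoʳ-≤ (suc k) (ℕ.n≤1+n k)) ⟩
  suc k ℕ.* suc k ℕ.+ p ℕ.* k   ≤⟨ ℕ.+-monoˡ-≤ (p ℕ.* k) le ⟩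
  p ℕ.+ p ℕ.* k                 ≡⟨ ℕ.*-suc p k ⟨
  p ℕ.* suc k                   ≡⟨ ℕ.*-identityˡ (p ℕ.* suc k) ⟨
  1 ℕ.* (p ℕ.* suc k)           ∎
  where open ℕ.≤-Reasoning

1/p+1/n≤1/k : ∀ k p .{{_ : NonZero k}} .{{_ : NonZero p}} → suc k ℕ.* suc k ℕ.≤ p →
  1ℤ ℚ./ p ℚ.+ 1ℤ ℚ./ suc k ℚ.≤ 1ℤ ℚ./ k
1/p+1/n≤1/k k@(suc k′) p@(suc p′) le = ℚ.toℚᵘ-cancel-≤ (begin
  ℚ.toℚᵘ (1ℤ ℚ./ p ℚ.+ 1ℤ ℚ./ suc k)
    ≃⟨ ℚ.toℚᵘ-homo-+ (1ℤ ℚ./ p) (1ℤ ℚ./ suc k) ⟩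
  ℚ.toℚᵘ (1ℤ ℚ./ p) ℚᵘ.+ ℚ.toℚᵘ (1ℤ ℚ./ suc k)
    ≃⟨ ℚᵘ.+-cong (ℚ.toℚᵘ-fromℚᵘ (ℚᵘ.mkℚᵘ 1ℤ p′)) (ℚ.toℚᵘ-fromℚᵘ (ℚᵘ.mkℚᵘ 1ℤ k)) ⟩
  ℚᵘ.mkℚᵘ 1ℤ p′ ℚᵘ.+ ℚᵘ.mkℚᵘ 1ℤ k
    ≤⟨ ℚᵘ.*≤* (ℤ.+≤+ (cross-≤ k p le)) ⟩
  ℚᵘ.mkℚᵘ 1ℤ k′
    ≃⟨ ℚ.toℚᵘ-fromℚᵘ (ℚᵘ.mkℚᵘ 1ℤ k′) ⟨
  ℚ.toℚᵘ (1ℤ ℚ./ k) ∎)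
  where
  open ℚᵘ.≤-Reasoning

∑1/n^-mono : ∀ s {i j} → i ℕ.≤′ j → ∑1/n^ s i ℚ.≤ ∑1/n^ s j
∑1/n^-mono s (ℕ.≤′-reflexive refl) = ℚ.≤-refl
∑1/n^-mono s {i} {suc j} (ℕ.≤′-step le) = begin
  ∑1/n^ s i                   ≤⟨ ∑1/n^-mono s le ⟩
  ∑1/n^ s j                   ≡⟨ ℚ.+-identityʳ _ ⟨
  ∑1/n^ s j ℚ.+ 0ℚ            ≤⟨ ℚ.+-monoʳ-≤ (∑1/n^ s j) (ℚ.nonNegative⁻¹ (1/ suc j ^ s)
                                   {{/-nonNeg (suc j ℕ.^ s) {{ℕ.m^n≢0 (suc j) s}}}}) ⟩
  ∑1/n^ s (suc j)             ∎
  where open ℚ.≤-Reasoning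

-- Telescoping: N ↦ ∑_{n ≤ N} 1/n^s + 1/N decreases, as 1/(N(N+1)) = 1/N - 1/(N+1).
∑1/n^+1/N-anti : ∀ s → 2 ℕ.≤ s → ∀ {i j} → .{{_ : NonZero i}} → .{{_ : NonZero j}} → i ℕ.≤′ j →
  ∑1/n^ s j ℚ.+ 1ℤ ℚ./ j ℚ.≤ ∑1/n^ s i ℚ.+ 1ℤ ℚ./ i
∑1/n^+1/N-anti s 2≤s (ℕ.≤′-reflexive refl) = ℚ.≤-refl
∑1/n^+1/N-anti s 2≤s {suc i} {suc zero} (ℕ.≤′-step (ℕ.≤′-reflexive ()))
∑1/n^+1/N-anti s 2≤s {i} {suc j@(suc _)} (ℕ.≤′-step le) = begin
  ∑1/n^ s j ℚ.+ 1/ suc j ^ s ℚ.+ 1ℤ ℚ./ suc j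
    ≡⟨ ℚ.+-assoc (∑1/n^ s j) (1/ suc j ^ s) (1ℤ ℚ./ suc j) ⟩
  ∑1/n^ s j ℚ.+ (1/ suc j ^ s ℚ.+ 1ℤ ℚ./ suc j)
    ≤⟨ ℚ.+-monoʳ-≤ (∑1/n^ s j) (1/p+1/n≤1/k j (suc j ℕ.^ s) {{_}} {{ℕ.m^n≢0 (suc j) s}} sq≤) ⟩
  ∑1/n^ s j ℚ.+ 1ℤ ℚ./ j
    ≤⟨ ∑1/n^+1/N-anti s 2≤s le ⟩
  ∑1/n^ s i ℚ.+ 1ℤ ℚ./ i ∎
  where
  open ℚ.≤-Reasoning
  sq≤ : suc j ℕ.* suc j ℕ.≤ suc j ℕ.^ s
  sq≤ = subst (ℕ._≤ suc j ℕ.^ s) (cong (suc j ℕ.*_) (ℕ.*-identityʳ (suc j)))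
          (ℕ.^-monoʳ-≤ (suc j) 2≤s)

archimedean : ∀ ε .{{_ : Positive ε}} → ∃[ N ] (1ℤ ℚ./ suc N ℚ.≤ ε)
archimedean (mkℚ (+ suc p) d c) = d , ℚ.toℚᵘ-cancel-≤ (begin
  ℚ.toℚᵘ (1ℤ ℚ./ suc d)       ≃⟨ ℚ.toℚᵘ-fromℚᵘ (ℚᵘ.mkℚᵘ 1ℤ d) ⟩
  ℚᵘ.mkℚᵘ 1ℤ d                ≤⟨ ℚᵘ.*≤* (ℤ.+≤+ (ℕ.*-monoˡ-≤ (suc d) (s≤s (z≤n {p})))) ⟩
  ℚᵘ.mkℚᵘ (+ suc p) d         ∎)
  where open ℚᵘ.≤-Reasoning

p≤q⇒0≤q-p : ∀ {p q} → p ℚ.≤ q → 0ℚ ℚ.≤ q ℚ.- p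
p≤q⇒0≤q-p {p} {q} p≤q = subst (ℚ._≤ q ℚ.- p) (ℚ.+-inverseʳ p) (ℚ.+-monoˡ-≤ (ℚ.- p) p≤q)

∑1/n^-gap : ∀ s → 2 ℕ.≤ s → ∀ N {i j} → suc N ℕ.≤ i → i ℕ.≤ j →
  ℚ.∣ ∑1/n^ s j ℚ.- ∑1/n^ s i ∣ ℚ.≤ 1ℤ ℚ./ suc N
∑1/n^-gap s 2≤s N {i@(suc _)} {j@(suc _)} N<i i≤j = begin
  ℚ.∣ S j ℚ.- S i ∣                     ≡⟨ ℚ.0≤p⇒∣p∣≡p (p≤q⇒0≤q-p (mono (ℕ.≤⇒≤′ i≤j))) ⟩
  S j ℚ.- S i                           ≤⟨ ℚ.+-monoʳ-≤ (S j) (ℚ.neg-antimono-≤ (mono (ℕ.≤⇒≤′ N<i))) ⟩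
  S j ℚ.- S (suc N)                     ≤⟨ ℚ.+-monoˡ-≤ (ℚ.- S (suc N)) upper ⟩
  S (suc N) ℚ.+ 1ℤ ℚ./ suc N ℚ.- S (suc N)
    ≡⟨ solve 2 (λ x y → x :+ y :- x := y) refl (S (suc N)) (1ℤ ℚ./ suc N) ⟩
  1ℤ ℚ./ suc N                          ∎
  where
  open ℚ.≤-Reasoning
  S = ∑1/n^ s
  mono : ∀ {i j} → i ℕ.≤′ j → S i ℚ.≤ S j
  mono = ∑1/n^-mono s
  upper : S j ℚ.≤ S (suc N) ℚ.+ 1ℤ ℚ./ suc N
  upper = begin
    S j                            ≡⟨ ℚ.+-identityʳ (S j) ⟨
    S j ℚ.+ 0ℚ                     ≤⟨ ℚ.+-monoʳ-≤ (S j) (ℚ.nonNegative⁻¹ (1ℤ ℚ./ j) {{/-nonNeg j}}) ⟩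
    S j ℚ.+ 1ℤ ℚ./ j               ≤⟨ ∑1/n^+1/N-anti s 2≤s (ℕ.≤⇒≤′ (ℕ.≤-trans N<i i≤j)) ⟩
    S (suc N) ℚ.+ 1ℤ ℚ./ suc N     ∎

∑1/n^-cauchy : ∀ s → 2 ℕ.≤ s → IsCauchy (∑1/n^ s)
∑1/n^-cauchy s 2≤s ε with archimedean ε
... | N , 1/N≤ε = suc N , bnd
  where
  bnd : ∀ i j → suc N ℕ.≤ i → suc N ℕ.≤ j → ℚ.∣ ∑1/n^ s i ℚ.- ∑1/n^ s j ∣ ℚ.≤ ε
  bnd i j N<i N<j with ℕ.≤-total i j
  ... | inj₁ i≤j = subst (ℚ._≤ ε) (∣a-b∣≡∣b-a∣ (∑1/n^ s j) (∑1/n^ s i))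
                     (ℚ.≤-trans (∑1/n^-gap s 2≤s N N<i i≤j) 1/N≤ε)
  ... | inj₂ j≤i = ℚ.≤-trans (∑1/n^-gap s 2≤s N N<j j≤i) 1/N≤ε

-- The Riemann zeta function at the integers s ≥ 2, as the sum of its Dirichlet series.
ζ : (s : ℕ) → 2 ℕ.≤ s → ℝ
seq    (ζ s _)   = ∑1/n^ s
cauchy (ζ s 2≤s) = ∑1/n^-cauchy s 2≤s

instance
  ζ-#0 : ∀ {s} {2≤s : 2 ℕ.≤ s} → ζ s 2≤s #0
  bound    ζ-#0             = 1ℚ
  positive ζ-#0             = _
  away     (ζ-#0 {s}) = 1 , λ n 1≤n → let open ℚ.≤-Reasoning in begin
    1ℚ                  ≡⟨ ∑1/n^[1] ⟨
    ∑1/n^ s 1           ≤⟨ ∑1/n^-mono s (ℕ.≤⇒≤′ 1≤n) ⟩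
    ∑1/n^ s n           ≡⟨ ℚ.0≤p⇒∣p∣≡p (∑1/n^-mono s {0} {n} (ℕ.≤⇒≤′ z≤n)) ⟨
    ℚ.∣ ∑1/n^ s n ∣     ∎
    where
    ∑1/n^[1] : ∑1/n^ s 1 ≡ 1ℚ
    ∑1/n^[1] = trans (ℚ.+-identityˡ (1/ 1 ^ s))
      (ℚ./-cong {p₁ = 1ℤ} {q₁ = 1 ℕ.^ s} {p₂ = 1ℤ} {q₂ = 1} {{ℕ.m^n≢0 1 s}} refl (ℕ.^-zeroˡ s))

μ : (n : ℕ) .{{_ : NonZero n}} → ℤ
μ n = if does (unique? ps) then -1ℤ ℤ.^ length ps else 0ℤ
  where ps = factors (factorise n)

-- y - ⌊y⌋; the library's fracPart truncates towards zero instead.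
frac : ℚ → ℚ
frac y = y ℚ.- ⌊ y ⌋ ℚ./ 1

summand : (m n : ℕ) .{{_ : NonZero m}} .{{_ : NonZero n}} → ℕ → ℚ
summand m n x =
  μ m ℤ.* μ n / (m ℕ.* n) ℚ.*
    (    frac (+ x / n)         ℚ.* frac (+ x / m)
     ℚ.- frac (+ (2 ℕ.* x) / n) ℚ.* frac (+ x / m)
     ℚ.- frac (+ x / n)         ℚ.* frac (+ (2 ℕ.* x) / m)
     ℚ.+ frac (+ (2 ℕ.* x) / n) ℚ.* frac (+ (2 ℕ.* x) / m))
  where instance _ = ℕ.m*n≢0 m n

{-# OPTIONS --safe #-}
-- Since {x/m} - {2x/m} =: c_m(x)/m with c_m an m-periodic integer sequence, the inner limit is
-- μ(m)μ(n)/(mn)² times κ(m,n), the mean of c_m c_n over a period.  A correlation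
-- ∑ c_m(x + u) c_n(x) has both periods m and n in u, hence the period d = gcd(m,n); averaging over
-- shifts by multiples of d reduces κ(m,n) to a sum over one residue system modulo d.  For m, n odd
-- this gives κ(m,n) = (d² - 1)/12, κ(2m,n) = κ(m,2n) = -(d² - 1)/24 and κ(2m,2n) = (4d² + 2)/12.
--
-- Summing over all m, n dividing 2 p₁ ⋯ p_k, the sums ∑ μ(m)μ(n) d²/(mn)² and ∑ μ(m)μ(n)/(mn)² are
-- finite Euler products, and the total is exactly E/6 - E²/6 with E = ∏ (1 - 1/p²); a sieve with
-- explicit error terms shows that E ζ(2) tends to 1.  Every other finite sum that contains a large
-- square of indices differs from such a total by a tail of ∑ d²/(mn)², which is at most the tail of
-- ζ(2)³ because (m,n) ↦ (d, m/d, n/d) is injective.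
module Submission where

-- The obstacle is the unordered sum: `HasSum` admits every finite set G that contains the chosen F,
-- and the terms have size gcd(m,n)²/(mn)², which is not a product of a weight in m and a weight in
-- n. The primes are therefore chosen after G. Once they include all primes up to the largest entry
-- of G, the finite set D of pairs of squarefree products of them contains every pair of G whose
-- term is nonzero. The total over D is known exactly, and D minus G avoids the square of indices
-- contained in G, so a single tail estimate suffices, uniform in the number of primes used.
--
-- All estimates are made in ℚ. The k-th rational of the target real is the closed form with ζ(2)
-- replaced by its partial sum S, so E/6 - E²/6 has to be compared with 1/(6S) - 1/(6S²). The
-- difference is at most |E S - 1|, and the sieve makes this small for all k beyond a bound that may
-- depend on G.
--
-- The parity cases have a common origin: {y} - {2y} = B(y) - B(2y) for the Bernoulli function B(y)
-- = {y} - 1/2. Doubling permutes a cyclic group of odd order but covers half of one of even order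
-- twice.

module Means where

  open import Data.Bool.Base using (if_then_else_)
  open import Data.Integer.Base as ℤ using (ℤ; 0ℤ; 1ℤ; -1ℤ)
  import Data.Integer.Properties as ℤ
  open import Data.List.Base
    using (List; []; _∷_; _++_; map; length; foldr; filter; upTo; applyDownFrom; cartesianProduct)
  open import Data.List.Membership.DecPropositional using (_∈?_)
  open import Data.List.Membership.Propositional using (_∈_; _∉_)
  open import Data.List.Membership.Propositional.Properties
    using ( ∈-∃++; ∈-++⁺ˡ; ∈-++⁺ʳ; ∈-++⁻; ∈-map⁺; ∈-map⁻; ∈-filter⁺; ∈-filter⁻; ∈-upTo⁺
          ; ∈-applyDownFrom⁺; ∈-applyDownFrom⁻; ∈-cartesianProduct⁺; ∈-cartesianProduct⁻ )
  open import Data.List.Relation.Binary.Permutation.Propositional as ↭ using (_↭_; ↭-sym; ↭⇒↭ₛ)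
  open import Data.List.Relation.Binary.Permutation.Propositional.Properties
    using (shift; ∈-resp-↭; ↭-length)
  open import Data.List.Relation.Binary.Permutation.Setoid.Properties using (Unique-resp-↭)
  open import Data.List.Relation.Binary.Subset.Propositional using (_⊆_)
  open import Data.List.Relation.Unary.All as All using (All; []; _∷_)
  open import Data.List.Relation.Unary.All.Properties using (¬Any⇒All¬)
  open import Data.List.Relation.Unary.AllPairs using ([]; _∷_)
  open import Data.List.Relation.Unary.Any using (here; there)
  open import Data.List.Relation.Unary.Unique.Propositional using (Unique)
  open import Data.List.Relation.Unary.Unique.Propositional.Properties
    using (map⁺; ++⁺; filter⁺; upTo⁺; applyDownFrom⁺₁; cartesianProduct⁺; Unique[x∷xs]⇒x∉xs)
  open import Data.Nat.Base as ℕ using (ℕ; zero; suc; NonZero; z≤n; s≤s)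
  open import Data.Nat.Coprimality as Coprime using (Coprime; coprime⇒gcd≡1; coprime-/gcd; coprime-divisor)
  open import Data.Nat.Divisibility
    using ( _∣_; _∤_; _∣?_; divides; quotient; quotient-∣; quotient≢0; m∣n⇒n≡quotient*m; _∣0; 1∣_
          ; ∣-refl; ∣-trans; ∣-antisym; ∣⇒≤; ∣1⇒≡1; m∣m*n; n∣m*n; ∣m+n∣m⇒∣n; *-monoʳ-∣; *-cancelˡ-∣ )
  open import Data.Nat.DivMod
    using ( _%_; m≡m%n+[m/n]*n; m%n<n; m%n%n≡m%n; m<n⇒m%n≡m; [m+n]%n≡m%n; m≤n⇒[n∸m]%m≡n%m
          ; m%n*o≡m*o%[n*o]; %-congʳ; %-distribˡ-*; m/n*n≡m )
  open import Data.Nat.GCD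
    using ( gcd; gcd-GCD; gcd-comm; gcd-greatest; gcd[m,n]∣m; gcd[m,n]∣n; gcd[m,n]≢0
          ; c*gcd[m,n]≡gcd[cm,cn]; module Bézout )
  open import Data.Nat.ListAction using (product)
  open import Data.Nat.Primality
    using (Prime; prime?; prime[2]; ¬prime[1]; prime⇒irreducible; prime⇒nonZero; euclidsLemma)
  open import Data.Nat.Primality.Factorisation
    using (PrimeFactorisation; factorise; factors; factorisationUnique; factorisationHasAllPrimeFactors)
  import Data.Nat.Properties as ℕ
  import Data.Nat.Solver
  open import Data.List.Relation.Unary.Unique.DecPropositional ℕ._≟_ using (unique?)
  open import Data.Product.Base using (∃-syntax; _×_; _,_; proj₁; proj₂)
  open import Data.Product.Properties using (,-injective; ≡-dec)
  open import Data.Rational.Base hiding (NonZero; floor)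
  import Data.Rational.Properties as ℚ
  open import Data.Rational.Solver using (module +-*-Solver)
  import Data.Rational.Unnormalised.Base as ℚᵘ
  import Data.Rational.Unnormalised.Properties as ℚᵘ
  open import Data.Sum.Base using (_⊎_; inj₁; inj₂)
  import Defs as ℝ
  open import Defs hiding (_+_; _*_; _-_; -_; 1/_; _≤_; ∣_∣)
  open import Relation.Binary.Definitions using (DecidableEquality)
  open import Relation.Binary.PropositionalEquality
  open import Relation.Nullary using (¬_; ¬?; _×-dec_; Dec; does; yes; no; contradiction)
  open import Relation.Nullary.Decidable using (dec-true; dec-false)

  open +-*-Solver using (solve; _:+_; _:*_; _:-_; :-_; _:=_; con; Polynomial)
  module ℕ-Solver = Data.Nat.Solver.+-*-Solver

  -- Natural numbers and their reciprocals in ℚ, and order in ℚ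

  /-* : ∀ i j m n .{{_ : NonZero m}} .{{_ : NonZero n}} →
    (i / m) * (j / n) ≡ _/_ (i ℤ.* j) (m ℕ.* n) {{ℕ.m*n≢0 m n}}
  /-* i j (suc m) (suc n) = ℚ.toℚᵘ-injective (begin
    toℚᵘ ((i / suc m) * (j / suc n))
      ≈⟨ ℚ.toℚᵘ-homo-* (i / suc m) (j / suc n) ⟩
    toℚᵘ (i / suc m) ℚᵘ.* toℚᵘ (j / suc n)
      ≈⟨ ℚᵘ.*-cong (ℚ.toℚᵘ-fromℚᵘ (ℚᵘ.mkℚᵘ i m)) (ℚ.toℚᵘ-fromℚᵘ (ℚᵘ.mkℚᵘ j n)) ⟩
    ℚᵘ.mkℚᵘ i m ℚᵘ.* ℚᵘ.mkℚᵘ j n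
      ≈⟨ ℚ.toℚᵘ-fromℚᵘ (ℚᵘ.mkℚᵘ i m ℚᵘ.* ℚᵘ.mkℚᵘ j n) ⟨
    toℚᵘ ((i ℤ.* j) / (suc m ℕ.* suc n)) ∎)
    where open ℚᵘ.≃-Reasoning

  n/n≡1 : ∀ n → ℤ.+ suc n / suc n ≡ 1ℚ
  n/n≡1 n = ℚ.toℚᵘ-injective (ℚᵘ.≃-trans (ℚ.toℚᵘ-fromℚᵘ (ℚᵘ.mkℚᵘ (ℤ.+ suc n) n))
    (ℚᵘ.*≡* (ℤ.*-comm (ℤ.+ suc n) (ℤ.+ 1))))

  /1-suc : ∀ n → ℤ.+ suc n / 1 ≡ 1ℚ + ℤ.+ n / 1
  /1-suc n = ℚ.toℚᵘ-injective (begin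
    toℚᵘ (ℤ.+ suc n / 1)                  ≈⟨ ℚ.toℚᵘ-fromℚᵘ (ℚᵘ.mkℚᵘ (ℤ.+ suc n) 0) ⟩
    ℚᵘ.mkℚᵘ (ℤ.+ suc n) 0                 ≈⟨ ℚᵘ.*≡* (cong (λ z → (1ℤ ℤ.+ z) ℤ.* 1ℤ) (sym (ℤ.*-identityʳ (ℤ.+ n)))) ⟩
    ℚᵘ.mkℚᵘ (ℤ.+ 1) 0 ℚᵘ.+ ℚᵘ.mkℚᵘ (ℤ.+ n) 0
      ≈⟨ ℚᵘ.+-congʳ (ℚᵘ.mkℚᵘ (ℤ.+ 1) 0) (ℚ.toℚᵘ-fromℚᵘ (ℚᵘ.mkℚᵘ (ℤ.+ n) 0)) ⟨
    toℚᵘ 1ℚ ℚᵘ.+ toℚᵘ (ℤ.+ n / 1)         ≈⟨ ℚ.toℚᵘ-homo-+ 1ℚ (ℤ.+ n / 1) ⟨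
    toℚᵘ (1ℚ + ℤ.+ n / 1)                 ∎)
    where open ℚᵘ.≃-Reasoning

  -- Recursive, so that `ι (suc n)` unfolds to 1 + `ι n` and inductions over ℕ end in ring
  -- identities.
  ι : ℕ → ℚ
  ι zero    = 0ℚ
  ι (suc n) = 1ℚ + ι n

  /1≡ι : ∀ n → ℤ.+ n / 1 ≡ ι n
  /1≡ι zero    = refl
  /1≡ι (suc n) = trans (/1-suc n) (cong (1ℚ +_) (/1≡ι n))

  ι-+ : ∀ m n → ι (m ℕ.+ n) ≡ ι m + ι n
  ι-+ zero    n = sym (ℚ.+-identityˡ (ι n))
  ι-+ (suc m) n = trans (cong (1ℚ +_) (ι-+ m n)) (sym (ℚ.+-assoc 1ℚ (ι m) (ι n)))

  ι-* : ∀ m n → ι (m ℕ.* n) ≡ ι m * ι n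
  ι-* zero    n = sym (ℚ.*-zeroˡ (ι n))
  ι-* (suc m) n = trans (ι-+ n (m ℕ.* n)) (trans (cong (ι n +_) (ι-* m n))
    (solve 2 (λ a b → b :+ a :* b := (con 1ℚ :+ a) :* b) refl (ι m) (ι n)))

  -- 1/n, extended by r 0 = 0 to keep it multiplicative
  r : ℕ → ℚ
  r zero    = 0ℚ
  r (suc n) = 1ℤ / suc n

  /≡ι*r : ∀ x n .{{_ : NonZero n}} → ℤ.+ x / n ≡ ι x * r n
  /≡ι*r x (suc n) = begin
    ℤ.+ x / suc n                      ≡⟨ ℚ./-cong (sym (ℤ.*-identityʳ (ℤ.+ x))) (sym (ℕ.*-identityˡ (suc n))) ⟩
    (ℤ.+ x ℤ.* 1ℤ) / (1 ℕ.* suc n)     ≡⟨ /-* (ℤ.+ x) 1ℤ 1 (suc n) ⟨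
    (ℤ.+ x / 1) * (1ℤ / suc n)         ≡⟨ cong (_* (1ℤ / suc n)) (/1≡ι x) ⟩
    ι x * r (suc n)                  ∎
    where open ≡-Reasoning

  ι*r≡1 : ∀ n .{{_ : NonZero n}} → ι n * r n ≡ 1ℚ
  ι*r≡1 (suc n) = trans (sym (/≡ι*r (suc n) (suc n))) (n/n≡1 n)

  r-* : ∀ m n → r (m ℕ.* n) ≡ r m * r n
  r-* zero    n       = sym (ℚ.*-zeroˡ (r n))
  r-* (suc m) zero    = trans (cong r (ℕ.*-zeroʳ (suc m))) (sym (ℚ.*-zeroʳ (r (suc m))))
  r-* (suc m) (suc n) = sym (/-* 1ℤ 1ℤ (suc m) (suc n))

  0≤ι : ∀ n → 0ℚ ≤ ι n
  0≤ι zero    = ℚ.≤-refl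
  0≤ι (suc n) = ℚ.+-mono-≤ {0ℚ} {1ℚ} (ℚ.nonNegative⁻¹ 1ℚ) (0≤ι n)

  ι-mono : ∀ {m n} → m ℕ.≤ n → ι m ≤ ι n
  ι-mono {n = n} z≤n = 0≤ι n
  ι-mono (s≤s p)     = ℚ.+-monoʳ-≤ 1ℚ (ι-mono p)

  0≤r : ∀ n → 0ℚ ≤ r n
  0≤r zero    = ℚ.≤-refl
  0≤r (suc n) = ℚ.nonNegative⁻¹ (r (suc n)) {{ℚ.normalize-nonNeg 1 (suc n)}}

  0≤+ : ∀ {p q} → 0ℚ ≤ p → 0ℚ ≤ q → 0ℚ ≤ p + q
  0≤+ = ℚ.+-mono-≤

  *-monoˡ : ∀ {p q s} → 0ℚ ≤ s → p ≤ q → s * p ≤ s * q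
  *-monoˡ {s = s} 0≤s = ℚ.*-monoˡ-≤-nonNeg s {{nonNegative 0≤s}}

  *-monoʳ : ∀ {p q s} → 0ℚ ≤ s → p ≤ q → p * s ≤ q * s
  *-monoʳ {s = s} 0≤s = ℚ.*-monoʳ-≤-nonNeg s {{nonNegative 0≤s}}

  0≤* : ∀ {p q} → 0ℚ ≤ p → 0ℚ ≤ q → 0ℚ ≤ p * q
  0≤* {p} {q} 0≤p 0≤q = subst (_≤ p * q) (ℚ.*-zeroʳ p) (*-monoˡ 0≤p 0≤q)

  *-mono-≤ : ∀ {p q s t} → 0ℚ ≤ p → 0ℚ ≤ t → p ≤ q → s ≤ t → p * s ≤ q * t
  *-mono-≤ 0≤p 0≤t p≤q s≤t = ℚ.≤-trans (*-monoˡ 0≤p s≤t) (*-monoʳ 0≤t p≤q)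

  0≤q-p⇒p≤q : ∀ {p q} → 0ℚ ≤ q - p → p ≤ q
  0≤q-p⇒p≤q {p} {q} h = subst₂ _≤_ (ℚ.+-identityˡ p)
    (solve 2 (λ p q → (q :- p) :+ p := q) refl p q) (ℚ.+-monoˡ-≤ p h)

  p≤p+q : ∀ {p q} → 0ℚ ≤ q → p ≤ p + q
  p≤p+q {p} {q} 0≤q = subst (_≤ p + q) (ℚ.+-identityʳ p) (ℚ.+-monoʳ-≤ p 0≤q)

  ∣∣-≤ : ∀ {p q} → p ≤ q → - p ≤ q → ∣ p ∣ ≤ q
  ∣∣-≤ {p} {q} a b with ℚ.∣p∣≡p∨∣p∣≡-p p
  ... | inj₁ e = subst (_≤ q) (sym e) a
  ... | inj₂ e = subst (_≤ q) (sym e) b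

  1≤ι : ∀ n .{{_ : NonZero n}} → 1ℚ ≤ ι n
  1≤ι (suc n) = p≤p+q (0≤ι n)

  r≤1 : ∀ n → r n ≤ 1ℚ
  r≤1 zero    = ℚ.nonNegative⁻¹ 1ℚ
  r≤1 (suc n) = subst₂ _≤_ (ℚ.*-identityˡ _) (ι*r≡1 (suc n)) (*-monoʳ (0≤r (suc n)) (1≤ι (suc n)))

  *-cancelˡ : ∀ n {p q} .{{_ : NonZero n}} → ι n * p ≡ ι n * q → p ≡ q
  *-cancelˡ n {p} {q} e = begin
    p               ≡⟨ lem p ⟨
    r n * (ι n * p) ≡⟨ cong (r n *_) e ⟩
    r n * (ι n * q) ≡⟨ lem q ⟩
    q               ∎
    where
    open ≡-Reasoning
    lem : ∀ t → r n * (ι n * t) ≡ t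
    lem t = trans (solve 3 (λ a b c → a :* (b :* c) := (b :* a) :* c) refl (r n) (ι n) t)
      (trans (cong (_* t) (ι*r≡1 n)) (ℚ.*-identityˡ t))

  -- Finite sums

  Sum : ℕ → (ℕ → ℚ) → ℚ
  Sum zero    f = 0ℚ
  Sum (suc n) f = Sum n f + f n

  Sum-cong< : ∀ n {f g : ℕ → ℚ} → (∀ i → i ℕ.< n → f i ≡ g i) → Sum n f ≡ Sum n g
  Sum-cong< zero    e = refl
  Sum-cong< (suc n) e = cong₂ _+_ (Sum-cong< n (λ i i<n → e i (ℕ.m<n⇒m<1+n i<n))) (e n ℕ.≤-refl)

  Sum-cong : ∀ n {f g : ℕ → ℚ} → (∀ i → f i ≡ g i) → Sum n f ≡ Sum n g
  Sum-cong n e = Sum-cong< n (λ i _ → e i)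

  Sum-mono : ∀ n {f g : ℕ → ℚ} → (∀ i → i ℕ.< n → f i ≤ g i) → Sum n f ≤ Sum n g
  Sum-mono zero    e = ℚ.≤-refl
  Sum-mono (suc n) e = ℚ.+-mono-≤ (Sum-mono n (λ i i<n → e i (ℕ.m<n⇒m<1+n i<n))) (e n ℕ.≤-refl)

  Sum-split : ∀ m n f → Sum (m ℕ.+ n) f ≡ Sum m f + Sum n (λ i → f (m ℕ.+ i))
  Sum-split m zero f = trans (cong (λ z → Sum z f) (ℕ.+-identityʳ m)) (sym (ℚ.+-identityʳ _))
  Sum-split m (suc n) f = trans (cong (λ z → Sum z f) (ℕ.+-suc m n))
    (trans (cong (_+ f (m ℕ.+ n)) (Sum-split m n f)) (ℚ.+-assoc (Sum m f) _ _))

  Sum-+ : ∀ n f g → Sum n (λ i → f i + g i) ≡ Sum n f + Sum n g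
  Sum-+ zero    f g = refl
  Sum-+ (suc n) f g = trans (cong (_+ (f n + g n)) (Sum-+ n f g))
    (solve 4 (λ a b c d → (a :+ b) :+ (c :+ d) := (a :+ c) :+ (b :+ d)) refl
      (Sum n f) (Sum n g) (f n) (g n))

  Sum-*ˡ : ∀ n c f → Sum n (λ i → c * f i) ≡ c * Sum n f
  Sum-*ˡ zero    c f = sym (ℚ.*-zeroʳ c)
  Sum-*ˡ (suc n) c f = trans (cong (_+ c * f n) (Sum-*ˡ n c f)) (sym (ℚ.*-distribˡ-+ c (Sum n f) (f n)))

  Sum-const : ∀ n c → Sum n (λ _ → c) ≡ ι n * c
  Sum-const zero    c = sym (ℚ.*-zeroˡ c)
  Sum-const (suc n) c = trans (cong (_+ c) (Sum-const n c))
    (solve 2 (λ a c → a :* c :+ c := (con 1ℚ :+ a) :* c) refl (ι n) c)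

  Sum-0 : ∀ n → Sum n (λ _ → 0ℚ) ≡ 0ℚ
  Sum-0 n = trans (Sum-const n 0ℚ) (ℚ.*-zeroʳ (ι n))

  Sum-swap : ∀ m n (f : ℕ → ℕ → ℚ) → Sum m (λ i → Sum n (f i)) ≡ Sum n (λ j → Sum m (λ i → f i j))
  Sum-swap zero    n f = sym (Sum-0 n)
  Sum-swap (suc m) n f = trans (cong (_+ Sum n (f m)) (Sum-swap m n f))
    (sym (Sum-+ n (λ j → Sum m (λ i → f i j)) (f m)))

  0≤Sum : ∀ n {f} → (∀ i → 0ℚ ≤ f i) → 0ℚ ≤ Sum n f
  0≤Sum n {f} h = subst (_≤ Sum n f) (Sum-0 n) (Sum-mono n (λ i _ → h i))

  ∣Sum∣≤ : ∀ n f → ∣ Sum n f ∣ ≤ Sum n (λ i → ∣ f i ∣)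
  ∣Sum∣≤ zero    f = ℚ.≤-refl
  ∣Sum∣≤ (suc n) f = ℚ.≤-trans (ℚ.∣p+q∣≤∣p∣+∣q∣ (Sum n f) (f n)) (ℚ.+-monoˡ-≤ ∣ f n ∣ (∣Sum∣≤ n f))

  Sum-≤ : ∀ {m n f} → (∀ i → 0ℚ ≤ f i) → m ℕ.≤ n → Sum m f ≤ Sum n f
  Sum-≤ {m} {n} {f} h m≤n = subst (Sum m f ≤_)
    (trans (sym (Sum-split m (n ℕ.∸ m) f)) (cong (λ z → Sum z f) (ℕ.m+[n∸m]≡n m≤n)))
    (p≤p+q (0≤Sum (n ℕ.∸ m) (λ i → h (m ℕ.+ i))))

  -- Periodic sequences

  Periodic : ℕ → (ℕ → ℚ) → Set
  Periodic N f = ∀ x → f (N ℕ.+ x) ≡ f x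

  periodic-* : ∀ {N f} k → Periodic N f → Periodic (k ℕ.* N) f
  periodic-* {N} {f} zero    p x = refl
  periodic-* {N} {f} (suc k) p x = trans (cong f (ℕ.+-assoc N (k ℕ.* N) x))
    (trans (p (k ℕ.* N ℕ.+ x)) (periodic-* k p x))

  Sum-shift1 : ∀ {N f} → Periodic N f → Sum N (λ x → f (suc x)) ≡ Sum N f
  Sum-shift1 {N} {f} p = begin
    Sum N (λ x → f (suc x))            ≡⟨ solve 2 (λ a b → b := (con 0ℚ :+ a :+ b) :- a) refl (f 0) _ ⟩
    Sum 1 f + Sum N (λ x → f (suc x)) - f 0
                                       ≡⟨ cong (_- f 0) (Sum-split 1 N f) ⟨
    Sum N f + f N - f 0                ≡⟨ cong (λ z → Sum N f + z - f 0) (trans (cong f (sym (ℕ.+-identityʳ N))) (p 0)) ⟩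
    Sum N f + f 0 - f 0                ≡⟨ solve 2 (λ a b → b :+ a :- a := b) refl (f 0) (Sum N f) ⟩
    Sum N f                            ∎
    where open ≡-Reasoning

  periodic-shift : ∀ {N f} u → Periodic N f → Periodic N (λ x → f (u ℕ.+ x))
  periodic-shift {N} {f} u p x = trans (cong f (trans (sym (ℕ.+-assoc u N x))
    (trans (cong (ℕ._+ x) (ℕ.+-comm u N)) (ℕ.+-assoc N u x)))) (p (u ℕ.+ x))

  Sum-shift : ∀ {N f} u → Periodic N f → Sum N (λ x → f (u ℕ.+ x)) ≡ Sum N f
  Sum-shift zero p = refl
  Sum-shift {N} {f} (suc u) p = trans
    (Sum-cong N (λ x → cong f (sym (ℕ.+-suc u x))))
    (trans (Sum-shift1 (periodic-shift u p)) (Sum-shift u p))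

  Sum-periods : ∀ {N f} k → Periodic N f → Sum (k ℕ.* N) f ≡ ι k * Sum N f
  Sum-periods {N} {f} zero p = sym (ℚ.*-zeroˡ (Sum N f))
  Sum-periods {N} {f} (suc k) p = begin
    Sum (N ℕ.+ k ℕ.* N) f                             ≡⟨ Sum-split N (k ℕ.* N) f ⟩
    Sum N f + Sum (k ℕ.* N) (λ i → f (N ℕ.+ i))       ≡⟨ cong (Sum N f +_) (Sum-cong (k ℕ.* N) p) ⟩
    Sum N f + Sum (k ℕ.* N) f                         ≡⟨ cong (Sum N f +_) (Sum-periods k p) ⟩
    Sum N f + ι k * Sum N f                           ≡⟨ solve 2 (λ k s → s :+ k :* s := (con 1ℚ :+ k) :* s) refl (ι k) (Sum N f) ⟩
    ι (suc k) * Sum N f                               ∎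
    where open ≡-Reasoning

  -- Correlations of periodic sequences

  periodic-gcd : ∀ {m n f} → Periodic m f → Periodic n f → Periodic (gcd m n) f
  -- Over ℕ, Bézout's identity reads gcd + l n = k m or gcd + k m = l n. Adding a multiple of one
  -- period to gcd + x gives a multiple of the other plus x, so nothing is ever subtracted.
  periodic-gcd {m} {n} {f} p q x with Bézout.identity (gcd-GCD m n)
  ... | Bézout.+- k l eq = begin
    f (gcd m n ℕ.+ x)                  ≡⟨ periodic-* l q (gcd m n ℕ.+ x) ⟨
    f (l ℕ.* n ℕ.+ (gcd m n ℕ.+ x))    ≡⟨ cong f (trans (sym (ℕ.+-assoc (l ℕ.* n) _ x))
                                            (cong (ℕ._+ x) (trans (ℕ.+-comm (l ℕ.* n) _) eq))) ⟩
    f (k ℕ.* m ℕ.+ x)                  ≡⟨ periodic-* k p x ⟩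
    f x                                ∎
    where open ≡-Reasoning
  ... | Bézout.-+ k l eq = begin
    f (gcd m n ℕ.+ x)                  ≡⟨ periodic-* k p (gcd m n ℕ.+ x) ⟨
    f (k ℕ.* m ℕ.+ (gcd m n ℕ.+ x))    ≡⟨ cong f (trans (sym (ℕ.+-assoc (k ℕ.* m) _ x))
                                            (cong (ℕ._+ x) (trans (ℕ.+-comm (k ℕ.* m) _) eq))) ⟩
    f (l ℕ.* n ℕ.+ x)                  ≡⟨ periodic-* l q x ⟩
    f x                                ∎
    where open ≡-Reasoning

  periodic-× : ∀ {N f g} → Periodic N f → Periodic N g → Periodic N (λ x → f x * g x)
  periodic-× p q x = cong₂ _*_ (p x) (q x)

  correlation : (ℕ → ℚ) → (ℕ → ℚ) → ℕ → ℕ → ℚ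
  correlation f g N u = Sum N (λ x → f (u ℕ.+ x) * g x)

  correlation-periodicˡ : ∀ {f g m} N → Periodic m f → Periodic m (correlation f g N)
  correlation-periodicˡ {f} {g} {m} N p u =
    Sum-cong N (λ x → cong (_* g x) (trans (cong f (ℕ.+-assoc m u x)) (p (u ℕ.+ x))))

  -- As `g` has period `n`, adding `n` to the shift of `f` amounts to translating the whole product
  -- by `n`, which does not change its sum over the common period `N`.
  correlation-periodicʳ : ∀ {f g n N} → Periodic N f → Periodic N g → Periodic n g →
    Periodic n (correlation f g N)
  correlation-periodicʳ {f} {g} {n} {N} p q q′ u = begin
    Sum N (λ x → f ((n ℕ.+ u) ℕ.+ x) * g x)
      ≡⟨ Sum-cong N (λ x → cong₂ _*_ (cong f (trans (cong (ℕ._+ x) (ℕ.+-comm n u)) (ℕ.+-assoc u n x))) (sym (q′ x))) ⟩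
    Sum N (λ x → f (u ℕ.+ (n ℕ.+ x)) * g (n ℕ.+ x))
      ≡⟨ Sum-shift n (periodic-× (periodic-shift u p) q) ⟩
    Sum N (λ x → f (u ℕ.+ x) * g x) ∎
    where open ≡-Reasoning

  -- The trace from functions modulo `a * d` to functions modulo `d`: the sum over the residues
  -- lying above x.
  fibre : ℕ → ℕ → (ℕ → ℚ) → ℕ → ℚ
  fibre a d f x = Sum a (λ k → f (k ℕ.* d ℕ.+ x))

  -- Replacing x by d + x advances k by one, and f(k d + x) has period `a` in k.
  fibre-periodic : ∀ {a d f} → Periodic (a ℕ.* d) f → Periodic d (fibre a d f)
  fibre-periodic {a} {d} {f} p x = trans
    (Sum-cong a (λ k → cong f (trans (sym (ℕ.+-assoc (k ℕ.* d) d x)) (cong (ℕ._+ x) (ℕ.+-comm (k ℕ.* d) d)))))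
    (Sum-shift1 {a} {λ k → f (k ℕ.* d ℕ.+ x)} λ k → trans
      (cong f (trans (cong (ℕ._+ x) (ℕ.*-distribʳ-+ d a k)) (ℕ.+-assoc (a ℕ.* d) (k ℕ.* d) x)))
      (p (k ℕ.* d ℕ.+ x)))

  -- A correlation has both periods, hence their gcd d, so averaging over shifts by
  -- multiples of d replaces f and then g by their fibre sums.
  Sum-correlate : ∀ a b d .{{_ : NonZero a}} .{{_ : NonZero b}} {f g} → Coprime a b →
    Periodic (a ℕ.* d) f → Periodic (b ℕ.* d) g →
    Sum (a ℕ.* d ℕ.* (b ℕ.* d)) (λ x → f x * g x) ≡
    ι d * Sum d (λ x → fibre a d f x * fibre b d g x)
  Sum-correlate a b d {f} {g} cop p q = *-cancelˡ a (*-cancelˡ b (begin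
    ι b * (ι a * S)
      ≡⟨ cong (ι b *_) step₁ ⟩
    ι b * Sum N (λ x → fibre a d f x * g x)
      ≡⟨ step₂ ⟩
    Sum N (λ x → fibre a d f x * fibre b d g x)
      ≡⟨ cong (λ z → Sum z (λ x → fibre a d f x * fibre b d g x))
           (ℕ-Solver.solve 3 (λ a b d → (a ℕ-Solver.:* d) ℕ-Solver.:* (b ℕ-Solver.:* d) ℕ-Solver.:= (b ℕ-Solver.:* (a ℕ-Solver.:* d)) ℕ-Solver.:* d) refl a b d) ⟩
    Sum (b ℕ.* (a ℕ.* d) ℕ.* d) (λ x → fibre a d f x * fibre b d g x)
      ≡⟨ Sum-periods (b ℕ.* (a ℕ.* d)) (periodic-× {d} {fibre a d f} {fibre b d g} fp gp) ⟩
    ι (b ℕ.* (a ℕ.* d)) * R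
      ≡⟨ cong (_* R) (trans (ι-* b (a ℕ.* d)) (cong (ι b *_) (ι-* a d))) ⟩
    ι b * (ι a * ι d) * R
      ≡⟨ solve 4 (λ a b d r → b :* (a :* d) :* r := b :* (a :* (d :* r))) refl (ι a) (ι b) (ι d) R ⟩
    ι b * (ι a * (ι d * R)) ∎))
    where
    open ≡-Reasoning
    N = a ℕ.* d ℕ.* (b ℕ.* d)
    S = Sum N (λ x → f x * g x)
    R = Sum d (λ x → fibre a d f x * fibre b d g x)
    fp : Periodic d (fibre a d f)
    fp = fibre-periodic {a} {d} {f} p
    gp : Periodic d (fibre b d g)
    gp = fibre-periodic {b} {d} {g} q
    pN : Periodic N f
    pN = subst (λ z → Periodic z f) (ℕ.*-comm (b ℕ.* d) (a ℕ.* d)) (periodic-* (b ℕ.* d) p)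
    qN : Periodic N g
    qN = periodic-* (a ℕ.* d) q
    fN : Periodic N (fibre a d f)
    fN = subst (λ z → Periodic z (fibre a d f))
           (ℕ-Solver.solve 3 (λ a b d → (b ℕ-Solver.:* (a ℕ-Solver.:* d)) ℕ-Solver.:* d ℕ-Solver.:= (a ℕ-Solver.:* d) ℕ-Solver.:* (b ℕ-Solver.:* d)) refl a b d)
           (periodic-* {d} {fibre a d f} (b ℕ.* (a ℕ.* d)) fp)
    gcd≡d : gcd (a ℕ.* d) (b ℕ.* d) ≡ d
    gcd≡d = trans (cong₂ gcd (ℕ.*-comm a d) (ℕ.*-comm b d)) (trans (sym (c*gcd[m,n]≡gcd[cm,cn] d a b))
      (trans (cong (d ℕ.*_) (coprime⇒gcd≡1 cop)) (ℕ.*-identityʳ d)))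
    T : ℕ → ℚ
    T = correlation f g N
    T-periodic : Periodic d T
    T-periodic = subst (λ z → Periodic z T) gcd≡d
      (periodic-gcd (correlation-periodicˡ N p) (correlation-periodicʳ pN qN q))
    step₁ : ι a * S ≡ Sum N (λ x → fibre a d f x * g x)
    step₁ = begin
      ι a * T 0                                               ≡⟨ Sum-const a (T 0) ⟨
      Sum a (λ _ → T 0)                                       ≡⟨ Sum-cong a (λ k → periodic-* k T-periodic 0) ⟨
      Sum a (λ k → T (k ℕ.* d ℕ.+ 0))                         ≡⟨ Sum-cong a (λ k → cong T (ℕ.+-identityʳ (k ℕ.* d))) ⟩
      Sum a (λ k → T (k ℕ.* d))                               ≡⟨ Sum-swap a N _ ⟩
      Sum N (λ x → Sum a (λ k → f (k ℕ.* d ℕ.+ x) * g x))     ≡⟨ Sum-cong N (λ x → trans (Sum-cong a (λ k → ℚ.*-comm _ (g x)))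
                                                                   (trans (Sum-*ˡ a (g x) _) (ℚ.*-comm (g x) _))) ⟩
      Sum N (λ x → fibre a d f x * g x)                       ∎
    -- Now the whole product is translated by multiples of `d`; its first factor is already
    -- `d`-periodic, so the averaging acts on `g` alone.
    step₂ : ι b * Sum N (λ x → fibre a d f x * g x) ≡ Sum N (λ x → fibre a d f x * fibre b d g x)
    step₂ = begin
      ι b * Sum N (λ x → fibre a d f x * g x)
        ≡⟨ Sum-const b _ ⟨
      Sum b (λ _ → Sum N (λ x → fibre a d f x * g x))
        ≡⟨ Sum-cong b (λ k → Sum-shift (k ℕ.* d) (periodic-× {N} {fibre a d f} {g} fN qN)) ⟨
      Sum b (λ k → Sum N (λ x → fibre a d f (k ℕ.* d ℕ.+ x) * g (k ℕ.* d ℕ.+ x)))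
        ≡⟨ Sum-cong b (λ k → Sum-cong N (λ x → cong (_* g (k ℕ.* d ℕ.+ x)) (periodic-* {d} {fibre a d f} k fp x))) ⟩
      Sum b (λ k → Sum N (λ x → fibre a d f x * g (k ℕ.* d ℕ.+ x)))
        ≡⟨ Sum-swap b N _ ⟩
      Sum N (λ x → Sum b (λ k → fibre a d f x * g (k ℕ.* d ℕ.+ x)))
        ≡⟨ Sum-cong N (λ x → Sum-*ˡ b (fibre a d f x) _) ⟩
      Sum N (λ x → fibre a d f x * fibre b d g x) ∎

  -- n ({x/n} - {2x/n}) as a function of the residue of x modulo n
  signed : ℕ → ℕ → ℚ
  signed n x = if does (2 ℕ.* x ℕ.<? n) then - ι x else ι n - ι x

  signed-low : ∀ {n x} → 2 ℕ.* x ℕ.< n → signed n x ≡ - ι x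
  signed-low {n} {x} h = cong (λ b → if b then - ι x else ι n - ι x) (dec-true (2 ℕ.* x ℕ.<? n) h)

  signed-high : ∀ {n x} → n ℕ.≤ 2 ℕ.* x → signed n x ≡ ι n - ι x
  signed-high {n} {x} h = cong (λ b → if b then - ι x else ι n - ι x)
    (dec-false (2 ℕ.* x ℕ.<? n) (ℕ.≤⇒≯ h))

  -- The representative of -x modulo n in the interval (-n/2, n/2]. The value at n = 0 is a dummy
  -- that spares a `NonZero` argument.
  centred : ℕ → ℕ → ℚ
  centred zero      x = 0ℚ
  centred n@(suc _) x = signed n (x % n)

  centred-periodic : ∀ n → Periodic n (centred n)
  centred-periodic zero      x = refl
  centred-periodic n@(suc _) x = cong (signed n)
    (trans (cong (_% n) (ℕ.+-comm n x)) ([m+n]%n≡m%n x n))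

  centred-< : ∀ {n x} → x ℕ.< n → centred n x ≡ signed n x
  centred-< {suc n} x<n = cong (signed (suc n)) (m<n⇒m%n≡m x<n)

  -- Faulhaber's formulas in degrees 0, 1 and 2, packed into one so that each residue sum below
  -- turns into a ring identity.
  Sum-quadratic : ∀ n A B C → Sum n (λ i → A + B * ι i + C * (ι i * ι i)) ≡
    A * ι n + B * (½ * (ι n * (ι n - 1ℚ))) + C * (r 6 * (ι n * (ι n - 1ℚ) * (ι 2 * ι n - 1ℚ)))
  Sum-quadratic zero A B C = solve 3 (λ A B C → con 0ℚ := A :* con 0ℚ :+ B :* (con ½ :* (con 0ℚ :* (con 0ℚ :- con 1ℚ)))
    :+ C :* (con (r 6) :* (con 0ℚ :* (con 0ℚ :- con 1ℚ) :* (con (ι 2) :* con 0ℚ :- con 1ℚ)))) refl A B C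
  Sum-quadratic (suc n) A B C = trans (cong (_+ (A + B * ι n + C * (ι n * ι n))) (Sum-quadratic n A B C))
    (solve 4 (λ A B C n →
      (A :* n :+ B :* (con ½ :* (n :* (n :- con 1ℚ)))
        :+ C :* (con (r 6) :* (n :* (n :- con 1ℚ) :* (con (ι 2) :* n :- con 1ℚ)))) :+ (A :+ B :* n :+ C :* (n :* n))
      := A :* (con 1ℚ :+ n) :+ B :* (con ½ :* ((con 1ℚ :+ n) :* ((con 1ℚ :+ n) :- con 1ℚ)))
        :+ C :* (con (r 6) :* ((con 1ℚ :+ n) :* ((con 1ℚ :+ n) :- con 1ℚ) :* (con (ι 2) :* (con 1ℚ :+ n) :- con 1ℚ))))
      refl A B C (ι n))

  -- Sums of `centred` over the fibres of reduction modulo d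

  centred-low : ∀ {n x} → 2 ℕ.* x ℕ.< n → centred n x ≡ - ι x
  centred-low {n} {x} h = trans (centred-< (ℕ.≤-<-trans (ℕ.m≤n*m x 2) h)) (signed-low {n} {x} h)

  centred-high : ∀ {n x} → x ℕ.< n → n ℕ.≤ 2 ℕ.* x → centred n x ≡ ι n - ι x
  centred-high {n} {x} x<n h = trans (centred-< x<n) (signed-high {n} {x} h)

  ι-affine : ∀ k d x → ι (k ℕ.* d ℕ.+ x) ≡ ι k * ι d + ι x
  ι-affine k d x = trans (ι-+ (k ℕ.* d) x) (cong (_+ ι x) (ι-* k d))

  Sum-affine : ∀ n A B → Sum n (λ i → A + B * ι i) ≡ A * ι n + B * (½ * (ι n * (ι n - 1ℚ)))
  Sum-affine n A B = trans
    (Sum-cong n (λ i → solve 2 (λ a i → a := a :+ con 0ℚ :* i) refl (A + B * ι i) (ι i * ι i)))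
    (trans (Sum-quadratic n A B 0ℚ) (solve 2 (λ a s → a :+ con 0ℚ :* s := a) refl _
      (r 6 * (ι n * (ι n - 1ℚ) * (ι 2 * ι n - 1ℚ)))))

  private
    low-bound : ∀ {k q d x} → k ℕ.< q → x ℕ.< d → 2 ℕ.* (k ℕ.* d ℕ.+ x) ℕ.< (q ℕ.+ q) ℕ.* d
    low-bound {k} {q} {d} {x} k<q x<d = begin-strict
      2 ℕ.* (k ℕ.* d ℕ.+ x)     <⟨ ℕ.*-monoʳ-< 2 (ℕ.+-monoʳ-< (k ℕ.* d) x<d) ⟩
      2 ℕ.* (k ℕ.* d ℕ.+ d)     ≡⟨ cong (2 ℕ.*_) (ℕ.+-comm (k ℕ.* d) d) ⟩
      2 ℕ.* (suc k ℕ.* d)       ≤⟨ ℕ.*-monoʳ-≤ 2 (ℕ.*-monoˡ-≤ d k<q) ⟩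
      2 ℕ.* (q ℕ.* d)           ≡⟨ ℕ-Solver.solve 2 (λ q d → ℕ-Solver.con 2 ℕ-Solver.:* (q ℕ-Solver.:* d) ℕ-Solver.:= (q ℕ-Solver.:+ q) ℕ-Solver.:* d) refl q d ⟩
      (q ℕ.+ q) ℕ.* d           ∎
      where open ℕ.≤-Reasoning

    index-bound : ∀ {k a d x} → k ℕ.< a → x ℕ.< d → k ℕ.* d ℕ.+ x ℕ.< a ℕ.* d
    index-bound {k} {a} {d} {x} k<a x<d = begin-strict
      k ℕ.* d ℕ.+ x   <⟨ ℕ.+-monoʳ-< (k ℕ.* d) x<d ⟩
      k ℕ.* d ℕ.+ d   ≡⟨ ℕ.+-comm (k ℕ.* d) d ⟩
      suc k ℕ.* d     ≤⟨ ℕ.*-monoˡ-≤ d k<a ⟩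
      a ℕ.* d         ∎
      where open ℕ.≤-Reasoning

    high-bound : ∀ {k q d x} → q ℕ.≤ k → (q ℕ.+ q) ℕ.* d ℕ.≤ 2 ℕ.* (k ℕ.* d ℕ.+ x)
    high-bound {k} {q} {d} {x} q≤k = begin
      (q ℕ.+ q) ℕ.* d           ≡⟨ ℕ-Solver.solve 2 (λ q d → (q ℕ-Solver.:+ q) ℕ-Solver.:* d ℕ-Solver.:= ℕ-Solver.con 2 ℕ-Solver.:* (q ℕ-Solver.:* d)) refl q d ⟩
      2 ℕ.* (q ℕ.* d)           ≤⟨ ℕ.*-monoʳ-≤ 2 (ℕ.*-monoˡ-≤ d q≤k) ⟩
      2 ℕ.* (k ℕ.* d)           ≤⟨ ℕ.*-monoʳ-≤ 2 (ℕ.m≤m+n (k ℕ.* d) x) ⟩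
      2 ℕ.* (k ℕ.* d ℕ.+ x)     ∎
      where open ℕ.≤-Reasoning

  fibre-low : ∀ {n d x q} → (∀ k → k ℕ.< q → 2 ℕ.* (k ℕ.* d ℕ.+ x) ℕ.< n) →
    Sum q (λ k → centred n (k ℕ.* d ℕ.+ x)) ≡ - ι x * ι q + - ι d * (½ * (ι q * (ι q - 1ℚ)))
  fibre-low {n} {d} {x} {q} h = trans
    (Sum-cong< q (λ k k<q → trans (centred-low (h k k<q)) (trans (cong -_ (ι-affine k d x))
      (solve 3 (λ k d x → :- (k :* d :+ x) := :- x :+ :- d :* k) refl (ι k) (ι d) (ι x)))))
    (Sum-affine q (- ι x) (- ι d))

  fibre-high : ∀ {n d x p q} → (∀ k → k ℕ.< q → (p ℕ.+ k) ℕ.* d ℕ.+ x ℕ.< n) →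
    (∀ k → n ℕ.≤ 2 ℕ.* ((p ℕ.+ k) ℕ.* d ℕ.+ x)) →
    Sum q (λ k → centred n ((p ℕ.+ k) ℕ.* d ℕ.+ x)) ≡
    (ι n - ι p * ι d - ι x) * ι q + - ι d * (½ * (ι q * (ι q - 1ℚ)))
  fibre-high {n} {d} {x} {p} {q} h h′ = trans
    (Sum-cong< q (λ k k<q → trans (centred-high (h k k<q) (h′ k))
      (trans (cong (λ z → ι n - z) (trans (ι-affine (p ℕ.+ k) d x) (cong (λ z → z * ι d + ι x) (ι-+ p k))))
      (solve 5 (λ n p k d x → n :- ((p :+ k) :* d :+ x) := (n :- p :* d :- x) :+ :- d :* k)
        refl (ι n) (ι p) (ι k) (ι d) (ι x)))))
    (Sum-affine q (ι n - ι p * ι d - ι x) (- ι d))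

  -- With y = x/d, the fibre consists of the points (y + k)/2q, over which B sums to B(y) by its
  -- distribution relation. Their doubles run twice through the points (y + k)/q and contribute
  -- 2B(y). The difference is -B(y) = 1/2 - x/d, scaled by 2 q d. The computation splits the fibre
  -- at its midpoint, where `centred` changes branch.
  fibre-even : ∀ q d {x} → x ℕ.< d →
    fibre (q ℕ.+ q) d (centred ((q ℕ.+ q) ℕ.* d)) x ≡ ι q * (ι d - ι 2 * ι x)
  fibre-even q d {x} x<d = begin
    Sum (q ℕ.+ q) f                        ≡⟨ Sum-split q q f ⟩
    Sum q f + Sum q (λ k → f (q ℕ.+ k))    ≡⟨ cong₂ _+_
      (fibre-low {n} {d} {x} {q} (λ k k<q → low-bound k<q x<d))
      (fibre-high {n} {d} {x} {q} {q} (λ k k<q → index-bound (ℕ.+-monoʳ-< q k<q) x<d)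
        (λ k → high-bound (ℕ.m≤m+n q k))) ⟩
    (- X * Q + - D * (½ * (Q * (Q - 1ℚ)))) + ((ι n - Q * D - X) * Q + - D * (½ * (Q * (Q - 1ℚ))))
      ≡⟨ cong (λ z → (- X * Q + - D * (½ * (Q * (Q - 1ℚ)))) + ((z - Q * D - X) * Q + - D * (½ * (Q * (Q - 1ℚ)))))
           (trans (ι-* (q ℕ.+ q) d) (cong (_* D) (ι-+ q q))) ⟩
    (- X * Q + - D * (½ * (Q * (Q - 1ℚ)))) + (((Q + Q) * D - Q * D - X) * Q + - D * (½ * (Q * (Q - 1ℚ))))
      ≡⟨ solve 3 (λ Q D X →
           (:- X :* Q :+ :- D :* (con ½ :* (Q :* (Q :- con 1ℚ))))
             :+ (((Q :+ Q) :* D :- Q :* D :- X) :* Q :+ :- D :* (con ½ :* (Q :* (Q :- con 1ℚ))))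
           := Q :* (D :- con (ι 2) :* X)) refl Q D X ⟩
    ι q * (ι d - ι 2 * ι x) ∎
    where
    open ≡-Reasoning
    n = (q ℕ.+ q) ℕ.* d
    f : ℕ → ℚ
    f k = centred n (k ℕ.* d ℕ.+ x)
    Q = ι q
    D = ι d
    X = ι x

  -- Doubling permutes the residues modulo the odd number 2q + 1, so the distribution relation sends
  -- B(y) - B(2y) to itself, whatever the parity of `d`.
  fibre-odd : ∀ q d {x} → x ℕ.< d →
    fibre (suc q ℕ.+ q) d (centred ((suc q ℕ.+ q) ℕ.* d)) x ≡ ι (suc q ℕ.+ q) * signed d x
  fibre-odd q d {x} x<d = begin
    Sum (suc q ℕ.+ q) f                                ≡⟨ Sum-split (suc q) q f ⟩
    Sum q f + f q + Sum q (λ k → f (suc q ℕ.+ k))      ≡⟨ cong₂ (λ s t → s + f q + t)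
      (fibre-low {n} {d} {x} {q} (λ k k<q → ℕ.<-≤-trans (low-bound k<q x<d) (ℕ.m≤n+m ((q ℕ.+ q) ℕ.* d) d)))
      (fibre-high {n} {d} {x} {suc q} {q} (λ k k<q → index-bound (ℕ.+-monoʳ-< (suc q) k<q) x<d)
        (λ k → ℕ.≤-trans (ℕ.*-monoˡ-≤ d (ℕ.+-monoʳ-≤ (suc q) (ℕ.n≤1+n q)))
          (high-bound {suc q ℕ.+ k} {suc q} {d} {x} (ℕ.m≤m+n (suc q) k)))) ⟩
    (- X * Q + - D * (½ * (Q * (Q - 1ℚ)))) + f q + ((ι n - (1ℚ + Q) * D - X) * Q + - D * (½ * (Q * (Q - 1ℚ))))
      ≡⟨ cong (λ z → (- X * Q + - D * (½ * (Q * (Q - 1ℚ)))) + f q + ((z - (1ℚ + Q) * D - X) * Q + - D * (½ * (Q * (Q - 1ℚ))))) ιn ⟩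
    (- X * Q + - D * (½ * (Q * (Q - 1ℚ)))) + f q + (((1ℚ + (Q + Q)) * D - (1ℚ + Q) * D - X) * Q + - D * (½ * (Q * (Q - 1ℚ))))
      ≡⟨ middle ⟩
    (1ℚ + (Q + Q)) * signed d x
      ≡⟨ cong (λ z → (1ℚ + z) * signed d x) (ι-+ q q) ⟨
    ι (suc q ℕ.+ q) * signed d x ∎
    where
    open ≡-Reasoning
    n = (suc q ℕ.+ q) ℕ.* d
    f : ℕ → ℚ
    f k = centred n (k ℕ.* d ℕ.+ x)
    Q = ι q
    D = ι d
    X = ι x
    ιn : ι n ≡ (1ℚ + (Q + Q)) * D
    ιn = trans (ι-* (suc q ℕ.+ q) d) (cong (λ z → (1ℚ + z) * D) (ι-+ q q))
    index : 2 ℕ.* (q ℕ.* d ℕ.+ x) ≡ 2 ℕ.* x ℕ.+ (q ℕ.+ q) ℕ.* d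
    index = ℕ-Solver.solve 3 (λ q d x → ℕ-Solver.con 2 ℕ-Solver.:* (q ℕ-Solver.:* d ℕ-Solver.:+ x) ℕ-Solver.:= ℕ-Solver.con 2 ℕ-Solver.:* x ℕ-Solver.:+ (q ℕ-Solver.:+ q) ℕ-Solver.:* d) refl q d x
    middle : (- X * Q + - D * (½ * (Q * (Q - 1ℚ)))) + f q
             + (((1ℚ + (Q + Q)) * D - (1ℚ + Q) * D - X) * Q + - D * (½ * (Q * (Q - 1ℚ))))
             ≡ (1ℚ + (Q + Q)) * signed d x
    -- Only the middle term k = q can fall on either side of n/2, and it lies below exactly when x
    -- lies below d/2.
    middle with 2 ℕ.* x ℕ.<? d
    ... | yes 2x<d = trans
      (cong (λ z → (- X * Q + - D * (½ * (Q * (Q - 1ℚ)))) + z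
          + (((1ℚ + (Q + Q)) * D - (1ℚ + Q) * D - X) * Q + - D * (½ * (Q * (Q - 1ℚ)))))
        (trans (centred-low {n} {q ℕ.* d ℕ.+ x}
                  (subst (ℕ._< n) (sym index) (ℕ.+-monoˡ-< ((q ℕ.+ q) ℕ.* d) 2x<d)))
               (cong -_ (ι-affine q d x))))
      (trans (solve 3 (λ Q D X →
           (:- X :* Q :+ :- D :* (con ½ :* (Q :* (Q :- con 1ℚ)))) :+ :- (Q :* D :+ X)
             :+ (((con 1ℚ :+ (Q :+ Q)) :* D :- (con 1ℚ :+ Q) :* D :- X) :* Q :+ :- D :* (con ½ :* (Q :* (Q :- con 1ℚ))))
           := (con 1ℚ :+ (Q :+ Q)) :* :- X) refl Q D X)
        (cong ((1ℚ + (Q + Q)) *_) (sym (signed-low {d} {x} 2x<d))))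
    ... | no  2x≮d = trans
      (cong (λ z → (- X * Q + - D * (½ * (Q * (Q - 1ℚ)))) + z
          + (((1ℚ + (Q + Q)) * D - (1ℚ + Q) * D - X) * Q + - D * (½ * (Q * (Q - 1ℚ)))))
        (trans (centred-high {n} {q ℕ.* d ℕ.+ x}
                  (index-bound (ℕ.m≤m+n (suc q) q) x<d)
                  (subst (n ℕ.≤_) (sym index) (ℕ.+-monoˡ-≤ ((q ℕ.+ q) ℕ.* d) (ℕ.≮⇒≥ 2x≮d))))
               (cong₂ _-_ ιn (ι-affine q d x))))
      (trans (solve 3 (λ Q D X →
           (:- X :* Q :+ :- D :* (con ½ :* (Q :* (Q :- con 1ℚ)))) :+ ((con 1ℚ :+ (Q :+ Q)) :* D :- (Q :* D :+ X))
             :+ (((con 1ℚ :+ (Q :+ Q)) :* D :- (con 1ℚ :+ Q) :* D :- X) :* Q :+ :- D :* (con ½ :* (Q :* (Q :- con 1ℚ))))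
           := (con 1ℚ :+ (Q :+ Q)) :* (D :- X)) refl Q D X)
        (cong ((1ℚ + (Q + Q)) *_) (sym (signed-high {d} {x} (ℕ.≮⇒≥ 2x≮d)))))

  -- Sums of squares over a full residue system

  quadratic : ∀ {n} → Polynomial n → Polynomial n → Polynomial n → Polynomial n → Polynomial n
  quadratic N A B C = A :* N :+ B :* (con ½ :* (N :* (N :- con 1ℚ)))
    :+ C :* (con (r 6) :* (N :* (N :- con 1ℚ) :* (con (ι 2) :* N :- con 1ℚ)))


  -- The right side of `Sum-quadratic` as a polynomial in N, ready for the substitution N = 1 + E;
  -- `quadratic` is the same polynomial in solver syntax.
  quad : ℚ → ℚ → ℚ → ℚ → ℚ
  quad N A B C = A * N + B * (½ * (N * (N - 1ℚ))) + C * (r 6 * (N * (N - 1ℚ) * (ι 2 * N - 1ℚ)))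

  -- The two bounds force p = ⌈n/2⌉, the place where `signed` changes branch. `F` also receives the
  -- residue itself, for the mixed sum with d - 2x.
  Sum-signed : ∀ (F : ℚ → ℚ → ℚ) p q n → (∀ i → i ℕ.< p → 2 ℕ.* i ℕ.< n) → n ℕ.≤ 2 ℕ.* p →
    Sum (p ℕ.+ q) (λ x → F (ι x) (signed n x)) ≡
    Sum p (λ i → F (ι i) (- ι i)) + Sum q (λ i → F (ι p + ι i) (ι n - (ι p + ι i)))
  Sum-signed F p q n low high = trans (Sum-split p q (λ x → F (ι x) (signed n x))) (cong₂ _+_
    (Sum-cong< p (λ i i<p → cong (F (ι i)) (signed-low {n} {i} (low i i<p))))
    (Sum-cong q (λ i → trans
      (cong (F (ι (p ℕ.+ i))) (signed-high {n} {p ℕ.+ i} (ℕ.≤-trans high (ℕ.*-monoʳ-≤ 2 (ℕ.m≤m+n p i)))))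
      (cong (λ z → F z (ι n - z)) (ι-+ p i)))))

  private
    odd-low : ∀ e i → i ℕ.< suc e → 2 ℕ.* i ℕ.< suc e ℕ.+ e
    odd-low e i (s≤s i≤e) = s≤s (ℕ.≤-trans (ℕ.*-monoʳ-≤ 2 i≤e) (ℕ.≤-reflexive (cong (e ℕ.+_) (ℕ.+-identityʳ e))))

    odd-high : ∀ e → suc e ℕ.+ e ℕ.≤ 2 ℕ.* suc e
    odd-high e = ℕ.+-monoʳ-≤ (suc e) (ℕ.≤-trans (ℕ.n≤1+n e) (ℕ.m≤m+n (suc e) 0))

    even-low : ∀ e i → i ℕ.< e → 2 ℕ.* i ℕ.< e ℕ.+ e
    even-low e i i<e = subst (2 ℕ.* i ℕ.<_) (cong (e ℕ.+_) (ℕ.+-identityʳ e)) (ℕ.*-monoʳ-< 2 i<e)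

    even-high : ∀ e → e ℕ.+ e ℕ.≤ 2 ℕ.* e
    even-high e = ℕ.+-monoʳ-≤ e (ℕ.m≤m+n e 0)

  -- The values are -e, ..., e, each taken once, so the sum is e(e + 1)(2e + 1)/3, where e(e + 1) =
  -- (d² - 1)/4.
  Sum-signed²-odd : ∀ e → let d = suc e ℕ.+ e in
    Sum d (λ x → signed d x * signed d x) ≡ ι d * (ι d * ι d - 1ℚ) * r 12
  Sum-signed²-odd e = begin
    Sum d (λ x → signed d x * signed d x)
      ≡⟨ Sum-signed (λ _ v → v * v) (suc e) e d (odd-low e) (odd-high e) ⟩
    Sum (suc e) (λ i → - ι i * - ι i) + Sum e (λ i → (ι d - (1ℚ + E + ι i)) * (ι d - (1ℚ + E + ι i)))
      ≡⟨ cong₂ _+_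
           (trans (Sum-cong (suc e) (λ i → solve 1 (λ i → :- i :* :- i := con 0ℚ :+ con 0ℚ :* i :+ con 1ℚ :* (i :* i)) refl (ι i)))
             (Sum-quadratic (suc e) 0ℚ 0ℚ 1ℚ))
           (trans (Sum-cong e (λ i → trans
               (cong (λ z → (z - (1ℚ + E + ι i)) * (z - (1ℚ + E + ι i))) (cong (λ y → 1ℚ + y) (ι-+ e e)))
               (solve 2 (λ E i → (con 1ℚ :+ (E :+ E) :- (con 1ℚ :+ E :+ i)) :* (con 1ℚ :+ (E :+ E) :- (con 1ℚ :+ E :+ i))
                 := E :* E :+ :- (E :+ E) :* i :+ con 1ℚ :* (i :* i)) refl E (ι i))))
             (Sum-quadratic e (E * E) (- (E + E)) 1ℚ)) ⟩
    quad (1ℚ + E) 0ℚ 0ℚ 1ℚ + quad E (E * E) (- (E + E)) 1ℚ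
      ≡⟨ solve 1 (λ E → quadratic (con 1ℚ :+ E) (con 0ℚ) (con 0ℚ) (con 1ℚ) :+ quadratic E (E :* E) (:- (E :+ E)) (con 1ℚ)
           := (con 1ℚ :+ (E :+ E)) :* ((con 1ℚ :+ (E :+ E)) :* (con 1ℚ :+ (E :+ E)) :- con 1ℚ) :* con (r 12)) refl E ⟩
    (1ℚ + (E + E)) * ((1ℚ + (E + E)) * (1ℚ + (E + E)) - 1ℚ) * r 12
      ≡⟨ cong (λ z → (1ℚ + z) * ((1ℚ + z) * (1ℚ + z) - 1ℚ) * r 12) (ι-+ e e) ⟨
    ι d * (ι d * ι d - 1ℚ) * r 12 ∎
    where
    open ≡-Reasoning
    d = suc e ℕ.+ e
    E = ι e

  -- Write s for `signed d x`. Then d - 2x is 2s + d where s ≤ 0 and 2s - d where s > 0, so the sum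
  -- is 2∑s² - d∑|s|, with ∑|s| = e(e + 1) = (d² - 1)/4.
  Sum-signed-odd : ∀ e → let d = suc e ℕ.+ e in
    Sum d (λ x → (ι d - ι 2 * ι x) * signed d x) ≡ - (ι d * (ι d * ι d - 1ℚ) * r 12)
  Sum-signed-odd e = begin
    Sum d (λ x → (ι d - ι 2 * ι x) * signed d x)
      ≡⟨ Sum-signed (λ x v → (ι d - ι 2 * x) * v) (suc e) e d (odd-low e) (odd-high e) ⟩
    Sum (suc e) (λ i → (ι d - ι 2 * ι i) * - ι i)
      + Sum e (λ i → (ι d - ι 2 * (1ℚ + E + ι i)) * (ι d - (1ℚ + E + ι i)))
      ≡⟨ cong₂ _+_
           (trans (Sum-cong (suc e) (λ i → trans
               (cong (λ z → (z - ι 2 * ι i) * - ι i) (cong (λ y → 1ℚ + y) (ι-+ e e)))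
               (solve 2 (λ E i → (con 1ℚ :+ (E :+ E) :- con (ι 2) :* i) :* :- i
                 := con 0ℚ :+ :- (con 1ℚ :+ (E :+ E)) :* i :+ con (ι 2) :* (i :* i)) refl E (ι i))))
             (Sum-quadratic (suc e) 0ℚ (- (1ℚ + (E + E))) (ι 2)))
           (trans (Sum-cong e (λ i → trans
               (cong (λ z → (z - ι 2 * (1ℚ + E + ι i)) * (z - (1ℚ + E + ι i))) (cong (λ y → 1ℚ + y) (ι-+ e e)))
               (solve 2 (λ E i → (con 1ℚ :+ (E :+ E) :- con (ι 2) :* (con 1ℚ :+ E :+ i)) :* (con 1ℚ :+ (E :+ E) :- (con 1ℚ :+ E :+ i))
                 := :- E :+ (con 1ℚ :- (E :+ E)) :* i :+ con (ι 2) :* (i :* i)) refl E (ι i))))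
             (Sum-quadratic e (- E) (1ℚ - (E + E)) (ι 2))) ⟩
    quad (1ℚ + E) 0ℚ (- (1ℚ + (E + E))) (ι 2) + quad E (- E) (1ℚ - (E + E)) (ι 2)
      ≡⟨ solve 1 (λ E → quadratic (con 1ℚ :+ E) (con 0ℚ) (:- (con 1ℚ :+ (E :+ E))) (con (ι 2))
             :+ quadratic E (:- E) (con 1ℚ :- (E :+ E)) (con (ι 2))
           := :- ((con 1ℚ :+ (E :+ E)) :* ((con 1ℚ :+ (E :+ E)) :* (con 1ℚ :+ (E :+ E)) :- con 1ℚ) :* con (r 12))) refl E ⟩
    - ((1ℚ + (E + E)) * ((1ℚ + (E + E)) * (1ℚ + (E + E)) - 1ℚ) * r 12)
      ≡⟨ cong (λ z → - ((1ℚ + z) * ((1ℚ + z) * (1ℚ + z) - 1ℚ) * r 12)) (ι-+ e e) ⟨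
    - (ι d * (ι d * ι d - 1ℚ) * r 12) ∎
    where
    open ≡-Reasoning
    d = suc e ℕ.+ e
    E = ι e

  -- The values are -(e - 1), ..., e. The unpaired value e is what turns d² - 1 into d² + 2.
  Sum-signed²-even : ∀ e → let d = e ℕ.+ e in
    Sum d (λ x → signed d x * signed d x) ≡ ι d * (ι d * ι d + ι 2) * r 12
  Sum-signed²-even e = begin
    Sum d (λ x → signed d x * signed d x)
      ≡⟨ Sum-signed (λ _ v → v * v) e e d (even-low e) (even-high e) ⟩
    Sum e (λ i → - ι i * - ι i) + Sum e (λ i → (ι d - (E + ι i)) * (ι d - (E + ι i)))
      ≡⟨ cong₂ _+_
           (trans (Sum-cong e (λ i → solve 1 (λ i → :- i :* :- i := con 0ℚ :+ con 0ℚ :* i :+ con 1ℚ :* (i :* i)) refl (ι i)))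
             (Sum-quadratic e 0ℚ 0ℚ 1ℚ))
           (trans (Sum-cong e (λ i → trans
               (cong (λ z → (z - (E + ι i)) * (z - (E + ι i))) (ι-+ e e))
               (solve 2 (λ E i → (E :+ E :- (E :+ i)) :* (E :+ E :- (E :+ i))
                 := E :* E :+ :- (E :+ E) :* i :+ con 1ℚ :* (i :* i)) refl E (ι i))))
             (Sum-quadratic e (E * E) (- (E + E)) 1ℚ)) ⟩
    quad E 0ℚ 0ℚ 1ℚ + quad E (E * E) (- (E + E)) 1ℚ
      ≡⟨ solve 1 (λ E → quadratic E (con 0ℚ) (con 0ℚ) (con 1ℚ) :+ quadratic E (E :* E) (:- (E :+ E)) (con 1ℚ)
           := (E :+ E) :* ((E :+ E) :* (E :+ E) :+ con (ι 2)) :* con (r 12)) refl E ⟩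
    (E + E) * ((E + E) * (E + E) + ι 2) * r 12
      ≡⟨ cong (λ z → z * (z * z + ι 2) * r 12) (ι-+ e e) ⟨
    ι d * (ι d * ι d + ι 2) * r 12 ∎
    where
    open ≡-Reasoning
    d = e ℕ.+ e
    E = ι e

  -- The mean over a period of m ({x/m} - {2x/m}) times n ({x/n} - {2x/n})
  κ : ℕ → ℕ → ℚ
  κ m n = r (m ℕ.* n) * Sum (m ℕ.* n) (λ x → centred m x * centred n x)

  κ-sym : ∀ m n → κ m n ≡ κ n m
  κ-sym m n = trans (cong (λ N → r N * Sum N (λ x → centred m x * centred n x)) (ℕ.*-comm m n))
    (cong (r (n ℕ.* m) *_) (Sum-cong (n ℕ.* m) (λ x → ℚ.*-comm (centred m x) (centred n x))))

  private
    r-cancel : ∀ a b d .{{_ : NonZero a}} .{{_ : NonZero b}} .{{_ : NonZero d}} s →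
      r (a ℕ.* d ℕ.* (b ℕ.* d)) * (ι d * ((ι a * ι b) * s)) ≡ r d * s
    r-cancel a b d s = begin
      r (a ℕ.* d ℕ.* (b ℕ.* d)) * (ι d * ((ι a * ι b) * s))
        ≡⟨ cong (_* (ι d * ((ι a * ι b) * s))) (trans (r-* (a ℕ.* d) (b ℕ.* d)) (cong₂ _*_ (r-* a d) (r-* b d))) ⟩
      r a * r d * (r b * r d) * (ι d * ((ι a * ι b) * s))
        ≡⟨ solve 7 (λ a b d ra rb rd s → ra :* rd :* (rb :* rd) :* (d :* ((a :* b) :* s))
             := (a :* ra) :* (b :* rb) :* (d :* rd) :* (rd :* s)) refl (ι a) (ι b) (ι d) (r a) (r b) (r d) s ⟩
      ι a * r a * (ι b * r b) * (ι d * r d) * (r d * s)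
        ≡⟨ cong (_* (r d * s)) (cong₂ _*_ (cong₂ _*_ (ι*r≡1 a) (ι*r≡1 b)) (ι*r≡1 d)) ⟩
      1ℚ * 1ℚ * 1ℚ * (r d * s)
        ≡⟨ ℚ.*-identityˡ (r d * s) ⟩
      r d * s ∎
      where open ≡-Reasoning

  -- The factors `a` and `b` of the fibre sums cancel against the length (a d)(b d) of the period,
  -- which leaves an average over residues modulo `d`. In the applications `s` and `t` are 1 for an
  -- odd fibre and 1/2 for an even one.
  κ-fibres : ∀ a b d .{{_ : NonZero a}} .{{_ : NonZero b}} .{{_ : NonZero d}} → Coprime a b →
    ∀ {h k : ℕ → ℚ} {s t} →
    (∀ x → x ℕ.< d → fibre a d (centred (a ℕ.* d)) x ≡ ι a * s * h x) →
    (∀ x → x ℕ.< d → fibre b d (centred (b ℕ.* d)) x ≡ ι b * t * k x) →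
    κ (a ℕ.* d) (b ℕ.* d) ≡ r d * (s * t * Sum d (λ x → h x * k x))
  κ-fibres a b d cop {h} {k} {s} {t} p q = begin
    r N * Sum N (λ x → centred (a ℕ.* d) x * centred (b ℕ.* d) x)
      ≡⟨ cong (r N *_) (Sum-correlate a b d cop (centred-periodic (a ℕ.* d)) (centred-periodic (b ℕ.* d))) ⟩
    r N * (ι d * Sum d (λ x → fibre a d (centred (a ℕ.* d)) x * fibre b d (centred (b ℕ.* d)) x))
      ≡⟨ cong (λ z → r N * (ι d * z)) (Sum-cong< d (λ x x<d → trans (cong₂ _*_ (p x x<d) (q x x<d))
           (solve 6 (λ a b s t h k → a :* s :* h :* (b :* t :* k) := a :* b :* (s :* t) :* (h :* k)) refl (ι a) (ι b) s t (h x) (k x)))) ⟩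
    r N * (ι d * Sum d (λ x → ι a * ι b * (s * t) * (h x * k x)))
      ≡⟨ cong (λ z → r N * (ι d * z)) (trans (Sum-*ˡ d (ι a * ι b * (s * t)) _) (ℚ.*-assoc (ι a * ι b) (s * t) _)) ⟩
    r N * (ι d * (ι a * ι b * (s * t * Sum d (λ x → h x * k x))))
      ≡⟨ r-cancel a b d _ ⟩
    r d * (s * t * Sum d (λ x → h x * k x)) ∎
    where
    open ≡-Reasoning
    N = a ℕ.* d ℕ.* (b ℕ.* d)

  -- The mean `κ` for the four parity patterns

  even⊎odd : ∀ n → (∃[ e ] n ≡ e ℕ.+ e) ⊎ (∃[ e ] n ≡ suc e ℕ.+ e)
  even⊎odd zero = inj₁ (0 , refl)
  even⊎odd (suc n) with even⊎odd n
  ... | inj₁ (e , eq) = inj₂ (e , cong suc eq)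
  ... | inj₂ (e , eq) = inj₁ (suc e , trans (cong suc eq) (cong suc (sym (ℕ.+-suc e e))))

  2∤⇒odd : ∀ {n} → 2 ∤ n → ∃[ e ] n ≡ suc e ℕ.+ e
  2∤⇒odd {n} 2∤n with even⊎odd n
  ... | inj₂ o = o
  ... | inj₁ (e , refl) = contradiction
    (divides e (trans (cong (e ℕ.+_) (sym (ℕ.+-identityʳ e))) (ℕ.*-comm 2 e))) 2∤n

  2∤⇒nonZero : ∀ {n} → 2 ∤ n → NonZero n
  2∤⇒nonZero {zero}  2∤n = contradiction (2 ∣0) 2∤n
  2∤⇒nonZero {suc n} 2∤n = _

  coprime-double : ∀ {a b} → Coprime a b → 2 ∤ b → Coprime (a ℕ.+ a) b
  coprime-double {a} {b} cop 2∤b {i} (i∣2a , i∣b) = cop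
    (coprime-divisor i⊥2 (subst (i ∣_) (cong (a ℕ.+_) (sym (ℕ.+-identityʳ a))) i∣2a) , i∣b)
    where
    i⊥2 : Coprime i 2
    i⊥2 (j∣i , j∣2) with prime⇒irreducible prime[2] j∣2
    ... | inj₁ j≡1  = j≡1
    ... | inj₂ refl = contradiction (∣-trans j∣i i∣b) 2∤b

  ι-half : ∀ a → ι a ≡ ι (a ℕ.+ a) * ½
  ι-half a = sym (trans (cong (_* ½) (ι-+ a a)) (solve 1 (λ a → (a :+ a) :* con ½ := a) refl (ι a)))

  r-ι-cancel : ∀ d .{{_ : NonZero d}} s → r d * (ι d * s) ≡ s
  r-ι-cancel d s = trans (sym (ℚ.*-assoc (r d) (ι d) s))
    (trans (cong (_* s) (trans (ℚ.*-comm (r d) (ι d)) (ι*r≡1 d))) (ℚ.*-identityˡ s))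

  fibre-2∤ : ∀ {a} d → 2 ∤ a → ∀ x → x ℕ.< d → fibre a d (centred (a ℕ.* d)) x ≡ ι a * 1ℚ * signed d x
  fibre-2∤ {a} d 2∤a x x<d with 2∤⇒odd 2∤a
  ... | q , refl = trans (fibre-odd q d x<d)
    (cong (_* signed d x) (sym (ℚ.*-identityʳ (ι (suc q ℕ.+ q)))))

  fibre-double : ∀ a d x → x ℕ.< d →
    fibre (a ℕ.+ a) d (centred ((a ℕ.+ a) ℕ.* d)) x ≡ ι (a ℕ.+ a) * ½ * (ι d - ι 2 * ι x)
  fibre-double a d x x<d = trans (fibre-even a d x<d) (cong (_* (ι d - ι 2 * ι x)) (ι-half a))

  module _ {a b d : ℕ} (2∤a : 2 ∤ a) (2∤b : 2 ∤ b) (2∤d : 2 ∤ d) (cop : Coprime a b) where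

    private instance
      a≢0 : NonZero a
      a≢0 = 2∤⇒nonZero 2∤a
      b≢0 : NonZero b
      b≢0 = 2∤⇒nonZero 2∤b
      d≢0 : NonZero d
      d≢0 = 2∤⇒nonZero 2∤d

    κ-odd : κ (a ℕ.* d) (b ℕ.* d) ≡ (ι d * ι d - 1ℚ) * r 12
    κ-odd with 2∤⇒odd 2∤d
    ... | e , refl = begin
      κ (a ℕ.* d) (b ℕ.* d)
        ≡⟨ κ-fibres a b d cop (fibre-2∤ d 2∤a) (fibre-2∤ d 2∤b) ⟩
      r d * (1ℚ * 1ℚ * Sum d (λ x → signed d x * signed d x))
        ≡⟨ cong (r d *_) (trans (ℚ.*-identityˡ _) (trans (Sum-signed²-odd e) (ℚ.*-assoc (ι d) _ (r 12)))) ⟩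
      r d * (ι d * ((ι d * ι d - 1ℚ) * r 12))
        ≡⟨ r-ι-cancel d _ ⟩
      (ι d * ι d - 1ℚ) * r 12 ∎
      where open ≡-Reasoning

    -- The factor 1/2 comes from the even fibre and the sign from `Sum-signed-odd`.
    κ-halfOdd : κ ((a ℕ.+ a) ℕ.* d) (b ℕ.* d) ≡ - ½ * ((ι d * ι d - 1ℚ) * r 12)
    κ-halfOdd with 2∤⇒odd 2∤d
    ... | e , refl = begin
      κ ((a ℕ.+ a) ℕ.* d) (b ℕ.* d)
        ≡⟨ κ-fibres (a ℕ.+ a) b d {{ℕ.>-nonZero (ℕ.≤-trans (ℕ.>-nonZero⁻¹ a) (ℕ.m≤m+n a a))}}
             (coprime-double cop 2∤b) (fibre-double a d) (fibre-2∤ d 2∤b) ⟩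
      r d * (½ * 1ℚ * Sum d (λ x → (ι d - ι 2 * ι x) * signed d x))
        ≡⟨ cong (r d *_) (trans (cong (½ * 1ℚ *_) (Sum-signed-odd e))
             (solve 2 (λ d s → con ½ :* con 1ℚ :* :- (d :* s :* con (r 12)) := d :* (con (- ½) :* (s :* con (r 12))))
               refl (ι d) (ι d * ι d - 1ℚ))) ⟩
      r d * (ι d * (- ½ * ((ι d * ι d - 1ℚ) * r 12)))
        ≡⟨ r-ι-cancel d _ ⟩
      - ½ * ((ι d * ι d - 1ℚ) * r 12) ∎
      where open ≡-Reasoning

    -- Here the common factor of the two indices is 2d, and the cofactors are odd. Both fibres are
    -- thus of the odd kind, and the even modulus enters only through the sum of squares.
    κ-even : κ (a ℕ.* (d ℕ.+ d)) (b ℕ.* (d ℕ.+ d)) ≡ (ι 4 * (ι d * ι d) + ι 2) * r 12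
    κ-even = begin
      κ (a ℕ.* 2d) (b ℕ.* 2d)
        ≡⟨ κ-fibres a b 2d cop (fibre-2∤ 2d 2∤a) (fibre-2∤ 2d 2∤b) ⟩
      r 2d * (1ℚ * 1ℚ * Sum 2d (λ x → signed 2d x * signed 2d x))
        ≡⟨ cong (r 2d *_) (trans (ℚ.*-identityˡ _) (trans (Sum-signed²-even d) (ℚ.*-assoc (ι 2d) _ (r 12)))) ⟩
      r 2d * (ι 2d * ((ι 2d * ι 2d + ι 2) * r 12))
        ≡⟨ r-ι-cancel 2d _ ⟩
      (ι 2d * ι 2d + ι 2) * r 12
        ≡⟨ cong (λ z → (z * z + ι 2) * r 12) (ι-+ d d) ⟩
      ((ι d + ι d) * (ι d + ι d) + ι 2) * r 12
        ≡⟨ solve 1 (λ d → ((d :+ d) :* (d :+ d) :+ con (ι 2)) :* con (r 12)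
             := (con (ι 4) :* (d :* d) :+ con (ι 2)) :* con (r 12)) refl (ι d) ⟩
      (ι 4 * (ι d * ι d) + ι 2) * r 12 ∎
      where
      open ≡-Reasoning
      2d = d ℕ.+ d
      instance
        2d≢0 : NonZero 2d
        2d≢0 = ℕ.>-nonZero (ℕ.≤-trans (ℕ.>-nonZero⁻¹ d) (ℕ.m≤m+n d d))

  -- All four means are expressed through the gcd of the odd parts, so that the terms at (m,n),
  -- (m,2n), (2m,n) and (2m,2n) can be added.
  record OddPair (m n : ℕ) : Set where
    field
      κ₁₁ : κ m n ≡ (ι (gcd m n) * ι (gcd m n) - 1ℚ) * r 12
      κ₂₁ : κ (2 ℕ.* m) n ≡ - ½ * ((ι (gcd m n) * ι (gcd m n) - 1ℚ) * r 12)
      κ₁₂ : κ m (2 ℕ.* n) ≡ - ½ * ((ι (gcd m n) * ι (gcd m n) - 1ℚ) * r 12)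
      κ₂₂ : κ (2 ℕ.* m) (2 ℕ.* n) ≡ (ι 4 * (ι (gcd m n) * ι (gcd m n)) + ι 2) * r 12

  oddPair : ∀ {m n} → 2 ∤ m → 2 ∤ n → OddPair m n
  oddPair {m} {n} 2∤m 2∤n = record
    { κ₁₁ = trans (cong₂ κ m≡ n≡) (κ-odd 2∤a 2∤b 2∤d cop)
    ; κ₂₁ = trans (cong₂ κ (2m a m≡) n≡) (κ-halfOdd 2∤a 2∤b 2∤d cop)
    ; κ₁₂ = trans (κ-sym m (2 ℕ.* n)) (trans (cong₂ κ (2m b n≡) m≡) (κ-halfOdd 2∤b 2∤a 2∤d (Coprime.sym cop)))
    ; κ₂₂ = trans (cong₂ κ (2d a m≡) (2d b n≡)) (κ-even 2∤a 2∤b 2∤d cop)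
    }
    where
    d = gcd m n
    d≢0 : NonZero d
    d≢0 = ℕ.≢-nonZero (gcd[m,n]≢0 m n (inj₁ (ℕ.≢-nonZero⁻¹ m {{2∤⇒nonZero 2∤m}})))
    instance _ = d≢0
    a = m ℕ./ d
    b = n ℕ./ d
    m≡ : m ≡ a ℕ.* d
    m≡ = sym (m/n*n≡m (gcd[m,n]∣m m n))
    n≡ : n ≡ b ℕ.* d
    n≡ = sym (m/n*n≡m (gcd[m,n]∣n m n))
    2∤d : 2 ∤ d
    2∤d 2∣d = 2∤m (∣-trans 2∣d (gcd[m,n]∣m m n))
    2∤a : 2 ∤ a
    2∤a 2∣a = 2∤m (subst (2 ∣_) (sym m≡) (∣-trans 2∣a (m∣m*n d)))
    2∤b : 2 ∤ b
    2∤b 2∣b = 2∤n (subst (2 ∣_) (sym n≡) (∣-trans 2∣b (m∣m*n d)))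
    cop : Coprime a b
    cop = coprime-/gcd m n
    2m : ∀ c {x} → x ≡ c ℕ.* d → 2 ℕ.* x ≡ (c ℕ.+ c) ℕ.* d
    2m c refl = trans (sym (ℕ.*-assoc 2 c d)) (cong (λ z → (c ℕ.+ z) ℕ.* d) (ℕ.+-identityʳ c))
    2d : ∀ c {x} → x ≡ c ℕ.* d → 2 ℕ.* x ≡ c ℕ.* (d ℕ.+ d)
    2d c refl = trans (cong (c ℕ.* d ℕ.+_) (ℕ.+-identityʳ (c ℕ.* d))) (sym (ℕ.*-distribˡ-+ c d d))

  -- Fractional parts of rationals as residues

  mkℚ≡ι*r : ∀ a d .(c : Coprime a (suc d)) → mkℚ (ℤ.+ a) d c ≡ ι a * r (suc d)
  mkℚ≡ι*r a d c = trans (sym (ℚ.↥p/↧p≡p (mkℚ (ℤ.+ a) d c))) (/≡ι*r a (suc d))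

  ι-% : ∀ x n .{{_ : NonZero n}} → (ι x - ι (x ℕ./ n) * ι n) ≡ ι (x % n)
  ι-% x n = trans (cong (λ z → z - ι (x ℕ./ n) * ι n) (trans (cong ι (m≡m%n+[m/n]*n x n))
      (trans (ι-+ (x % n) (x ℕ./ n ℕ.* n)) (cong (λ z → ι (x % n) + z) (ι-* (x ℕ./ n) n)))))
    (solve 2 (λ a b → a :+ b :- b := a) refl (ι (x % n)) (ι (x ℕ./ n) * ι n))

  frac-mkℚ : ∀ a d .(c : Coprime a (suc d)) → frac (mkℚ (ℤ.+ a) d c) ≡ ι (a % suc d) * r (suc d)
  frac-mkℚ a d c = begin
    p - (ℤ.+ 1 ℤ.* ℤ.+ (a ℕ./ suc d)) / 1           ≡⟨ cong (λ z → p - z / 1) (ℤ.*-identityˡ (ℤ.+ (a ℕ./ suc d))) ⟩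
    p - ℤ.+ (a ℕ./ suc d) / 1                       ≡⟨ cong₂ _-_ (mkℚ≡ι*r a d c) (/1≡ι (a ℕ./ suc d)) ⟩
    ι a * r D - ι (a ℕ./ D)                         ≡⟨ cong (λ z → ι a * r D - z) (ℚ.*-identityʳ (ι (a ℕ./ D))) ⟨
    ι a * r D - ι (a ℕ./ D) * 1ℚ                    ≡⟨ cong (λ z → ι a * r D - ι (a ℕ./ D) * z) (ι*r≡1 D) ⟨
    ι a * r D - ι (a ℕ./ D) * (ι D * r D)           ≡⟨ solve 4 (λ a r q D → a :* r :- q :* (D :* r) := (a :- q :* D) :* r) refl
                                                        (ι a) (r D) (ι (a ℕ./ D)) (ι D) ⟩
    (ι a - ι (a ℕ./ D) * ι D) * r D                 ≡⟨ cong (_* r D) (ι-% a D) ⟩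
    ι (a % D) * r D                                 ∎
    where
    open ≡-Reasoning
    p = mkℚ (ℤ.+ a) d c
    D = suc d

  -- `frac` sees only the reduced form a/D of x/n. Scaled by n and by D respectively, the residues
  -- of a modulo D and of x modulo n both become the remainder of a n = x D modulo n D.
  frac-/ : ∀ x n .{{_ : NonZero n}} → frac (ℤ.+ x / n) ≡ ι (x % n) * r n
  frac-/ x n@(suc n′) with ℤ.+ x / n in eq
  ... | mkℚ (ℤ.-[1+ a ]) d c = contradiction
    (subst NonNegative eq (ℚ.normalize-nonNeg x n)) λ ()
  ... | mkℚ (ℤ.+ a) d c = trans (frac-mkℚ a d c) (*-cancelˡ n (*-cancelˡ (suc d) (begin
    ι D * (ι n * (ι (a % D) * r D))     ≡⟨ solve 4 (λ D n s rd → D :* (n :* (s :* rd)) := (s :* n) :* (D :* rd)) refl (ι D) (ι n) (ι (a % D)) (r D) ⟩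
    ι (a % D) * ι n * (ι D * r D)       ≡⟨ cong₂ _*_ (sym (ι-* (a % D) n)) (ι*r≡1 D) ⟩
    ι (a % D ℕ.* n) * 1ℚ                ≡⟨ cong₂ (λ s t → ι s * t) residues (sym (ι*r≡1 n)) ⟩
    ι (x % n ℕ.* D) * (ι n * r n)       ≡⟨ cong (_* (ι n * r n)) (ι-* (x % n) D) ⟩
    ι (x % n) * ι D * (ι n * r n)       ≡⟨ solve 4 (λ D n s rn → s :* D :* (n :* rn) := D :* (n :* (s :* rn))) refl (ι D) (ι n) (ι (x % n)) (r n) ⟩
    ι D * (ι n * (ι (x % n) * r n))     ∎)))
    where
    open ≡-Reasoning
    D = suc d
    cross : x ℕ.* D ≡ a ℕ.* n
    cross with ℚᵘ.≃-trans (ℚᵘ.≃-sym (ℚ.toℚᵘ-fromℚᵘ (ℚᵘ.mkℚᵘ (ℤ.+ x) n′))) (ℚᵘ.≃-reflexive (cong toℚᵘ eq))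
    ... | ℚᵘ.*≡* e = ℤ.+-injective (trans (ℤ.pos-* x D) (trans e (sym (ℤ.pos-* a n))))
    residues : a % D ℕ.* n ≡ x % n ℕ.* D
    residues = begin
      a % D ℕ.* n                ≡⟨ m%n*o≡m*o%[n*o] a D n ⟩
      (a ℕ.* n) % (D ℕ.* n)      ≡⟨ cong (_% (D ℕ.* n)) (sym cross) ⟩
      (x ℕ.* D) % (D ℕ.* n)      ≡⟨ %-congʳ {D ℕ.* n} {n ℕ.* D} {x ℕ.* D} (ℕ.*-comm D n) ⟩
      (x ℕ.* D) % (n ℕ.* D)      ≡⟨ m%n*o≡m*o%[n*o] x n D ⟨
      x % n ℕ.* D                ∎

  frac-diff : ∀ x n .{{_ : NonZero n}} → frac (ℤ.+ x / n) - frac (ℤ.+ (2 ℕ.* x) / n) ≡ centred n x * r n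
  frac-diff x n@(suc _) = trans (cong₂ _-_ (frac-/ x n) (frac-/ (2 ℕ.* x) n)) (go (2 ℕ.* (x % n) ℕ.<? n))
    where
    s = x % n
    double : (2 ℕ.* x) % n ≡ (2 ℕ.* s) % n
    double = trans (%-distribˡ-* 2 x n) (trans (cong (λ z → (2 % n ℕ.* z) % n) (sym (m%n%n≡m%n x n))) (sym (%-distribˡ-* 2 s n)))
    s+s : ι (2 ℕ.* s) ≡ ι s + ι s
    s+s = trans (cong (λ z → ι (s ℕ.+ z)) (ℕ.+-identityʳ s)) (ι-+ s s)
    go : Dec (2 ℕ.* s ℕ.< n) → ι s * r n - ι ((2 ℕ.* x) % n) * r n ≡ centred n x * r n
    go (yes lo) = trans
      (cong (λ z → ι s * r n - z * r n) (trans (cong ι (trans double (m<n⇒m%n≡m lo))) s+s))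
      (trans (solve 2 (λ s r → s :* r :- (s :+ s) :* r := :- s :* r) refl (ι s) (r n))
        (cong (_* r n) (sym (signed-low {n} {s} lo))))
    go (no 2s≮n) = trans
      (cong (λ z → ι s * r n - z * r n) 2x%n)
      (trans (solve 3 (λ s r n → s :* r :- (s :+ s :- n) :* r := (n :- s) :* r) refl (ι s) (r n) (ι n))
        (cong (_* r n) (sym (signed-high {n} {s} n≤2s))))
      where
      n≤2s = ℕ.≮⇒≥ 2s≮n
      t = 2 ℕ.* s ℕ.∸ n
      t<n : t ℕ.< n
      t<n = ℕ.+-cancelʳ-< n t n (subst (ℕ._< n ℕ.+ n) (sym (ℕ.m∸n+n≡m n≤2s))
        (ℕ.+-mono-<-≤ (m%n<n x n) (ℕ.≤-trans (ℕ.≤-reflexive (ℕ.+-identityʳ s)) (ℕ.<⇒≤ (m%n<n x n)))))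
      2x%n : ι ((2 ℕ.* x) % n) ≡ ι s + ι s - ι n
      2x%n = begin
        ι ((2 ℕ.* x) % n)       ≡⟨ cong ι (trans double (sym (m≤n⇒[n∸m]%m≡n%m n≤2s))) ⟩
        ι (t % n)               ≡⟨ cong ι (m<n⇒m%n≡m t<n) ⟩
        ι t                     ≡⟨ solve 2 (λ t n → t := (t :+ n) :- n) refl (ι t) (ι n) ⟩
        ι t + ι n - ι n         ≡⟨ cong (λ z → z - ι n) (trans (sym (ι-+ t n)) (cong ι (ℕ.m∸n+n≡m n≤2s))) ⟩
        ι (2 ℕ.* s) - ι n       ≡⟨ cong (λ z → z - ι n) s+s ⟩
        ι s + ι s - ι n         ∎
        where open ≡-Reasoning

  -- Averages of periodic sequences

  r-antitone : ∀ {m n} .{{_ : NonZero m}} → m ℕ.≤ n → r n ≤ r m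
  r-antitone {m} {n} m≤n = subst₂ _≤_
    (trans (cong (r n *_) (ι*r≡1 m)) (ℚ.*-identityʳ (r n)))
    (trans (sym (ℚ.*-assoc (r n) (ι n) (r m)))
      (trans (cong (_* r m) (trans (ℚ.*-comm (r n) (ι n)) (ι*r≡1 n {{ℕ.>-nonZero (ℕ.≤-trans (ℕ.>-nonZero⁻¹ m) m≤n)}})))
        (ℚ.*-identityˡ (r m))))
    (*-monoˡ (0≤r n) (*-monoʳ (0≤r m) (ι-mono m≤n)))

  ∑≡Sum : ∀ X {f : (x : ℕ) .{{_ : NonZero x}} → ℚ} {g} → (∀ i → f (suc i) ≡ g i) → ∑ X f ≡ Sum X g
  ∑≡Sum zero    e = refl
  ∑≡Sum (suc X) e = cong₂ _+_ (∑≡Sum X e) (e X)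

  -- The reals involved are constant sequences, so a rational estimate holds at every index; the
  -- additional slack in the order on ℝ is absorbed.
  fromℚ-limit : ∀ {a : (X : ℕ) .{{_ : NonZero X}} → ℚ} {l} →
    (∀ ε .{{_ : Positive ε}} → ∃[ N ] (∀ X .{{_ : NonZero X}} → N ℕ.≤ X → ∣ a X - l ∣ ≤ ε)) →
    (λ X → fromℚ (a X)) ⟶ fromℚ l
  fromℚ-limit h ε = let (N , p) = h ε in N , λ X N≤X ε′ → 0 , λ _ _ →
    ℚ.≤-trans (p X N≤X) (p≤p+q (ℚ.<⇒≤ (ℚ.positive⁻¹ ε′)))

  -- The partial sums of f minus its mean are themselves periodic, hence bounded.
  module _ {N : ℕ} .{{_ : NonZero N}} {f : ℕ → ℚ} (p : Periodic N f) where

    private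
      mean : ℚ
      mean = r N * Sum N f

      deviation : ℕ → ℚ
      deviation X = Sum X (λ i → f i - mean)

      deviation-≡ : ∀ X → deviation X ≡ Sum X f - ι X * mean
      deviation-≡ X = trans (Sum-+ X f (λ _ → - mean)) (cong (λ z → Sum X f + z)
        (trans (Sum-const X (- mean)) (sym (ℚ.neg-distribʳ-* (ι X) mean))))

      deviation-N : deviation N ≡ 0ℚ
      deviation-N = begin
        deviation N                        ≡⟨ deviation-≡ N ⟩
        Sum N f - ι N * (r N * Sum N f)    ≡⟨ solve 3 (λ s n r → s :- n :* (r :* s) := s :* (con 1ℚ :- n :* r)) refl (Sum N f) (ι N) (r N) ⟩
        Sum N f * (1ℚ - ι N * r N)         ≡⟨ cong (λ z → Sum N f * (1ℚ - z)) (ι*r≡1 N) ⟩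
        Sum N f * 0ℚ                       ≡⟨ ℚ.*-zeroʳ (Sum N f) ⟩
        0ℚ                                 ∎
        where open ≡-Reasoning

      deviation-periodic : Periodic N deviation
      deviation-periodic X = trans (Sum-split N X (λ i → f i - mean)) (trans
        (cong₂ _+_ deviation-N (Sum-cong X (λ i → cong (λ z → z - mean) (p i))))
        (ℚ.+-identityˡ (deviation X)))

      bound : ℚ
      bound = Sum N (λ i → ∣ f i - mean ∣)

      0≤bound : 0ℚ ≤ bound
      0≤bound = 0≤Sum N (λ i → ℚ.0≤∣p∣ (f i - mean))

      ∣deviation∣≤ : ∀ X → ∣ deviation X ∣ ≤ bound
      ∣deviation∣≤ X = begin
        ∣ deviation X ∣                                ≡⟨ cong (λ z → ∣ deviation z ∣) (trans (m≡m%n+[m/n]*n X N) (ℕ.+-comm (X % N) _)) ⟩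
        ∣ deviation (X ℕ./ N ℕ.* N ℕ.+ X % N) ∣        ≡⟨ cong ∣_∣ (periodic-* (X ℕ./ N) deviation-periodic (X % N)) ⟩
        ∣ deviation (X % N) ∣                          ≤⟨ ∣Sum∣≤ (X % N) (λ i → f i - mean) ⟩
        Sum (X % N) (λ i → ∣ f i - mean ∣)             ≤⟨ Sum-≤ (λ i → ℚ.0≤∣p∣ (f i - mean)) (ℕ.<⇒≤ (m%n<n X N)) ⟩
        bound                                          ∎
        where open ℚ.≤-Reasoning

      average-≡ : ∀ X .{{_ : NonZero X}} → r X * Sum X f - mean ≡ r X * deviation X
      average-≡ X = begin
        r X * Sum X f - mean                     ≡⟨ cong (λ z → r X * Sum X f - z) (trans (sym (ℚ.*-identityˡ mean)) (cong (_* mean) (sym (ι*r≡1 X)))) ⟩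
        r X * Sum X f - ι X * r X * mean         ≡⟨ solve 4 (λ r s x m → r :* s :- x :* r :* m := r :* (s :- x :* m)) refl (r X) (Sum X f) (ι X) mean ⟩
        r X * (Sum X f - ι X * mean)             ≡⟨ cong (r X *_) (deviation-≡ X) ⟨
        r X * deviation X                        ∎
        where open ≡-Reasoning

    average-limit : ∀ ε .{{_ : Positive ε}} →
      ∃[ K ] (∀ X .{{_ : NonZero X}} → K ℕ.≤ X → ∣ r X * Sum X f - mean ∣ ≤ ε)
    average-limit ε =
      -- The added 1 makes the bound strictly positive, so that ε can be divided by it.
      let b = bound + 1ℚ
          b>0 = ℚ.nonNeg+pos⇒pos bound {{nonNegative 0≤bound}} 1ℚ
          (δ , δ>0 , b*δ≡ε) = scaled b {{b>0}} ε
          (k , r≤δ) = archimedean δ {{δ>0}}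
      in suc k , λ X k<X → let open ℚ.≤-Reasoning in begin
        ∣ r X * Sum X f - mean ∣      ≡⟨ cong ∣_∣ (average-≡ X) ⟩
        ∣ r X * deviation X ∣         ≡⟨ ℚ.∣p*q∣≡∣p∣*∣q∣ (r X) (deviation X) ⟩
        ∣ r X ∣ * ∣ deviation X ∣     ≡⟨ cong (_* ∣ deviation X ∣) (ℚ.0≤p⇒∣p∣≡p (0≤r X)) ⟩
        r X * ∣ deviation X ∣         ≤⟨ *-mono-≤ (0≤r X) (0≤+ 0≤bound (ℚ.nonNegative⁻¹ 1ℚ))
                                           (ℚ.≤-trans (r-antitone k<X) r≤δ)
                                           (ℚ.≤-trans (∣deviation∣≤ X) (p≤p+q (ℚ.nonNegative⁻¹ 1ℚ))) ⟩
        δ * b                         ≡⟨ trans (ℚ.*-comm δ b) b*δ≡ε ⟩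
        ε                             ∎

  -- The value of the inner limit

  w : ℕ → ℚ
  w n = r n * r n

  w-* : ∀ m n → w (m ℕ.* n) ≡ w m * w n
  w-* m n = trans (cong₂ _*_ (r-* m n) (r-* m n))
    (solve 2 (λ a b → (a :* b) :* (a :* b) := (a :* a) :* (b :* b)) refl (r m) (r n))

  0≤w : ∀ n → 0ℚ ≤ w n
  0≤w n = 0≤* (0≤r n) (0≤r n)

  μℚ : ℕ → ℚ
  μℚ zero      = 0ℚ
  μℚ n@(suc _) = μ n / 1

  term : ℕ → ℕ → ℚ
  term m n = μℚ m * μℚ n * (w m * w n * κ m n)

  -- The four products of fractional parts factor as ({x/n} - {2x/n})({x/m} - {2x/m}). Each factor
  -- brings a further 1/n or 1/m, whence the squared weights.
  summand-centred : ∀ m n .{{_ : NonZero m}} .{{_ : NonZero n}} x →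
    summand m n x ≡ μℚ m * μℚ n * (w m * w n) * (centred m x * centred n x)
  summand-centred m@(suc _) n@(suc _) x = begin
    summand m n x
      ≡⟨ cong (_* (a * b - a′ * b - a * b′ + a′ * b′)) coeff ⟩
    μℚ m * μℚ n * (r m * r n) * (a * b - a′ * b - a * b′ + a′ * b′)
      ≡⟨ cong (μℚ m * μℚ n * (r m * r n) *_) (solve 4 (λ a a′ b b′ → a :* b :- a′ :* b :- a :* b′ :+ a′ :* b′
           := (b :- b′) :* (a :- a′)) refl a a′ b b′) ⟩
    μℚ m * μℚ n * (r m * r n) * ((b - b′) * (a - a′))
      ≡⟨ cong (μℚ m * μℚ n * (r m * r n) *_) (cong₂ _*_ (frac-diff x m) (frac-diff x n)) ⟩
    μℚ m * μℚ n * (r m * r n) * (centred m x * r m * (centred n x * r n))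
      ≡⟨ solve 5 (λ μ rm rn cm cn → μ :* (rm :* rn) :* (cm :* rm :* (cn :* rn)) := μ :* ((rm :* rm) :* (rn :* rn)) :* (cm :* cn)) refl
           (μℚ m * μℚ n) (r m) (r n) (centred m x) (centred n x) ⟩
    μℚ m * μℚ n * (w m * w n) * (centred m x * centred n x) ∎
    where
    open ≡-Reasoning
    a = frac (ℤ.+ x / n)
    a′ = frac (ℤ.+ (2 ℕ.* x) / n)
    b = frac (ℤ.+ x / m)
    b′ = frac (ℤ.+ (2 ℕ.* x) / m)
    coeff : (μ m ℤ.* μ n) / (m ℕ.* n) ≡ μℚ m * μℚ n * (r m * r n)
    coeff = begin
      (μ m ℤ.* μ n) / (m ℕ.* n)          ≡⟨ /-* (μ m) (μ n) m n ⟨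
      (μ m / m) * (μ n / n)              ≡⟨ cong₂ _*_ (unit (μ m) m) (unit (μ n) n) ⟩
      μℚ m * r m * (μℚ n * r n)          ≡⟨ solve 4 (λ a b c d → a :* b :* (c :* d) := a :* c :* (b :* d)) refl (μℚ m) (r m) (μℚ n) (r n) ⟩
      μℚ m * μℚ n * (r m * r n)          ∎
      where
      unit : ∀ i k .{{_ : NonZero k}} → i / k ≡ i / 1 * r k
      unit i (suc k) = sym (trans (/-* i 1ℤ 1 (suc k)) (ℚ./-cong (ℤ.*-identityʳ i) (ℕ.*-identityˡ (suc k))))

  summand-limit : ∀ m n .{{_ : NonZero m}} .{{_ : NonZero n}} →
    (λ X → fromℚ (1ℤ / X * ∑ X (λ x → summand m n x))) ⟶ fromℚ (term m n)
  summand-limit m@(suc m′) n@(suc n′) = fromℚ-limit {λ X → 1ℤ / X * ∑ X (λ x → summand m n x)} {term m n} λ ε → let (K , h) = average-limit {N} {f} f-periodic ε in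
    K , λ { X@(suc _) K≤X → subst₂ (λ s t → ∣ 1ℤ / X * s - t ∣ ≤ ε)
        (sym (∑≡Sum X {λ x → summand m n x} {f} (λ i → summand-centred m n (suc i)))) mean≡ (h X K≤X) }
    where
    N = m ℕ.* n
    A = μℚ m * μℚ n * (w m * w n)
    centred² : ℕ → ℚ
    centred² x = centred m x * centred n x
    f : ℕ → ℚ
    -- `∑` starts at x = 1 and `Sum` at 0; over a full period the shift by one is undone by
    -- `Sum-shift1`.
    f i = A * centred² (suc i)
    centred²-periodic : Periodic N centred²
    centred²-periodic = periodic-× {N} {centred m} {centred n}
      (subst (λ z → Periodic z (centred m)) (ℕ.*-comm n m) (periodic-* {m} {centred m} n (centred-periodic m)))
      (periodic-* {n} {centred n} m (centred-periodic n))
    f-periodic : Periodic N f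
    f-periodic i = cong (A *_) (trans (cong centred² (sym (ℕ.+-suc N i))) (centred²-periodic (suc i)))
    mean≡ : r N * Sum N f ≡ term m n
    mean≡ = begin
      r N * Sum N f                              ≡⟨ cong (r N *_) (trans (Sum-*ˡ N A (λ i → centred² (suc i))) (cong (A *_) (Sum-shift1 {N} {centred²} centred²-periodic))) ⟩
      r N * (A * Sum N centred²)                  ≡⟨ solve 4 (λ r μ w s → r :* (μ :* w :* s) := μ :* (w :* (r :* s))) refl (r N) (μℚ m * μℚ n) (w m * w n) (Sum N centred²) ⟩
      term m n                                   ∎
      where open ≡-Reasoning

  -- Sums over lists without repetitions

  private variable
    I I′ : Set

  listSum : (I → ℚ) → List I → ℚ
  listSum f []       = 0ℚ
  listSum f (x ∷ xs) = f x + listSum f xs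

  listSum-++ : ∀ (f : I → ℚ) xs ys → listSum f (xs ++ ys) ≡ listSum f xs + listSum f ys
  listSum-++ f []       ys = sym (ℚ.+-identityˡ _)
  listSum-++ f (x ∷ xs) ys = trans (cong (f x +_) (listSum-++ f xs ys)) (sym (ℚ.+-assoc (f x) _ _))

  listSum-map : ∀ (f : I′ → ℚ) (g : I → I′) xs → listSum f (map g xs) ≡ listSum (λ x → f (g x)) xs
  listSum-map f g []       = refl
  listSum-map f g (x ∷ xs) = cong (f (g x) +_) (listSum-map f g xs)

  listSum-cong : ∀ {f g : I → ℚ} xs → (∀ {x} → x ∈ xs → f x ≡ g x) → listSum f xs ≡ listSum g xs
  listSum-cong []       e = refl
  listSum-cong (x ∷ xs) e = cong₂ _+_ (e (here refl)) (listSum-cong xs (λ i → e (there i)))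

  listSum-mono : ∀ {f g : I → ℚ} xs → (∀ {x} → x ∈ xs → f x ≤ g x) → listSum f xs ≤ listSum g xs
  listSum-mono []       e = ℚ.≤-refl
  listSum-mono (x ∷ xs) e = ℚ.+-mono-≤ (e (here refl)) (listSum-mono xs (λ i → e (there i)))

  listSum-*ˡ : ∀ c (f : I → ℚ) xs → listSum (λ x → c * f x) xs ≡ c * listSum f xs
  listSum-*ˡ c f []       = sym (ℚ.*-zeroʳ c)
  listSum-*ˡ c f (x ∷ xs) = trans (cong (c * f x +_) (listSum-*ˡ c f xs)) (sym (ℚ.*-distribˡ-+ c (f x) _))

  listSum-+ : ∀ (f g : I → ℚ) xs → listSum (λ x → f x + g x) xs ≡ listSum f xs + listSum g xs
  listSum-+ f g []       = refl
  listSum-+ f g (x ∷ xs) = trans (cong (f x + g x +_) (listSum-+ f g xs))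
    (solve 4 (λ a b c d → (a :+ b) :+ (c :+ d) := (a :+ c) :+ (b :+ d)) refl (f x) (g x) _ _)

  0≤listSum : ∀ {f : I → ℚ} xs → (∀ x → 0ℚ ≤ f x) → 0ℚ ≤ listSum f xs
  0≤listSum []       h = ℚ.≤-refl
  0≤listSum (x ∷ xs) h = 0≤+ (h x) (0≤listSum xs h)

  ∣listSum∣≤ : ∀ (f : I → ℚ) xs → ∣ listSum f xs ∣ ≤ listSum (λ x → ∣ f x ∣) xs
  ∣listSum∣≤ f []       = ℚ.≤-refl
  ∣listSum∣≤ f (x ∷ xs) = ℚ.≤-trans (ℚ.∣p+q∣≤∣p∣+∣q∣ (f x) (listSum f xs)) (ℚ.+-monoʳ-≤ ∣ f x ∣ (∣listSum∣≤ f xs))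

  listSum-↭ : ∀ (f : I → ℚ) {xs ys} → xs ↭ ys → listSum f xs ≡ listSum f ys
  listSum-↭ f ↭.refl         = refl
  listSum-↭ f (↭.prep x p)   = cong (f x +_) (listSum-↭ f p)
  listSum-↭ f (↭.swap x y p) = trans (cong (λ z → f x + (f y + z)) (listSum-↭ f p))
    (solve 3 (λ a b c → a :+ (b :+ c) := b :+ (a :+ c)) refl (f x) (f y) _)
  listSum-↭ f (↭.trans p q)  = trans (listSum-↭ f p) (listSum-↭ f q)

  listSum-cartesianProduct : ∀ (f : I × I′ → ℚ) xs ys →
    listSum f (cartesianProduct xs ys) ≡ listSum (λ x → listSum (λ y → f (x , y)) ys) xs
  listSum-cartesianProduct f []       ys = refl
  listSum-cartesianProduct f (x ∷ xs) ys = trans (listSum-++ f (map (x ,_) ys) _)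
    (cong₂ _+_ (listSum-map f (x ,_) ys) (listSum-cartesianProduct f xs ys))

  -- The elements of `xs` are taken out of `ys` one at a time. This is how an inclusion of index
  -- sets becomes a splitting of sums.
  unique-⊆⇒↭ : ∀ {xs ys : List I} → Unique xs → xs ⊆ ys → ∃[ zs ] ys ↭ xs ++ zs
  unique-⊆⇒↭ {xs = []}     {ys} u        xs⊆ys = ys , ↭.refl
  unique-⊆⇒↭ {xs = x ∷ xs} {ys} uu@(_ ∷ u) xs⊆ys with ∈-∃++ (xs⊆ys (here refl))
  ... | as , bs , refl =
    let zs , p = unique-⊆⇒↭ {xs = xs} {as ++ bs} u rest in
    zs , ↭.trans (shift x as bs) (↭.prep x p)
    where
    rest : xs ⊆ as ++ bs
    rest y∈xs with ∈-resp-↭ (shift x as bs) (xs⊆ys (there y∈xs))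
    ... | here refl = contradiction y∈xs (Unique[x∷xs]⇒x∉xs uu)
    ... | there y∈  = y∈

  ++-disjoint : ∀ (xs : List I) {zs z} → Unique (xs ++ zs) → z ∈ zs → z ∉ xs
  ++-disjoint (x ∷ xs) u       z∈zs (here refl)  = Unique[x∷xs]⇒x∉xs u (∈-++⁺ʳ xs z∈zs)
  ++-disjoint (x ∷ xs) (_ ∷ u) z∈zs (there z∈xs) = ++-disjoint xs u z∈zs z∈xs

  complement : ∀ {xs ys : List I} → Unique xs → Unique ys → xs ⊆ ys →
    ∃[ zs ] (ys ↭ xs ++ zs × (∀ {z} → z ∈ zs → z ∈ ys × z ∉ xs))
  complement {I = I} {xs} {ys} uxs uys xs⊆ys =
    let zs , p = unique-⊆⇒↭ uxs xs⊆ys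
        u = Unique-resp-↭ (setoid I) (↭⇒↭ₛ p) uys
    in zs , p , λ z∈zs → ∈-resp-↭ (↭-sym p) (∈-++⁺ʳ xs z∈zs) , ++-disjoint xs u z∈zs

  range : ℕ → List ℕ
  range = applyDownFrom suc

  listSum-range : ∀ f n → listSum f (range n) ≡ Sum n (λ i → f (suc i))
  listSum-range f zero    = refl
  listSum-range f (suc n) = trans (cong (f (suc n) +_) (listSum-range f n)) (ℚ.+-comm (f (suc n)) _)

  range-unique : ∀ n → Unique (range n)
  range-unique n = applyDownFrom⁺₁ suc n (λ j<i _ eq → ℕ.<⇒≢ j<i (sym (ℕ.suc-injective eq)))

  ∈-range⁺ : ∀ {m n} .{{_ : NonZero m}} → m ℕ.≤ n → m ∈ range n
  ∈-range⁺ {suc m} m≤n = ∈-applyDownFrom⁺ suc m≤n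

  ∈-range⁻ : ∀ {m n} → m ∈ range n → NonZero m × m ℕ.≤ n
  ∈-range⁻ m∈ with ∈-applyDownFrom⁻ suc m∈
  ... | i , i<n , refl = _ , i<n

  -- The sum of (gcd(m, n)/(m n))² over pairs outside a square is controlled by writing
  -- (m , n) = (a d , b d) with d the gcd, which injects pairs into triples weighted by 1/(d a b)².

  majorant : ℕ × ℕ → ℚ
  majorant (m , n) = w m * w n * (ι (gcd m n) * ι (gcd m n))

  0≤majorant : ∀ mn → 0ℚ ≤ majorant mn
  0≤majorant (m , n) = 0≤* (0≤* (0≤w m) (0≤w n)) (0≤* (0≤ι (gcd m n)) (0≤ι (gcd m n)))

  triple : ℕ × ℕ → ℕ × ℕ × ℕ
  triple (m , n) = gcd m n , quotient (gcd[m,n]∣m m n) , quotient (gcd[m,n]∣n m n)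

  triple-injective : ∀ {p q} → triple p ≡ triple q → p ≡ q
  triple-injective {m , n} {m′ , n′} eq with ,-injective eq
  ... | g≡ , eq′ with ,-injective eq′
  ...   | a≡ , b≡ = cong₂ _,_
    (trans (m∣n⇒n≡quotient*m (gcd[m,n]∣m m n)) (trans (cong₂ ℕ._*_ a≡ g≡) (sym (m∣n⇒n≡quotient*m (gcd[m,n]∣m m′ n′)))))
    (trans (m∣n⇒n≡quotient*m (gcd[m,n]∣n m n)) (trans (cong₂ ℕ._*_ b≡ g≡) (sym (m∣n⇒n≡quotient*m (gcd[m,n]∣n m′ n′)))))

  w₃ : ℕ × ℕ × ℕ → ℚ
  w₃ (d , a , b) = w d * (w a * w b)

  majorant-triple : ∀ m n .{{_ : NonZero m}} → majorant (m , n) ≡ w₃ (triple (m , n))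
  majorant-triple m n = begin
    w m * w n * (ι d * ι d)
      ≡⟨ cong₂ (λ s t → w s * w t * (ι d * ι d)) (m∣n⇒n≡quotient*m (gcd[m,n]∣m m n)) (m∣n⇒n≡quotient*m (gcd[m,n]∣n m n)) ⟩
    w (a ℕ.* d) * w (b ℕ.* d) * (ι d * ι d)
      ≡⟨ cong₂ (λ s t → s * t * (ι d * ι d)) (w-* a d) (w-* b d) ⟩
    w a * (r d * r d) * (w b * (r d * r d)) * (ι d * ι d)
      ≡⟨ solve 4 (λ a b rd d → a :* (rd :* rd) :* (b :* (rd :* rd)) :* (d :* d)
           := (d :* rd) :* (d :* rd) :* ((rd :* rd) :* (a :* b))) refl (w a) (w b) (r d) (ι d) ⟩
    ι d * r d * (ι d * r d) * (w d * (w a * w b))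
      ≡⟨ cong (λ z → z * z * (w d * (w a * w b))) (ι*r≡1 d {{ℕ.≢-nonZero (gcd[m,n]≢0 m n (inj₁ (ℕ.≢-nonZero⁻¹ m)))}}) ⟩
    1ℚ * 1ℚ * (w d * (w a * w b))
      ≡⟨ ℚ.*-identityˡ _ ⟩
    w d * (w a * w b) ∎
    where
    open ≡-Reasoning
    d = gcd m n
    a = quotient (gcd[m,n]∣m m n)
    b = quotient (gcd[m,n]∣n m n)

  cube : ℕ → List (ℕ × ℕ × ℕ)
  cube K = cartesianProduct (range K) (cartesianProduct (range K) (range K))

  cube-unique : ∀ K → Unique (cube K)
  cube-unique K = cartesianProduct⁺ (range-unique K) (cartesianProduct⁺ (range-unique K) (range-unique K))

  ζ₂ : ℕ → ℚ
  ζ₂ K = Sum K (λ i → w (suc i))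

  listSum-product : ∀ (f : I → ℚ) (g : I′ → ℚ) xs ys →
    listSum (λ (x , y) → f x * g y) (cartesianProduct xs ys) ≡ listSum f xs * listSum g ys
  listSum-product f g xs ys = trans (listSum-cartesianProduct _ xs ys)
    (trans (listSum-cong xs (λ {x} _ → trans (listSum-*ˡ (f x) g ys) (ℚ.*-comm (f x) _)))
    (trans (listSum-*ˡ (listSum g ys) f xs) (ℚ.*-comm (listSum g ys) _)))

  listSum-cube : ∀ K → listSum w₃ (cube K) ≡ ζ₂ K * (ζ₂ K * ζ₂ K)
  listSum-cube K = trans (listSum-product w (λ (a , b) → w a * w b) (range K) _)
    (trans (cong (listSum w (range K) *_) (listSum-product w w (range K) (range K)))
    (cong (λ z → z * (z * z)) (listSum-range w K)))

  -- If d, a and b are all at most `M`, then m = a d and n = b d are at most M². Hence the triples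
  -- of pairs outside the square avoid `cube M`; being distinct and contained in `cube K`, they
  -- weigh at most the difference of the two cubes.
  majorant-tail : ∀ {M K} → M ℕ.≤ K → ∀ {R : List (ℕ × ℕ)} → Unique R →
    (∀ {m n} → (m , n) ∈ R → NonZero m × NonZero n × m ℕ.≤ K × n ℕ.≤ K) →
    (∀ {m n} → (m , n) ∈ R → ¬ (m ℕ.≤ M ℕ.* M × n ℕ.≤ M ℕ.* M)) →
    listSum majorant R ≤ ζ₂ K * (ζ₂ K * ζ₂ K) - ζ₂ M * (ζ₂ M * ζ₂ M)
  majorant-tail {M} {K} M≤K {R} uR inside outside = begin
    listSum majorant R
      ≡⟨ listSum-cong R (λ { {m , n} x∈ → majorant-triple m n {{proj₁ (inside x∈)}} }) ⟩
    listSum (λ x → w₃ (triple x)) R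
      ≡⟨ solve 2 (λ a b → a := a :+ b :- b) refl _ (listSum w₃ (cube M)) ⟩
    listSum (λ x → w₃ (triple x)) R + listSum w₃ (cube M) - listSum w₃ (cube M)
      ≡⟨ cong (λ z → z - listSum w₃ (cube M)) (trans (cong (_+ listSum w₃ (cube M)) (sym (listSum-map w₃ triple R))) (sym (listSum-++ w₃ (map triple R) (cube M)))) ⟩
    listSum w₃ T - listSum w₃ (cube M)
      ≤⟨ ℚ.+-monoˡ-≤ (- listSum w₃ (cube M)) T≤ ⟩
    listSum w₃ (cube K) - listSum w₃ (cube M)
      ≡⟨ cong₂ _-_ (listSum-cube K) (listSum-cube M) ⟩
    ζ₂ K * (ζ₂ K * ζ₂ K) - ζ₂ M * (ζ₂ M * ζ₂ M) ∎
    where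
    open ℚ.≤-Reasoning
    T = map triple R ++ cube M
    unpack : ∀ {L d a b} → (d , a , b) ∈ cube L → d ∈ range L × a ∈ range L × b ∈ range L
    unpack {L} x∈ = let d∈ , ab∈ = ∈-cartesianProduct⁻ (range L) _ x∈
                    in d∈ , ∈-cartesianProduct⁻ (range L) (range L) ab∈
    uT : Unique T
    uT = ++⁺ (map⁺ triple-injective uR) (cube-unique M) disjoint
      where
      disjoint : ∀ {x} → ¬ (x ∈ map triple R × x ∈ cube M)
      disjoint (x∈ , x∈M) with ∈-map⁻ triple x∈
      ... | (m , n) , mn∈ , refl =
        let d∈ , a∈ , b∈ = unpack {M} x∈M
            d≤ = proj₂ (∈-range⁻ d∈)
        in outside mn∈
          ( subst (ℕ._≤ M ℕ.* M) (sym (m∣n⇒n≡quotient*m (gcd[m,n]∣m m n))) (ℕ.*-mono-≤ (proj₂ (∈-range⁻ a∈)) d≤)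
          , subst (ℕ._≤ M ℕ.* M) (sym (m∣n⇒n≡quotient*m (gcd[m,n]∣n m n))) (ℕ.*-mono-≤ (proj₂ (∈-range⁻ b∈)) d≤))
    T⊆ : T ⊆ cube K
    T⊆ {x} x∈ with ∈-++⁻ (map triple R) x∈
    ... | inj₂ x∈M = let d∈ , a∈ , b∈ = unpack {M} x∈M in
      ∈-cartesianProduct⁺ (widen d∈) (∈-cartesianProduct⁺ (widen a∈) (widen b∈))
      where
      widen : ∀ {i} → i ∈ range M → i ∈ range K
      widen i∈ = let i≢0 , i≤M = ∈-range⁻ i∈ in ∈-range⁺ {{i≢0}} (ℕ.≤-trans i≤M M≤K)
    ... | inj₁ x∈R with ∈-map⁻ triple x∈R
    ...   | (m , n) , mn∈ , refl =
      let m≢0 , n≢0 , m≤K , n≤K = inside mn∈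
          g∣m = gcd[m,n]∣m m n
          g∣n = gcd[m,n]∣n m n
      in ∈-cartesianProduct⁺
           (∈-range⁺ {{ℕ.≢-nonZero (gcd[m,n]≢0 m n (inj₁ (ℕ.≢-nonZero⁻¹ m {{m≢0}})))}}
             (ℕ.≤-trans (∣⇒≤ {{m≢0}} g∣m) m≤K))
           (∈-cartesianProduct⁺
             (∈-range⁺ {{quotient≢0 g∣m {{m≢0}}}} (ℕ.≤-trans (∣⇒≤ {{m≢0}} (quotient-∣ g∣m)) m≤K))
             (∈-range⁺ {{quotient≢0 g∣n {{n≢0}}}} (ℕ.≤-trans (∣⇒≤ {{n≢0}} (quotient-∣ g∣n)) n≤K)))
    T≤ : listSum w₃ T ≤ listSum w₃ (cube K)
    T≤ = let zs , p = unique-⊆⇒↭ uT T⊆ in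
      subst (listSum w₃ T ≤_) (sym (trans (listSum-↭ w₃ p) (listSum-++ w₃ T zs)))
        (p≤p+q (0≤listSum zs (λ (d , a , b) → 0≤* (0≤w d) (0≤* (0≤w a) (0≤w b)))))

  -- The Möbius function

  primeFactors : (n : ℕ) .{{_ : NonZero n}} → List ℕ
  primeFactors n = factors (factorise n)

  module _ (n : ℕ) .{{_ : NonZero n}} where
    open PrimeFactorisation (factorise n)

    primeFactors-prime : All Prime (primeFactors n)
    primeFactors-prime = factorsPrime

    product-primeFactors : product (primeFactors n) ≡ n
    product-primeFactors = sym isFactorisation

    primeFactors-∣ : ∀ {p} → p ∈ primeFactors n → p ∣ n
    primeFactors-∣ {p} p∈ = subst (p ∣_) product-primeFactors (go p∈)
      where
      go : ∀ {ps} → p ∈ ps → p ∣ product ps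
      go {q ∷ ps} (here refl) = m∣m*n (product ps)
      go {q ∷ ps} (there p∈)  = ∣-trans (go p∈) (n∣m*n q)

    μ-unique : Unique (primeFactors n) → μ n ≡ -1ℤ ℤ.^ length (primeFactors n)
    μ-unique u = cong (λ b → if b then -1ℤ ℤ.^ length (primeFactors n) else 0ℤ) (dec-true (unique? (primeFactors n)) u)

    μ-¬unique : ¬ Unique (primeFactors n) → μ n ≡ 0ℤ
    μ-¬unique ¬u = cong (λ b → if b then -1ℤ ℤ.^ length (primeFactors n) else 0ℤ) (dec-false (unique? (primeFactors n)) ¬u)

  primeFactors-* : ∀ {p} n .{{_ : NonZero n}} .{{_ : NonZero (p ℕ.* n)}} → Prime p →
    primeFactors (p ℕ.* n) ↭ p ∷ primeFactors n
  primeFactors-* {p} n pp = factorisationUnique (factorise (p ℕ.* n)) (record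
    { factors         = p ∷ primeFactors n
    ; isFactorisation = cong (p ℕ.*_) (sym (product-primeFactors n))
    ; factorsPrime    = pp ∷ primeFactors-prime n
    })

  -- A new prime adds one prime factor and neither creates nor removes a repetition.
  μ-* : ∀ {p} n .{{_ : NonZero n}} .{{_ : NonZero (p ℕ.* n)}} → Prime p → p ∤ n →
    μ (p ℕ.* n) ≡ ℤ.- μ n
  μ-* {p} n pp p∤n with unique? (primeFactors n)
  ... | yes u = begin
    μ (p ℕ.* n)                                  ≡⟨ μ-unique (p ℕ.* n) u′ ⟩
    -1ℤ ℤ.^ length (primeFactors (p ℕ.* n))      ≡⟨ cong (-1ℤ ℤ.^_) (↭-length p↭) ⟩
    -1ℤ ℤ.* -1ℤ ℤ.^ length (primeFactors n)      ≡⟨ ℤ.-1*i≡-i _ ⟩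
    ℤ.- (-1ℤ ℤ.^ length (primeFactors n))        ∎
    where
    open ≡-Reasoning
    p↭ = primeFactors-* n pp
    u′ : Unique (primeFactors (p ℕ.* n))
    u′ = Unique-resp-↭ (setoid ℕ) (↭⇒↭ₛ (↭-sym p↭))
      (¬Any⇒All¬ _ (λ p∈ → p∤n (primeFactors-∣ n p∈)) ∷ u)
  ... | no ¬u = trans (μ-¬unique (p ℕ.* n) ¬u′) refl
    where
    ¬u′ : ¬ Unique (primeFactors (p ℕ.* n))
    ¬u′ u with Unique-resp-↭ (setoid ℕ) (↭⇒↭ₛ (primeFactors-* n pp)) u
    ... | _ ∷ u″ = ¬u u″

  μℚ≡μ/1 : ∀ m .{{_ : NonZero m}} → μℚ m ≡ μ m / 1
  μℚ≡μ/1 (suc _) = refl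

  neg-/1 : ∀ i → ℤ.- i / 1 ≡ - (i / 1)
  neg-/1 (ℤ.+ zero)    = refl
  neg-/1 (ℤ.+ (suc k)) = refl
  neg-/1 ℤ.-[1+ k ]    = solve 1 (λ a → a := :- (:- a)) refl (ℤ.+ (suc k) / 1)

  μℚ-* : ∀ {p} n .{{_ : NonZero n}} → Prime p → p ∤ n → μℚ (p ℕ.* n) ≡ - μℚ n
  μℚ-* {p} n pp p∤n = begin
    μℚ (p ℕ.* n)        ≡⟨ μℚ≡μ/1 (p ℕ.* n) ⟩
    μ (p ℕ.* n) / 1     ≡⟨ cong (_/ 1) (μ-* n pp p∤n) ⟩
    (ℤ.- μ n) / 1       ≡⟨ neg-/1 (μ n) ⟩
    - (μ n / 1)         ≡⟨ cong -_ (μℚ≡μ/1 n) ⟨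
    - μℚ n              ∎
    where
    open ≡-Reasoning
    instance
      p*n≢0 : NonZero (p ℕ.* n)
      p*n≢0 = ℕ.m*n≢0 p n {{prime⇒nonZero pp}}

  -- Products of distinct primes from a given list

  subproducts : List ℕ → List ℕ
  subproducts []       = 1 ∷ []
  subproducts (p ∷ ps) = subproducts ps ++ map (p ℕ.*_) (subproducts ps)

  prime-∤⇒coprime : ∀ {p n} → Prime p → p ∤ n → Coprime n p
  prime-∤⇒coprime pp p∤n (i∣n , i∣p) with prime⇒irreducible pp i∣p
  ... | inj₁ i≡1  = i≡1
  ... | inj₂ refl = contradiction i∣n p∤n

  subproducts-∣ : ∀ ps {m} → m ∈ subproducts ps → m ∣ product ps
  subproducts-∣ []       (here refl) = ∣-refl
  subproducts-∣ (p ∷ ps) m∈ with ∈-++⁻ (subproducts ps) m∈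
  ... | inj₁ m∈′ = ∣-trans (subproducts-∣ ps m∈′) (n∣m*n p)
  ... | inj₂ m∈′ with ∈-map⁻ (p ℕ.*_) m∈′
  ...   | k , k∈ , refl = *-monoʳ-∣ p (subproducts-∣ ps k∈)

  ∣-subproducts : ∀ {ps m} → All Prime ps → m ∣ product ps → m ∈ subproducts ps
  ∣-subproducts {[]} [] m∣ = here (∣1⇒≡1 m∣)
  ∣-subproducts {p ∷ ps} {m} (pp ∷ pps) m∣ with p ∣? m
  ... | no p∤m = ∈-++⁺ˡ (∣-subproducts pps (coprime-divisor (prime-∤⇒coprime pp p∤m) m∣))
  ... | yes (divides k refl) = ∈-++⁺ʳ (subproducts ps) (subst (_∈ map (p ℕ.*_) (subproducts ps)) (ℕ.*-comm p k)
    (∈-map⁺ (p ℕ.*_) (∣-subproducts pps (*-cancelˡ-∣ p {{prime⇒nonZero pp}} (subst (_∣ p ℕ.* product ps) (ℕ.*-comm k p) m∣)))))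

  ∉⇒∤ : ∀ {p ps} → Prime p → All Prime ps → p ∉ ps → ∀ {m} → m ∈ subproducts ps → p ∤ m
  ∉⇒∤ {ps = ps} pp pps p∉ m∈ p∣m = p∉ (factorisationHasAllPrimeFactors pp (∣-trans p∣m (subproducts-∣ ps m∈)) pps)

  subproducts-nonZero : ∀ {ps} → All Prime ps → ∀ {m} → m ∈ subproducts ps → NonZero m
  subproducts-nonZero []         (here refl) = _
  subproducts-nonZero {p ∷ ps} (pp ∷ pps) m∈ with ∈-++⁻ (subproducts ps) m∈
  ... | inj₁ m∈′ = subproducts-nonZero pps m∈′
  ... | inj₂ m∈′ with ∈-map⁻ (p ℕ.*_) m∈′
  ...   | k , k∈ , refl = ℕ.m*n≢0 p k {{prime⇒nonZero pp}} {{subproducts-nonZero pps k∈}}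

  subproducts-unique : ∀ {ps} → All Prime ps → Unique ps → Unique (subproducts ps)
  subproducts-unique [] [] = [] ∷ []
  subproducts-unique {p ∷ ps} (pp ∷ pps) uu@(_ ∷ u) = ++⁺ us
    (map⁺ (λ {x} {y} → ℕ.*-cancelˡ-≡ x y p {{prime⇒nonZero pp}}) us) disjoint
    where
    us = subproducts-unique pps u
    disjoint : ∀ {m} → ¬ (m ∈ subproducts ps × m ∈ map (p ℕ.*_) (subproducts ps))
    disjoint (m∈ , m∈′) with ∈-map⁻ (p ℕ.*_) m∈′
    ... | k , _ , refl = ∉⇒∤ pp pps (Unique[x∷xs]⇒x∉xs uu) m∈ (m∣m*n k)

  product-∣ : ∀ {fs} k → All Prime fs → Unique fs → All (_∣ k) fs → product fs ∣ k
  product-∣ k [] [] [] = 1∣ k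
  product-∣ {p ∷ fs} k (pp ∷ pfs) uu@(_ ∷ u) (p∣k ∷ fs∣k) with p∣k
  ... | divides j refl = subst (p ℕ.* product fs ∣_) (ℕ.*-comm p j) (*-monoʳ-∣ p
    (coprime-divisor (prime-∤⇒coprime pp λ p∣Π →
        Unique[x∷xs]⇒x∉xs uu (factorisationHasAllPrimeFactors pp p∣Π pfs))
      (subst (product fs ∣_) (ℕ.*-comm j p) (product-∣ (j ℕ.* p) pfs u fs∣k))))

  ∈⇒∣product : ∀ {p ps} → p ∈ ps → p ∣ product ps
  ∈⇒∣product {ps = q ∷ ps} (here refl) = m∣m*n (product ps)
  ∈⇒∣product {ps = q ∷ ps} (there p∈)  = ∣-trans (∈⇒∣product p∈) (n∣m*n q)

  -- A squarefree m is a product of distinct primes that are at most m. With all primes up to a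
  -- bound in `ps`, no index below the bound with μ(m) ≠ 0 is missed.
  μℚ-support : ∀ {ps} m .{{_ : NonZero m}} → All Prime ps → (∀ {p} → Prime p → p ℕ.≤ m → p ∈ ps) →
    μℚ m ≡ 0ℚ ⊎ m ∈ subproducts ps
  μℚ-support {ps} m@(suc _) pps primes∈ with unique? (primeFactors m)
  ... | no ¬u = inj₁ refl
  ... | yes u = inj₂ (∣-subproducts pps (subst (_∣ product ps) (product-primeFactors m)
    (product-∣ (product ps) (primeFactors-prime m) u (All.tabulate λ p∈ →
      ∈⇒∣product (primes∈ (All.lookup (primeFactors-prime m) p∈) (∣⇒≤ (primeFactors-∣ m p∈)))))))

  -- Sums over products of distinct primes

  Σ² : List ℕ → (ℕ → ℕ → ℚ) → ℚ
  Σ² ps F = listSum (λ m → listSum (F m) (subproducts ps)) (subproducts ps)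

  Σ²-cong : ∀ ps {F G : ℕ → ℕ → ℚ} → (∀ {m n} → m ∈ subproducts ps → n ∈ subproducts ps → F m n ≡ G m n) →
    Σ² ps F ≡ Σ² ps G
  Σ²-cong ps e = listSum-cong (subproducts ps) (λ m∈ → listSum-cong (subproducts ps) (λ n∈ → e m∈ n∈))

  Σ²-*ˡ : ∀ ps c F → Σ² ps (λ m n → c * F m n) ≡ c * Σ² ps F
  Σ²-*ˡ ps c F = trans (listSum-cong (subproducts ps) (λ {m} _ → listSum-*ˡ c (F m) (subproducts ps)))
    (listSum-*ˡ c _ (subproducts ps))

  Σ²-+ : ∀ ps F G → Σ² ps (λ m n → F m n + G m n) ≡ Σ² ps F + Σ² ps G
  Σ²-+ ps F G = trans (listSum-cong (subproducts ps) (λ {m} _ → listSum-+ (F m) (G m) (subproducts ps)))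
    (listSum-+ _ _ (subproducts ps))

  -- Each index either avoids p or is p times one that does. This is the recursion that produces the
  -- Euler products.
  Σ²-∷ : ∀ p ps F → Σ² (p ∷ ps) F ≡
    Σ² ps (λ m n → F m n + F m (p ℕ.* n) + (F (p ℕ.* m) n + F (p ℕ.* m) (p ℕ.* n)))
  Σ²-∷ p ps F = begin
    Σ² (p ∷ ps) F
      ≡⟨ split _ ⟩
    listSum (λ m → listSum (F m) (subproducts (p ∷ ps)) + listSum (F (p ℕ.* m)) (subproducts (p ∷ ps))) (subproducts ps)
      ≡⟨ listSum-cong (subproducts ps) (λ {m} _ → trans (cong₂ _+_ (split (F m)) (split (F (p ℕ.* m))))
           (sym (listSum-+ _ _ (subproducts ps)))) ⟩
    Σ² ps (λ m n → F m n + F m (p ℕ.* n) + (F (p ℕ.* m) n + F (p ℕ.* m) (p ℕ.* n))) ∎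
    where
    open ≡-Reasoning
    split : ∀ f → listSum f (subproducts (p ∷ ps)) ≡ listSum (λ m → f m + f (p ℕ.* m)) (subproducts ps)
    split f = trans (listSum-++ f (subproducts ps) _)
      (trans (cong (λ z → listSum f (subproducts ps) + z) (listSum-map f (p ℕ.*_) (subproducts ps)))
        (sym (listSum-+ f _ (subproducts ps))))

  E : List ℕ → ℚ
  E []       = 1ℚ
  E (p ∷ ps) = (1ℚ - w p) * E ps

  gcd-*ˡ : ∀ {p} m n → Prime p → p ∤ n → gcd (p ℕ.* m) n ≡ gcd m n
  gcd-*ˡ {p} m n pp p∤n = ∣-antisym
    (gcd-greatest
      (coprime-divisor {n = p} (λ (i∣g , i∣p) → prime-∤⇒coprime pp p∤n (∣-trans i∣g (gcd[m,n]∣n (p ℕ.* m) n) , i∣p))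
        (gcd[m,n]∣m (p ℕ.* m) n))
      (gcd[m,n]∣n (p ℕ.* m) n))
    (gcd-greatest (∣-trans (gcd[m,n]∣m m n) (n∣m*n p)) (gcd[m,n]∣n m n))

  gcd-*ʳ : ∀ {p} m n → Prime p → p ∤ m → gcd m (p ℕ.* n) ≡ gcd m n
  gcd-*ʳ {p} m n pp p∤m = trans (gcd-comm m (p ℕ.* n)) (trans (gcd-*ˡ n m pp p∤m) (gcd-comm n m))

  -- The pairs (m,n), (m,pn), (pm,n), (pm,pn) give the local factor 1 - 1/p² - 1/p² + p²/p⁴. The gcd
  -- grows only in the last pair, and this p² reduces 1/p⁴ to 1/p².
  Σ²-gcd² : ∀ {ps} → All Prime ps → Unique ps →
    Σ² ps (λ m n → μℚ m * μℚ n * majorant (m , n)) ≡ E ps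
  Σ²-gcd² [] [] = refl
  Σ²-gcd² {p ∷ ps} (pp ∷ pps) uu@(_ ∷ u) = begin
    Σ² (p ∷ ps) F
      ≡⟨ Σ²-∷ p ps F ⟩
    Σ² ps (λ m n → F m n + F m (p ℕ.* n) + (F (p ℕ.* m) n + F (p ℕ.* m) (p ℕ.* n)))
      ≡⟨ Σ²-cong ps step ⟩
    Σ² ps (λ m n → (1ℚ - w p) * F m n)
      ≡⟨ Σ²-*ˡ ps (1ℚ - w p) F ⟩
    (1ℚ - w p) * Σ² ps F
      ≡⟨ cong ((1ℚ - w p) *_) (Σ²-gcd² pps u) ⟩
    (1ℚ - w p) * E ps ∎
    where
    open ≡-Reasoning
    F : ℕ → ℕ → ℚ
    F m n = μℚ m * μℚ n * majorant (m , n)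
    step : ∀ {m n} → m ∈ subproducts ps → n ∈ subproducts ps →
      F m n + F m (p ℕ.* n) + (F (p ℕ.* m) n + F (p ℕ.* m) (p ℕ.* n)) ≡ (1ℚ - w p) * F m n
    step {m} {n} m∈ n∈ = begin
      F m n + F m (p ℕ.* n) + (F (p ℕ.* m) n + F (p ℕ.* m) (p ℕ.* n))
        ≡⟨ cong₂ (λ s t → F m n + s + t)
             (cong₂ _*_ (cong (μ₁ *_) μn) (cong₂ (λ s t → w m * s * (ι t * ι t)) (w-* p n) (gcd-*ʳ m n pp p∤m)))
             (cong₂ _+_
               (cong₂ _*_ (cong (_* μ₂) μm) (cong₂ (λ s t → s * w n * (ι t * ι t)) (w-* p m) (gcd-*ˡ m n pp p∤n)))
               (cong₂ _*_ (cong₂ _*_ μm μn) (cong₂ _*_ (cong₂ _*_ (w-* p m) (w-* p n)) (cong (λ z → z * z)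
                 (trans (cong ι (sym (c*gcd[m,n]≡gcd[cm,cn] p m n))) (ι-* p (gcd m n))))))) ⟩
      F m n + μ₁ * - μ₂ * (w m * (w p * w n) * (g * g))
        + (- μ₁ * μ₂ * (w p * w m * w n * (g * g)) + - μ₁ * - μ₂ * (w p * w m * (w p * w n) * (ι p * g * (ι p * g))))
        ≡⟨ solve 7 (λ a b p rp u v g →
             a :* b :* (u :* v :* (g :* g)) :+ a :* :- b :* (u :* (rp :* rp :* v) :* (g :* g))
               :+ (:- a :* b :* (rp :* rp :* u :* v :* (g :* g))
                 :+ :- a :* :- b :* (rp :* rp :* u :* (rp :* rp :* v) :* (p :* g :* (p :* g))))
             := (con 1ℚ :- con (ι 2) :* (rp :* rp) :+ (p :* rp) :* (p :* rp) :* (rp :* rp)) :* (a :* b :* (u :* v :* (g :* g))))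
             refl μ₁ μ₂ (ι p) (r p) (w m) (w n) g ⟩
      (1ℚ - ι 2 * w p + ι p * r p * (ι p * r p) * w p) * F m n
        ≡⟨ cong (λ z → (1ℚ - ι 2 * w p + z * z * w p) * F m n) (ι*r≡1 p {{prime⇒nonZero pp}}) ⟩
      (1ℚ - ι 2 * w p + 1ℚ * 1ℚ * w p) * F m n
        ≡⟨ cong (_* F m n) (solve 1 (λ w → con 1ℚ :- con (ι 2) :* w :+ con 1ℚ :* con 1ℚ :* w := con 1ℚ :- w) refl (w p)) ⟩
      (1ℚ - w p) * F m n ∎
      where
      μ₁ = μℚ m
      μ₂ = μℚ n
      g = ι (gcd m n)
      p∉ = Unique[x∷xs]⇒x∉xs uu
      p∤m = ∉⇒∤ pp pps p∉ m∈
      p∤n = ∉⇒∤ pp pps p∉ n∈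
      μm = μℚ-* m {{subproducts-nonZero pps m∈}} pp p∤m
      μn = μℚ-* n {{subproducts-nonZero pps n∈}} pp p∤n

  -- Without the gcd the two indices are independent, and the local factor is the full square 1 -
  -- 2/p² + 1/p⁴.
  Σ²-1 : ∀ {ps} → All Prime ps → Unique ps →
    Σ² ps (λ m n → μℚ m * μℚ n * (w m * w n)) ≡ E ps * E ps
  Σ²-1 [] [] = refl
  Σ²-1 {p ∷ ps} (pp ∷ pps) uu@(_ ∷ u) = begin
    Σ² (p ∷ ps) F
      ≡⟨ Σ²-∷ p ps F ⟩
    Σ² ps (λ m n → F m n + F m (p ℕ.* n) + (F (p ℕ.* m) n + F (p ℕ.* m) (p ℕ.* n)))
      ≡⟨ Σ²-cong ps step ⟩
    Σ² ps (λ m n → (1ℚ - w p) * (1ℚ - w p) * F m n)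
      ≡⟨ Σ²-*ˡ ps ((1ℚ - w p) * (1ℚ - w p)) F ⟩
    (1ℚ - w p) * (1ℚ - w p) * Σ² ps F
      ≡⟨ cong ((1ℚ - w p) * (1ℚ - w p) *_) (Σ²-1 pps u) ⟩
    (1ℚ - w p) * (1ℚ - w p) * (E ps * E ps)
      ≡⟨ solve 2 (λ a e → a :* a :* (e :* e) := a :* e :* (a :* e)) refl (1ℚ - w p) (E ps) ⟩
    (1ℚ - w p) * E ps * ((1ℚ - w p) * E ps) ∎
    where
    open ≡-Reasoning
    F : ℕ → ℕ → ℚ
    F m n = μℚ m * μℚ n * (w m * w n)
    step : ∀ {m n} → m ∈ subproducts ps → n ∈ subproducts ps →
      F m n + F m (p ℕ.* n) + (F (p ℕ.* m) n + F (p ℕ.* m) (p ℕ.* n)) ≡ (1ℚ - w p) * (1ℚ - w p) * F m n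
    step {m} {n} m∈ n∈ = begin
      F m n + F m (p ℕ.* n) + (F (p ℕ.* m) n + F (p ℕ.* m) (p ℕ.* n))
        ≡⟨ cong₂ (λ s t → F m n + s + t)
             (cong₂ _*_ (cong (μ₁ *_) μn) (cong (w m *_) (w-* p n)))
             (cong₂ _+_
               (cong₂ _*_ (cong (_* μ₂) μm) (cong (_* w n) (w-* p m)))
               (cong₂ _*_ (cong₂ _*_ μm μn) (cong₂ _*_ (w-* p m) (w-* p n)))) ⟩
      F m n + μ₁ * - μ₂ * (w m * (w p * w n))
        + (- μ₁ * μ₂ * (w p * w m * w n) + - μ₁ * - μ₂ * (w p * w m * (w p * w n)))
        ≡⟨ solve 5 (λ a b p u v →
             a :* b :* (u :* v) :+ a :* :- b :* (u :* (p :* v))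
               :+ (:- a :* b :* (p :* u :* v) :+ :- a :* :- b :* (p :* u :* (p :* v)))
             := (con 1ℚ :- p) :* (con 1ℚ :- p) :* (a :* b :* (u :* v)))
             refl μ₁ μ₂ (w p) (w m) (w n) ⟩
      (1ℚ - w p) * (1ℚ - w p) * F m n ∎
      where
      μ₁ = μℚ m
      μ₂ = μℚ n
      p∉ = Unique[x∷xs]⇒x∉xs uu
      p∤m = ∉⇒∤ pp pps p∉ m∈
      p∤n = ∉⇒∤ pp pps p∉ n∈
      μm = μℚ-* m {{subproducts-nonZero pps m∈}} pp p∤m
      μn = μℚ-* n {{subproducts-nonZero pps n∈}} pp p∤n

  -- Size of the terms and their exact total over squarefree pairs

  ∣μℚ∣≤1 : ∀ m → ∣ μℚ m ∣ ≤ 1ℚ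
  ∣μℚ∣≤1 zero = ℚ.nonNegative⁻¹ 1ℚ
  ∣μℚ∣≤1 m@(suc _) with unique? (primeFactors m)
  ... | no _  = ℚ.nonNegative⁻¹ 1ℚ
  ... | yes _ = sign (length (primeFactors m))
    where
    ±1 : ∀ k → -1ℤ ℤ.^ k ≡ 1ℤ ⊎ -1ℤ ℤ.^ k ≡ -1ℤ
    ±1 zero = inj₁ refl
    ±1 (suc k) with ±1 k
    ... | inj₁ eq = inj₂ (cong (-1ℤ ℤ.*_) eq)
    ... | inj₂ eq = inj₁ (cong (-1ℤ ℤ.*_) eq)
    sign : ∀ k → ∣ -1ℤ ℤ.^ k / 1 ∣ ≤ 1ℚ
    sign k with ±1 k
    ... | inj₁ eq = ℚ.≤-reflexive (cong (λ z → ∣ z / 1 ∣) eq)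
    ... | inj₂ eq = ℚ.≤-reflexive (cong (λ z → ∣ z / 1 ∣) eq)

  ∣term∣≤ : ∀ m n → ∣ κ m n ∣ ≤ ι (gcd m n) * ι (gcd m n) → ∣ term m n ∣ ≤ majorant (m , n)
  ∣term∣≤ m n ∣κ∣≤ = begin
    ∣ term m n ∣
      ≡⟨ trans (ℚ.∣p*q∣≡∣p∣*∣q∣ (μℚ m * μℚ n) _) (cong₂ _*_ (ℚ.∣p*q∣≡∣p∣*∣q∣ (μℚ m) (μℚ n))
           (trans (ℚ.∣p*q∣≡∣p∣*∣q∣ (w m * w n) (κ m n)) (cong (_* ∣ κ m n ∣) (ℚ.0≤p⇒∣p∣≡p 0≤ww)))) ⟩
    ∣ μℚ m ∣ * ∣ μℚ n ∣ * (w m * w n * ∣ κ m n ∣)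
      ≤⟨ *-mono-≤ (0≤* (ℚ.0≤∣p∣ (μℚ m)) (ℚ.0≤∣p∣ (μℚ n))) (0≤majorant (m , n))
           (*-mono-≤ (ℚ.0≤∣p∣ (μℚ m)) (ℚ.nonNegative⁻¹ 1ℚ) (∣μℚ∣≤1 m) (∣μℚ∣≤1 n))
           (*-monoˡ 0≤ww ∣κ∣≤) ⟩
    1ℚ * 1ℚ * majorant (m , n)
      ≡⟨ ℚ.*-identityˡ (majorant (m , n)) ⟩
    majorant (m , n) ∎
    where
    open ℚ.≤-Reasoning
    0≤ww = 0≤* (0≤w m) (0≤w n)

  private
    0≤c : ∀ c .{{_ : NonNegative c}} → 0ℚ ≤ c
    0≤c c = ℚ.nonNegative⁻¹ c

    -- A certificate for inequalities that are affine in G on G ≥ 1: the coefficients `a` and `b`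
    -- below are read off from q - p = a(G - 1) + b, which the ring solver then checks.
    ≤-by-linear : ∀ {p q G} a b .{{_ : NonNegative a}} .{{_ : NonNegative b}} → 1ℚ ≤ G →
      q ≡ p + (a * (G - 1ℚ) + b) → p ≤ q
    ≤-by-linear {p} {G = G} a b 1≤G eq = subst (p ≤_) (sym eq)
      (p≤p+q (0≤+ (0≤* (0≤c a) (p≤q⇒0≤q-p 1≤G)) (0≤c b)))

    bound₁₁ : ∀ {G} → 1ℚ ≤ G → ∣ (G - 1ℚ) * r 12 ∣ ≤ G
    bound₁₁ {G} h = ∣∣-≤
      (≤-by-linear (ι 11 * r 12) 1ℚ h (solve 1 (λ G → G := (G :- con 1ℚ) :* con (r 12) :+ (con (ι 11 * r 12) :* (G :- con 1ℚ) :+ con 1ℚ)) refl G))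
      (≤-by-linear (ι 13 * r 12) 1ℚ h (solve 1 (λ G → G := :- ((G :- con 1ℚ) :* con (r 12)) :+ (con (ι 13 * r 12) :* (G :- con 1ℚ) :+ con 1ℚ)) refl G))

    bound₂₁ : ∀ {G} → 1ℚ ≤ G → ∣ - ½ * ((G - 1ℚ) * r 12) ∣ ≤ G
    bound₂₁ {G} h = ∣∣-≤
      (≤-by-linear (ι 25 * r 24) 1ℚ h (solve 1 (λ G → G := con (- ½) :* ((G :- con 1ℚ) :* con (r 12)) :+ (con (ι 25 * r 24) :* (G :- con 1ℚ) :+ con 1ℚ)) refl G))
      (≤-by-linear (ι 23 * r 24) 1ℚ h (solve 1 (λ G → G := :- (con (- ½) :* ((G :- con 1ℚ) :* con (r 12))) :+ (con (ι 23 * r 24) :* (G :- con 1ℚ) :+ con 1ℚ)) refl G))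

    bound₂₂ : ∀ {G} → 1ℚ ≤ G → ∣ (ι 4 * G + ι 2) * r 12 ∣ ≤ ι 4 * G
    bound₂₂ {G} h = ∣∣-≤
      (≤-by-linear (ι 11 * r 3) (ι 7 * r 2) h (solve 1 (λ G → con (ι 4) :* G := (con (ι 4) :* G :+ con (ι 2)) :* con (r 12) :+ (con (ι 11 * r 3) :* (G :- con 1ℚ) :+ con (ι 7 * r 2))) refl G))
      (≤-by-linear (ι 13 * r 3) (ι 9 * r 2) h (solve 1 (λ G → con (ι 4) :* G := :- ((con (ι 4) :* G :+ con (ι 2)) :* con (r 12)) :+ (con (ι 13 * r 3) :* (G :- con 1ℚ) :+ con (ι 9 * r 2))) refl G))

  module _ {ps : List ℕ} (prime : All Prime ps) (unique : Unique ps) (2∉ : 2 ∉ ps) where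

    private
      2∤ : ∀ {m} → m ∈ subproducts ps → 2 ∤ m
      2∤ = ∉⇒∤ prime[2] prime 2∉

      μ-2* : ∀ {m} → m ∈ subproducts ps → μℚ (2 ℕ.* m) ≡ - μℚ m
      μ-2* {m} m∈ = μℚ-* m {{2∤⇒nonZero (2∤ m∈)}} prime[2] (2∤ m∈)

      1≤gcd² : ∀ {m n} → m ∈ subproducts ps → 1ℚ ≤ ι (gcd m n) * ι (gcd m n)
      1≤gcd² {m} {n} m∈ = *-mono-≤ (ℚ.nonNegative⁻¹ 1ℚ) (0≤ι (gcd m n)) 1≤g 1≤g
        where
        1≤g : 1ℚ ≤ ι (gcd m n)
        1≤g = 1≤ι (gcd m n) {{ℕ.≢-nonZero (gcd[m,n]≢0 m n (inj₁ (ℕ.≢-nonZero⁻¹ m {{2∤⇒nonZero (2∤ m∈)}})))}}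

      -- With G = gcd², μ(2m) = -μ(m) and 1/2² = 1/4, the four means combine to (G - 1)/12 · (1 +
      -- 1/8 + 1/8) + (4G + 2)/(12 · 16) = G/8 - 3/32.
      sum-doubles : ∀ m n → μℚ (2 ℕ.* m) ≡ - μℚ m → μℚ (2 ℕ.* n) ≡ - μℚ n → OddPair m n →
        term m n + term m (2 ℕ.* n) + (term (2 ℕ.* m) n + term (2 ℕ.* m) (2 ℕ.* n)) ≡
        r 8 * (μℚ m * μℚ n * majorant (m , n)) + - (ι 3 * r 32) * (μℚ m * μℚ n * (w m * w n))
      sum-doubles m n μm μn o = trans
        (cong₂ _+_
          (cong₂ _+_ (cong (λ k → μ₁ * μ₂ * (w m * w n * k)) κ₁₁)
                     (cong₂ (λ s k → μ₁ * proj₁ s * (w m * proj₂ s * k)) (cong₂ _,_ μn (w-* 2 n)) κ₁₂))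
          (cong₂ _+_ (cong₂ (λ s k → proj₁ s * μ₂ * (proj₂ s * w n * k)) (cong₂ _,_ μm (w-* 2 m)) κ₂₁)
                     (cong₂ _*_ (cong₂ _*_ μm μn) (cong₂ _*_ (cong₂ _*_ (w-* 2 m) (w-* 2 n)) κ₂₂))))
        (solve 5 (λ a b u v G →
          a :* b :* (u :* v :* ((G :- con 1ℚ) :* con (r 12)))
            :+ a :* :- b :* (u :* (con (w 2) :* v) :* (con (- ½) :* ((G :- con 1ℚ) :* con (r 12))))
            :+ (:- a :* b :* (con (w 2) :* u :* v :* (con (- ½) :* ((G :- con 1ℚ) :* con (r 12))))
              :+ :- a :* :- b :* (con (w 2) :* u :* (con (w 2) :* v) :* ((con (ι 4) :* G :+ con (ι 2)) :* con (r 12))))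
          := con (r 8) :* (a :* b :* (u :* v :* G)) :+ con (- (ι 3 * r 32)) :* (a :* b :* (u :* v)))
          refl μ₁ μ₂ (w m) (w n) (ι (gcd m n) * ι (gcd m n)))
        where
        open OddPair o
        μ₁ = μℚ m
        μ₂ = μℚ n

    -- The prime 2 contributes the factor 3/4 to `E`, and 1/8 = (1/6)(3/4), 3/32 = (1/6)(3/4)². Thus
    -- the irregular behaviour at 2 is just what makes both coefficients equal to 1/6.
    Σ²-term : Σ² (2 ∷ ps) term ≡ r 6 * (E (2 ∷ ps) - E (2 ∷ ps) * E (2 ∷ ps))
    Σ²-term = begin
      Σ² (2 ∷ ps) term
        ≡⟨ Σ²-∷ 2 ps term ⟩
      Σ² ps (λ m n → term m n + term m (2 ℕ.* n) + (term (2 ℕ.* m) n + term (2 ℕ.* m) (2 ℕ.* n)))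
        ≡⟨ Σ²-cong ps (λ {m} {n} m∈ n∈ → sum-doubles m n (μ-2* m∈) (μ-2* n∈) (oddPair (2∤ m∈) (2∤ n∈))) ⟩
      Σ² ps (λ m n → r 8 * F m n + - (ι 3 * r 32) * G m n)
        ≡⟨ Σ²-+ ps (λ m n → r 8 * F m n) (λ m n → - (ι 3 * r 32) * G m n) ⟩
      Σ² ps (λ m n → r 8 * F m n) + Σ² ps (λ m n → - (ι 3 * r 32) * G m n)
        ≡⟨ cong₂ _+_ (trans (Σ²-*ˡ ps (r 8) F) (cong (r 8 *_) (Σ²-gcd² prime unique)))
                     (trans (Σ²-*ˡ ps (- (ι 3 * r 32)) G) (cong (- (ι 3 * r 32) *_) (Σ²-1 prime unique))) ⟩
      r 8 * E ps + - (ι 3 * r 32) * (E ps * E ps)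
        ≡⟨ solve 1 (λ e → con (r 8) :* e :+ con (- (ι 3 * r 32)) :* (e :* e)
             := con (r 6) :* (con (1ℚ - w 2) :* e :- con (1ℚ - w 2) :* e :* (con (1ℚ - w 2) :* e))) refl (E ps) ⟩
      r 6 * (E (2 ∷ ps) - E (2 ∷ ps) * E (2 ∷ ps)) ∎
      where
      open ≡-Reasoning
      F G : ℕ → ℕ → ℚ
      F m n = μℚ m * μℚ n * majorant (m , n)
      G m n = μℚ m * μℚ n * (w m * w n)

    -- Needed for the tail. On these squarefree indices the explicit values of `κ` apply; when both
    -- are even the gcd doubles too, which leaves room for the coefficient 4.
    ∣κ∣≤gcd² : ∀ {m n} → m ∈ subproducts (2 ∷ ps) → n ∈ subproducts (2 ∷ ps) →
      ∣ κ m n ∣ ≤ ι (gcd m n) * ι (gcd m n)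
    ∣κ∣≤gcd² {m} {n} m∈ n∈ with ∈-++⁻ (subproducts ps) m∈ | ∈-++⁻ (subproducts ps) n∈
    ... | inj₁ m∈₁ | inj₁ n∈₁ = subst (λ k → ∣ k ∣ ≤ ι (gcd m n) * ι (gcd m n))
      (sym (OddPair.κ₁₁ (oddPair (2∤ m∈₁) (2∤ n∈₁)))) (bound₁₁ (1≤gcd² {m} {n} m∈₁))
    ... | inj₁ m∈₁ | inj₂ n∈₂ with ∈-map⁻ (2 ℕ.*_) n∈₂
    ...   | j , j∈ , refl = subst₂ (λ k g → ∣ k ∣ ≤ ι g * ι g)
      (sym (OddPair.κ₁₂ (oddPair (2∤ m∈₁) (2∤ j∈)))) (sym (gcd-*ʳ m j prime[2] (2∤ m∈₁))) (bound₂₁ (1≤gcd² {m} {j} m∈₁))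
    ∣κ∣≤gcd² {m} {n} m∈ n∈ | inj₂ m∈₂ | inj₁ n∈₁ with ∈-map⁻ (2 ℕ.*_) m∈₂
    ...   | i , i∈ , refl = subst₂ (λ k g → ∣ k ∣ ≤ ι g * ι g)
      (sym (OddPair.κ₂₁ (oddPair (2∤ i∈) (2∤ n∈₁)))) (sym (gcd-*ˡ i n prime[2] (2∤ n∈₁))) (bound₂₁ (1≤gcd² {i} {n} i∈))
    ∣κ∣≤gcd² {m} {n} m∈ n∈ | inj₂ m∈₂ | inj₂ n∈₂ with ∈-map⁻ (2 ℕ.*_) m∈₂ | ∈-map⁻ (2 ℕ.*_) n∈₂
    ...   | i , i∈ , refl | j , j∈ , refl = subst₂ (λ k g → ∣ k ∣ ≤ g)
      (sym (OddPair.κ₂₂ (oddPair (2∤ i∈) (2∤ j∈)))) gcd≡ (bound₂₂ (1≤gcd² {i} {j} i∈))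
      where
      g = ι (gcd i j)
      gcd≡ : ι 4 * (g * g) ≡ ι (gcd (2 ℕ.* i) (2 ℕ.* j)) * ι (gcd (2 ℕ.* i) (2 ℕ.* j))
      gcd≡ = trans (solve 1 (λ g → con (ι 4) :* (g :* g) := con (ι 2) :* g :* (con (ι 2) :* g)) refl g)
        (cong (λ z → z * z) (trans (sym (ι-* 2 (gcd i j))) (cong ι (c*gcd[m,n]≡gcd[cm,cn] 2 i j))))

    ∣term∣≤majorant : ∀ {m n} → m ∈ subproducts (2 ∷ ps) → n ∈ subproducts (2 ∷ ps) →
      ∣ term m n ∣ ≤ majorant (m , n)
    ∣term∣≤majorant {m} {n} m∈ n∈ = ∣term∣≤ m n (∣κ∣≤gcd² m∈ n∈)

  -- The sieve of Eratosthenes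

  on∣ : ℕ → ℕ → ℚ → ℚ → ℚ
  on∣ p k x y = if does (p ∣? k) then x else y

  on∣-yes : ∀ {p k} x y → p ∣ k → on∣ p k x y ≡ x
  on∣-yes {p} {k} x y h = cong (λ b → if b then x else y) (dec-true (p ∣? k) h)

  on∣-no : ∀ {p k} x y → p ∤ k → on∣ p k x y ≡ y
  on∣-no {p} {k} x y h = cong (λ b → if b then x else y) (dec-false (p ∣? k) h)

  sieved : List ℕ → ℕ → ℚ
  sieved []       k = 1ℚ
  sieved (p ∷ ps) k = on∣ p k 0ℚ (sieved ps k)

  0≤sieved : ∀ ps k → 0ℚ ≤ sieved ps k
  0≤sieved []       k = ℚ.nonNegative⁻¹ 1ℚ
  0≤sieved (p ∷ ps) k with p ∣? k
  ... | yes _ = ℚ.≤-refl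
  ... | no  _ = 0≤sieved ps k

  sieved≤1 : ∀ ps k → sieved ps k ≤ 1ℚ
  sieved≤1 []       k = ℚ.≤-refl
  sieved≤1 (p ∷ ps) k with p ∣? k
  ... | yes _ = ℚ.nonNegative⁻¹ 1ℚ
  ... | no  _ = sieved≤1 ps k

  sieved-1 : ∀ {ps} → All Prime ps → sieved ps 1 ≡ 1ℚ
  sieved-1 [] = refl
  sieved-1 {p ∷ ps} (pp ∷ pps) = trans
    (on∣-no {p} {1} 0ℚ (sieved ps 1) λ p∣1 → ¬prime[1] (subst Prime (∣1⇒≡1 p∣1) pp)) (sieved-1 pps)

  sieved-0 : ∀ {p ps k} → p ∈ ps → p ∣ k → sieved ps k ≡ 0ℚ
  sieved-0 {p} {ps = _ ∷ ps} {k} (here refl) p∣k = on∣-yes {p} {k} 0ℚ (sieved ps k) p∣k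
  sieved-0 {ps = q ∷ ps} {k} (there p∈) p∣k with q ∣? k
  ... | yes _ = refl
  ... | no  _ = sieved-0 p∈ p∣k

  sieved-* : ∀ {p ps} k → Prime p → All Prime ps → p ∉ ps → sieved ps (k ℕ.* p) ≡ sieved ps k
  sieved-* k pp [] p∉ = refl
  sieved-* {p} {q ∷ ps} k pp (qp ∷ pps) p∉ with q ∣? k
  ... | yes q∣k = on∣-yes {q} {k ℕ.* p} 0ℚ (sieved ps (k ℕ.* p)) (∣-trans q∣k (m∣m*n p))
  ... | no  q∤k = trans (on∣-no {q} {k ℕ.* p} 0ℚ (sieved ps (k ℕ.* p)) q∤kp)
    (sieved-* k pp pps (λ p∈ → p∉ (there p∈)))
    where
    q∤kp : q ∤ k ℕ.* p
    q∤kp q∣kp with euclidsLemma k p qp q∣kp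
    ... | inj₁ q∣k = q∤k q∣k
    ... | inj₂ q∣p with prime⇒irreducible pp q∣p
    ...   | inj₁ refl = ¬prime[1] qp
    ...   | inj₂ refl = p∉ (here refl)

  -- The sum of 1/k² over k ≤ K coprime to ps.  Each prime p removes a factor 1 - 1/p² up to an error
  -- of order 1/K; cutting off at multiples K of the product of ps keeps the recursion Z-∷ exact.
  Z : List ℕ → ℕ → ℚ
  Z ps K = Sum K (λ i → sieved ps (suc i) * w (suc i))

  Z-mono : ∀ ps {K L} → K ℕ.≤ L → Z ps K ≤ Z ps L
  Z-mono ps = Sum-≤ (λ i → 0≤* (0≤sieved ps (suc i)) (0≤w (suc i)))

  -- Each block Kp + 1, ..., Kp + p contains a single multiple of p, its last element.
  Sum-multiples : ∀ p .{{_ : NonZero p}} (h : ℕ → ℚ) → (∀ {k} → p ∤ k → h k ≡ 0ℚ) → ∀ K →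
    Sum (K ℕ.* p) (λ i → h (suc i)) ≡ Sum K (λ i → h (suc i ℕ.* p))
  Sum-multiples p h h0 zero = refl
  Sum-multiples p@(suc p′) h h0 (suc K) = begin
    Sum (p ℕ.+ K ℕ.* p) (λ i → h (suc i))
      ≡⟨ cong (λ z → Sum z (λ i → h (suc i))) (ℕ.+-comm p (K ℕ.* p)) ⟩
    Sum (K ℕ.* p ℕ.+ p) (λ i → h (suc i))
      ≡⟨ Sum-split (K ℕ.* p) p (λ i → h (suc i)) ⟩
    Sum (K ℕ.* p) (λ i → h (suc i)) + (Sum p′ (λ i → h (suc (K ℕ.* p ℕ.+ i))) + h (suc (K ℕ.* p ℕ.+ p′)))
      ≡⟨ cong₂ _+_ (Sum-multiples p h h0 K) (cong₂ _+_
           (trans (Sum-cong< p′ λ i i<p′ → h0 (off i i<p′)) (Sum-0 p′))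
           (cong h (trans (cong suc (ℕ.+-comm (K ℕ.* p) p′)) refl))) ⟩
    Sum K (λ i → h (suc i ℕ.* p)) + (0ℚ + h (suc K ℕ.* p))
      ≡⟨ cong (λ z → Sum K (λ i → h (suc i ℕ.* p)) + z) (ℚ.+-identityˡ _) ⟩
    Sum (suc K) (λ i → h (suc i ℕ.* p)) ∎
    where
    open ≡-Reasoning
    off : ∀ i → i ℕ.< p′ → p ∤ suc (K ℕ.* p ℕ.+ i)
    off i i<p′ p∣ = ℕ.<⇒≱ (s≤s i<p′)
      (∣⇒≤ (∣m+n∣m⇒∣n (subst (p ∣_) (sym (ℕ.+-suc (K ℕ.* p) i)) p∣) (n∣m*n K)))

  -- The multiples of p up to K p that survive `ps` are p k with k ≤ K surviving `ps`. The drop of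
  -- the cutoff from K p to K is the only reason why the factor 1 - 1/p² is not exact.
  Z-∷ : ∀ {p ps} K → Prime p → All Prime ps → p ∉ ps →
    Z (p ∷ ps) (K ℕ.* p) ≡ Z ps (K ℕ.* p) - w p * Z ps K
  Z-∷ {p} {ps} K pp pps p∉ = begin
    Z (p ∷ ps) (K ℕ.* p)
      ≡⟨ Sum-cong (K ℕ.* p) (λ i → remove (suc i)) ⟩
    Sum (K ℕ.* p) (λ i → f (suc i) + - h (suc i))
      ≡⟨ Sum-+ (K ℕ.* p) (λ i → f (suc i)) (λ i → - h (suc i)) ⟩
    Z ps (K ℕ.* p) + Sum (K ℕ.* p) (λ i → - h (suc i))
      ≡⟨ cong (λ z → Z ps (K ℕ.* p) + z) (trans (Sum-cong (K ℕ.* p) (λ i → sym (-1* (h (suc i)))))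
           (trans (Sum-*ˡ (K ℕ.* p) (- 1ℚ) (λ i → h (suc i))) (-1* _))) ⟩
    Z ps (K ℕ.* p) - Sum (K ℕ.* p) (λ i → h (suc i))
      ≡⟨ cong (λ z → Z ps (K ℕ.* p) - z) (trans (Sum-multiples p {{prime⇒nonZero pp}} h (λ {k} p∤k → on∣-no {p} {k} (f k) 0ℚ p∤k) K)
           (trans (Sum-cong K (λ i → multiple (suc i))) (Sum-*ˡ K (w p) _))) ⟩
    Z ps (K ℕ.* p) - w p * Z ps K ∎
    where
    open ≡-Reasoning
    -1* : ∀ x → - 1ℚ * x ≡ - x
    -1* = solve 1 (λ x → con (- 1ℚ) :* x := :- x) refl
    f h : ℕ → ℚ
    f k = sieved ps k * w k
    h k = on∣ p k (f k) 0ℚ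
    remove : ∀ k → sieved (p ∷ ps) k * w k ≡ f k + - h k
    remove k with p ∣? k
    ... | yes _ = solve 2 (λ w s → con 0ℚ :* w := s :* w :+ :- (s :* w)) refl (w k) (sieved ps k)
    ... | no  _ = sym (ℚ.+-identityʳ (f k))
    multiple : ∀ k → h (k ℕ.* p) ≡ w p * f k
    multiple k = trans (on∣-yes {p} {k ℕ.* p} (f (k ℕ.* p)) 0ℚ (n∣m*n k))
      (trans (cong₂ _*_ (sieved-* k pp pps p∉) (w-* k p))
        (solve 3 (λ s a b → s :* (a :* b) := b :* (s :* a)) refl (sieved ps k) (w k) (w p)))

  w≤1 : ∀ n → w n ≤ 1ℚ
  w≤1 n = *-mono-≤ (0≤r n) (ℚ.nonNegative⁻¹ 1ℚ) (r≤1 n) (r≤1 n)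

  0≤1-w : ∀ p → 0ℚ ≤ 1ℚ - w p
  0≤1-w p = p≤q⇒0≤q-p (w≤1 p)

  0≤E : ∀ ps → 0ℚ ≤ E ps
  0≤E []       = ℚ.nonNegative⁻¹ 1ℚ
  0≤E (p ∷ ps) = 0≤* (0≤1-w p) (0≤E ps)

  E≤1 : ∀ ps → E ps ≤ 1ℚ
  E≤1 []       = ℚ.≤-refl
  E≤1 (p ∷ ps) = *-mono-≤ (0≤1-w p) (ℚ.nonNegative⁻¹ 1ℚ)
    (0≤q-p⇒p≤q (subst (0ℚ ≤_) (solve 1 (λ w → w := con 1ℚ :- (con 1ℚ :- w)) refl (w p)) (0≤w p))) (E≤1 ps)

  ζ₂-mono : ∀ {K L} → K ℕ.≤ L → ζ₂ K ≤ ζ₂ L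
  ζ₂-mono = Sum-≤ (λ i → 0≤w (suc i))

  ∑1/n²≡ζ₂ : ∀ K → ∑1/n^ 2 K ≡ ζ₂ K
  ∑1/n²≡ζ₂ K = ∑≡Sum K (λ i → trans (cong (λ z → r (suc i ℕ.* z)) (ℕ.*-identityʳ (suc i))) (r-* (suc i) (suc i)))

  ζ₂-gap : ∀ {K L} .{{_ : NonZero K}} → K ℕ.≤ L → ζ₂ L - ζ₂ K ≤ r K
  ζ₂-gap {suc K} {L} K≤L = subst (_≤ r (suc K))
    (trans (ℚ.0≤p⇒∣p∣≡p (subst₂ (λ s t → 0ℚ ≤ s - t) (sym (∑1/n²≡ζ₂ L)) (sym (∑1/n²≡ζ₂ (suc K))) (p≤q⇒0≤q-p (ζ₂-mono K≤L))))
      (cong₂ _-_ (∑1/n²≡ζ₂ L) (∑1/n²≡ζ₂ (suc K))))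
    (∑1/n^-gap 2 ℕ.≤-refl K {suc K} {L} ℕ.≤-refl K≤L)

  product-nonZero : ∀ {ps} → All Prime ps → NonZero (product ps)
  product-nonZero [] = _
  product-nonZero {p ∷ ps} (pp ∷ pps) = ℕ.m*n≢0 p (product ps) {{prime⇒nonZero pp}} {{product-nonZero pps}}

  module _ {p : ℕ} {ps : List ℕ} (pp : Prime p) (pps : All Prime ps) (p∉ : p ∉ ps) (K : ℕ) where

    private
      P = product ps
      -- `A` is the cutoff for p ∷ ps, bracketed so that the hypothesis for `ps` applies at K p; `B`
      -- = A/p is the cutoff for `ps` at K.
      A = K ℕ.* p ℕ.* P
      B = K ℕ.* P
      instance
        p≢0 : NonZero p
        p≢0 = prime⇒nonZero pp
        P≢0 : NonZero P
        P≢0 = product-nonZero pps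

      A≡ : A ≡ B ℕ.* p
      A≡ = trans (ℕ.*-assoc K p P) (trans (cong (K ℕ.*_) (ℕ.*-comm p P)) (sym (ℕ.*-assoc K P p)))

      Z-step : Z (p ∷ ps) (K ℕ.* product (p ∷ ps)) ≡ Z ps A - w p * Z ps B
      Z-step = trans (cong (Z (p ∷ ps)) (trans (sym (ℕ.*-assoc K p P)) A≡))
        (trans (Z-∷ B pp pps p∉) (cong (λ z → Z ps z - w p * Z ps B) (sym A≡)))

      B≤A : B ℕ.≤ A
      B≤A = subst (B ℕ.≤_) (sym A≡) (ℕ.m≤m*n B p)

      ζ≡ : ζ₂ (K ℕ.* product (p ∷ ps)) ≡ ζ₂ A
      ζ≡ = cong ζ₂ (sym (ℕ.*-assoc K p P))

    -- The lower cutoff helps here: subtracting w p * Z ps B removes no more than subtracting w p *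
    -- Z ps A.
    Z-lower-step : E ps * ζ₂ A ≤ Z ps A → E (p ∷ ps) * ζ₂ (K ℕ.* product (p ∷ ps)) ≤ Z (p ∷ ps) (K ℕ.* product (p ∷ ps))
    Z-lower-step ih = begin
      (1ℚ - w p) * E ps * ζ₂ (K ℕ.* product (p ∷ ps))  ≡⟨ trans (cong ((1ℚ - w p) * E ps *_) ζ≡) (ℚ.*-assoc (1ℚ - w p) (E ps) (ζ₂ A)) ⟩
      (1ℚ - w p) * (E ps * ζ₂ A)                       ≤⟨ *-monoˡ (0≤1-w p) ih ⟩
      (1ℚ - w p) * Z ps A                              ≡⟨ solve 2 (λ w z → (con 1ℚ :- w) :* z := z :- w :* z) refl (w p) (Z ps A) ⟩
      Z ps A - w p * Z ps A                            ≤⟨ ℚ.+-monoʳ-≤ (Z ps A) (ℚ.neg-antimono-≤ (*-monoˡ (0≤w p) (Z-mono ps B≤A))) ⟩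
      Z ps A - w p * Z ps B                            ≡⟨ Z-step ⟨
      Z (p ∷ ps) (K ℕ.* product (p ∷ ps))              ∎
      where open ℚ.≤-Reasoning

    -- The mismatch of cutoffs costs at most ζ₂ A - ζ₂ B ≤ 1/B ≤ 1/K, so each prime adds one to the
    -- multiple of 1/K in the error.
    Z-upper-step : .{{_ : NonZero K}} → ∀ ℓ → 0ℚ ≤ ℓ → E ps * ζ₂ B ≤ Z ps B → Z ps A ≤ E ps * ζ₂ A + ℓ * r (K ℕ.* p) →
      Z (p ∷ ps) (K ℕ.* product (p ∷ ps)) ≤ E (p ∷ ps) * ζ₂ (K ℕ.* product (p ∷ ps)) + (1ℚ + ℓ) * r K
    Z-upper-step ℓ 0≤ℓ lower upper = begin
      Z (p ∷ ps) (K ℕ.* product (p ∷ ps))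
        ≡⟨ Z-step ⟩
      Z ps A - w p * Z ps B
        ≤⟨ ℚ.+-mono-≤ upper (ℚ.neg-antimono-≤ (*-monoˡ (0≤w p) lower)) ⟩
      E ps * ζ₂ A + ℓ * r (K ℕ.* p) - w p * (E ps * ζ₂ B)
        ≡⟨ solve 5 (λ e a b w l → e :* a :+ l :- w :* (e :* b) := (con 1ℚ :- w) :* e :* a :+ (w :* e :* (a :- b) :+ l)) refl
             (E ps) (ζ₂ A) (ζ₂ B) (w p) (ℓ * r (K ℕ.* p)) ⟩
      (1ℚ - w p) * E ps * ζ₂ A + (w p * E ps * (ζ₂ A - ζ₂ B) + ℓ * r (K ℕ.* p))
        ≤⟨ ℚ.+-monoʳ-≤ ((1ℚ - w p) * E ps * ζ₂ A) (ℚ.+-mono-≤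
             (*-mono-≤ (0≤* (0≤w p) (0≤E ps)) (0≤r K)
               (*-mono-≤ (0≤w p) (ℚ.nonNegative⁻¹ 1ℚ) (w≤1 p) (E≤1 ps))
               (ℚ.≤-trans (ζ₂-gap {B} {A} B≤A) (r-antitone (ℕ.m≤m*n K P))))
             (*-monoˡ 0≤ℓ (r-antitone (ℕ.m≤m*n K p)))) ⟩
      (1ℚ - w p) * E ps * ζ₂ A + (1ℚ * 1ℚ * r K + ℓ * r K)
        ≡⟨ cong₂ _+_ (cong ((1ℚ - w p) * E ps *_) (sym ζ≡))
             (solve 2 (λ l r → con 1ℚ :* con 1ℚ :* r :+ l :* r := (con 1ℚ :+ l) :* r) refl ℓ (r K)) ⟩
      E (p ∷ ps) * ζ₂ (K ℕ.* product (p ∷ ps)) + (1ℚ + ℓ) * r K ∎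
      where
      open ℚ.≤-Reasoning
      instance
        B≢0 : NonZero B
        B≢0 = ℕ.m*n≢0 K P

  Z-lower : ∀ {ps} → All Prime ps → Unique ps → ∀ K → E ps * ζ₂ (K ℕ.* product ps) ≤ Z ps (K ℕ.* product ps)
  Z-lower [] [] K = ℚ.≤-reflexive (trans (ℚ.*-identityˡ _)
    (Sum-cong (K ℕ.* 1) (λ i → sym (ℚ.*-identityˡ (w (suc i))))))
  Z-lower {p ∷ ps} (pp ∷ pps) uu@(_ ∷ u) K =
    Z-lower-step pp pps (Unique[x∷xs]⇒x∉xs uu) K (Z-lower pps u (K ℕ.* p))

  Z-upper : ∀ {ps} → All Prime ps → Unique ps → ∀ K .{{_ : NonZero K}} →
    Z ps (K ℕ.* product ps) ≤ E ps * ζ₂ (K ℕ.* product ps) + ι (length ps) * r K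
  Z-upper [] [] K = ℚ.≤-reflexive (trans
    (Sum-cong (K ℕ.* 1) (λ i → ℚ.*-identityˡ (w (suc i))))
    (solve 2 (λ z r → z := con 1ℚ :* z :+ con 0ℚ :* r) refl (ζ₂ (K ℕ.* 1)) (r K)))
  Z-upper {p ∷ ps} (pp ∷ pps) uu@(_ ∷ u) K =
    Z-upper-step pp pps (Unique[x∷xs]⇒x∉xs uu) K (ι (length ps)) (0≤ι (length ps))
      (Z-lower pps u K) (Z-upper pps u (K ℕ.* p) {{ℕ.m*n≢0 K p {{it}} {{prime⇒nonZero pp}}}})
    where
    it : NonZero K
    it = ℕ.≢-nonZero (ℕ.≢-nonZero⁻¹ K)

  1≤Z : ∀ {ps} → All Prime ps → ∀ {K} .{{_ : NonZero K}} → 1ℚ ≤ Z ps K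
  1≤Z {ps} pps {suc K} = subst (_≤ Z ps (suc K)) (cong (λ z → 0ℚ + z * 1ℚ) (sieved-1 pps)) (Z-mono ps (s≤s (z≤n {K})))

  -- Every k from 2 to `N` is sieved out, which leaves the term 1 and a tail of ζ(2) beyond `N`.
  Z≤1+r : ∀ {ps} → All Prime ps → ∀ N .{{_ : NonZero N}} →
    (∀ k → 2 ℕ.≤ k → k ℕ.≤ N → ∃[ p ] (p ∈ ps × p ∣ k)) → ∀ {K} → N ℕ.≤ K → Z ps K ≤ 1ℚ + r N
  Z≤1+r {ps} pps N@(suc N′) cover {K} N≤K = begin
    Z ps K
      ≡⟨ trans (cong (Z ps) (sym (ℕ.m+[n∸m]≡n N≤K))) (Sum-split N L _) ⟩
    Z ps N + Sum L (λ i → sieved ps (suc (N ℕ.+ i)) * w (suc (N ℕ.+ i)))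
      ≤⟨ ℚ.+-mono-≤ (ℚ.≤-reflexive Z-N) (Sum-mono L (λ i _ → subst (sieved ps (suc (N ℕ.+ i)) * w (suc (N ℕ.+ i)) ≤_) (ℚ.*-identityˡ (w (suc (N ℕ.+ i))))
           (*-monoʳ (0≤w (suc (N ℕ.+ i))) (sieved≤1 ps (suc (N ℕ.+ i)))))) ⟩
    1ℚ + Sum L (λ i → w (suc (N ℕ.+ i)))
      ≡⟨ cong (λ z → 1ℚ + z) (trans (solve 2 (λ a b → a := b :+ a :- b) refl _ (ζ₂ N))
           (cong (λ z → z - ζ₂ N) (trans (sym (Sum-split N L (λ i → w (suc i)))) (cong ζ₂ (ℕ.m+[n∸m]≡n N≤K))))) ⟩
    1ℚ + (ζ₂ K - ζ₂ N)
      ≤⟨ ℚ.+-monoʳ-≤ 1ℚ (ζ₂-gap N≤K) ⟩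
    1ℚ + r N ∎
    where
    open ℚ.≤-Reasoning
    L = K ℕ.∸ N
    Z-N : Z ps N ≡ 1ℚ
    Z-N = trans (Sum-split 1 N′ (λ i → sieved ps (suc i) * w (suc i)))
      (cong₂ _+_ (cong (λ z → 0ℚ + z * 1ℚ) (sieved-1 pps))
        (trans (Sum-cong< N′ (λ i i<N′ → let p , p∈ , p∣ = cover (suc (suc i)) (s≤s (s≤s z≤n)) (s≤s i<N′) in
            trans (cong (_* w (suc (suc i))) (sieved-0 p∈ p∣)) (ℚ.*-zeroˡ (w (suc (suc i))))))
          (Sum-0 N′)))

  -- Squeezing through `Z`: E ζ₂ ≤ Z ≤ 1 + 1/N bounds E ζ₂ from above for every K, and 1 ≤ Z ≤ E ζ₂
  -- + (number of primes)/j from below. The primes are fixed at this point, so j can outgrow their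
  -- number.
  euler : ∀ {ps} → All Prime ps → Unique ps → ∀ N .{{_ : NonZero N}} →
    (∀ k → 2 ℕ.≤ k → k ℕ.≤ N → ∃[ p ] (p ∈ ps × p ∣ k)) →
    ∀ ε .{{_ : Positive ε}} → r N ≤ ε → ∃[ K₀ ] (∀ K → K₀ ℕ.≤ K → ∣ E ps * ζ₂ K - 1ℚ ∣ ≤ ε)
  euler {ps} pps u N cover ε rN≤ε =
    let b = 1ℚ + ι (length ps)
        b>0 = ℚ.pos+nonNeg⇒pos 1ℚ (ι (length ps)) {{nonNegative (0≤ι (length ps))}}
        (δ , δ>0 , b*δ≡ε) = scaled b {{b>0}} ε
        (j , r≤δ) = archimedean δ {{δ>0}}
    in suc j ℕ.* P , λ K K₀≤K → ∣∣-≤ (upper K) (lower j δ {{δ>0}} r≤δ b*δ≡ε K K₀≤K)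
    where
    open ℚ.≤-Reasoning
    P = product ps
    instance
      P≢0 : NonZero P
      P≢0 = product-nonZero pps
    upper : ∀ K → E ps * ζ₂ K - 1ℚ ≤ ε
    upper K = begin
      E ps * ζ₂ K - 1ℚ              ≤⟨ ℚ.+-monoˡ-≤ (- 1ℚ) (*-monoˡ (0≤E ps) (ζ₂-mono (ℕ.≤-trans (ℕ.m≤m⊔n K N) (ℕ.m≤m*n (K ℕ.⊔ N) P)))) ⟩
      E ps * ζ₂ L - 1ℚ              ≤⟨ ℚ.+-monoˡ-≤ (- 1ℚ) (Z-lower pps u (K ℕ.⊔ N)) ⟩
      Z ps L - 1ℚ                   ≤⟨ ℚ.+-monoˡ-≤ (- 1ℚ) (Z≤1+r pps N cover (ℕ.≤-trans (ℕ.m≤n⊔m K N) (ℕ.m≤m*n (K ℕ.⊔ N) P))) ⟩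
      1ℚ + r N - 1ℚ                 ≡⟨ solve 1 (λ r → con 1ℚ :+ r :- con 1ℚ := r) refl (r N) ⟩
      r N                           ≤⟨ rN≤ε ⟩
      ε                             ∎
      -- Enlarging the cutoff only increases E ζ₂; it must be a multiple of P for the sieve and at
      -- least `N` for `Z≤1+r`.
      where L = (K ℕ.⊔ N) ℕ.* P
    lower : ∀ j δ .{{_ : Positive δ}} → r (suc j) ≤ δ → (1ℚ + ι (length ps)) * δ ≡ ε →
      ∀ K → suc j ℕ.* P ℕ.≤ K → - (E ps * ζ₂ K - 1ℚ) ≤ ε
    lower j δ r≤δ b*δ≡ε K K₀≤K = begin
      - (E ps * ζ₂ K - 1ℚ)                          ≡⟨ solve 1 (λ x → :- (x :- con 1ℚ) := con 1ℚ :- x) refl (E ps * ζ₂ K) ⟩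
      1ℚ - E ps * ζ₂ K                              ≤⟨ ℚ.+-mono-≤ (ℚ.≤-trans (1≤Z pps {L}) (Z-upper pps u (suc j)))
                                                         (ℚ.neg-antimono-≤ (*-monoˡ (0≤E ps) (ζ₂-mono K₀≤K))) ⟩
      E ps * ζ₂ L + ι (length ps) * r (suc j) - E ps * ζ₂ L
                                                    ≡⟨ solve 2 (λ a b → a :+ b :- a := b) refl (E ps * ζ₂ L) (ι (length ps) * r (suc j)) ⟩
      ι (length ps) * r (suc j)                     ≤⟨ *-mono-≤ (0≤ι (length ps)) (ℚ.<⇒≤ (ℚ.positive⁻¹ δ))
                                                         (subst (ι (length ps) ≤_) (ℚ.+-comm (ι (length ps)) 1ℚ) (p≤p+q (ℚ.nonNegative⁻¹ 1ℚ))) r≤δ ⟩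
      (1ℚ + ι (length ps)) * δ                      ≡⟨ b*δ≡ε ⟩
      ε                                             ∎
      where
      L = suc j ℕ.* P
      instance
        L≢0 : NonZero L
        L≢0 = ℕ.m*n≢0 (suc j) P

  -- Odd primes up to a bound

  oddPrime? : ∀ n → Dec (Prime n × n ≢ 2)
  oddPrime? n = prime? n ×-dec ¬? (n ℕ.≟ 2)

  oddPrimes : ℕ → List ℕ
  oddPrimes N = filter oddPrime? (upTo (suc N))

  oddPrimes-prime : ∀ N → All Prime (oddPrimes N)
  oddPrimes-prime N = All.tabulate (λ p∈ → proj₁ (proj₂ (∈-filter⁻ oddPrime? {xs = upTo (suc N)} p∈)))

  oddPrimes-unique : ∀ N → Unique (oddPrimes N)
  oddPrimes-unique N = filter⁺ oddPrime? (upTo⁺ (suc N))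

  2∉oddPrimes : ∀ N → 2 ∉ oddPrimes N
  2∉oddPrimes N 2∈ = proj₂ (proj₂ (∈-filter⁻ oddPrime? {xs = upTo (suc N)} 2∈)) refl

  primes∈ : ∀ {N p} → Prime p → p ℕ.≤ N → p ∈ 2 ∷ oddPrimes N
  primes∈ {N} {p} pp p≤N with p ℕ.≟ 2
  ... | yes refl = here refl
  ... | no  p≢2  = there (∈-filter⁺ oddPrime? (∈-upTo⁺ (s≤s p≤N)) (pp , p≢2))

  primeDivisor : ∀ {N qs} → (∀ {p} → Prime p → p ℕ.≤ N → p ∈ qs) →
    ∀ k → 2 ℕ.≤ k → k ℕ.≤ N → ∃[ p ] (p ∈ qs × p ∣ k)
  primeDivisor {N} {qs} primes∈ k 2≤k k≤N = go (primeFactors k) (product-primeFactors k) (primeFactors-prime k) (primeFactors-∣ k)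
    where
    instance
      k≢0 : NonZero k
      k≢0 = ℕ.>-nonZero (ℕ.≤-trans (s≤s z≤n) 2≤k)
    go : ∀ ps → product ps ≡ k → All Prime ps → (∀ {p} → p ∈ ps → p ∣ k) → ∃[ p ] (p ∈ qs × p ∣ k)
    go []      eq _        _  = contradiction 2≤k (ℕ.<⇒≱ (s≤s (ℕ.≤-reflexive (sym eq))))
    go (p ∷ _) _  (pp ∷ _) p∣ = p , primes∈ pp (ℕ.≤-trans (∣⇒≤ (p∣ (here refl))) k≤N) , p∣ (here refl)

  -- Comparison with the values of ζ(2)

  inv₀-unique : ∀ {q x} → 1ℚ ≤ q → x * q ≡ 1ℚ → inv₀ q ≡ x
  inv₀-unique {q} {x} 1≤q xq≡1 = begin
    inv₀ q             ≡⟨ ℚ.*-identityʳ (inv₀ q) ⟨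
    inv₀ q * 1ℚ        ≡⟨ cong (inv₀ q *_) xq≡1 ⟨
    inv₀ q * (x * q)   ≡⟨ solve 3 (λ i x q → i :* (x :* q) := i :* q :* x) refl (inv₀ q) x q ⟩
    inv₀ q * q * x     ≡⟨ cong (_* x) (inv₀-inverseˡ {1ℚ} q (ℚ.≤-trans 1≤q (ℚ.≤-reflexive (sym (ℚ.0≤p⇒∣p∣≡p (ℚ.≤-trans (ℚ.nonNegative⁻¹ 1ℚ) 1≤q)))))) ⟩
    1ℚ * x             ≡⟨ ℚ.*-identityˡ x ⟩
    x                  ∎
    where open ≡-Reasoning

  module _ {e S : ℚ} (0≤e : 0ℚ ≤ e) (e≤1 : e ≤ 1ℚ) (1≤S : 1ℚ ≤ S) where

    private
      0≤1 : 0ℚ ≤ 1ℚ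
      0≤1 = ℚ.nonNegative⁻¹ 1ℚ
      0≤S = ℚ.≤-trans 0≤1 1≤S
      u = inv₀ S
      uS≡1 : u * S ≡ 1ℚ
      uS≡1 = inv₀-inverseˡ {1ℚ} S (ℚ.≤-trans 1≤S (ℚ.≤-reflexive (sym (ℚ.0≤p⇒∣p∣≡p 0≤S))))
      0≤u : 0ℚ ≤ u
      0≤u = ℚ.*-cancelʳ-≤-pos S {{positive (ℚ.<-≤-trans (ℚ.positive⁻¹ 1ℚ) 1≤S)}}
        (subst₂ _≤_ (sym (ℚ.*-zeroˡ S)) (sym uS≡1) 0≤1)
      u≤1 : u ≤ 1ℚ
      u≤1 = subst₂ _≤_ (ℚ.*-identityʳ u) uS≡1 (*-monoˡ 0≤u 1≤S)
      1≤ι6* : ∀ {q} → 1ℚ ≤ q → 1ℚ ≤ (ℤ.+ 6 / 1) * q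
      1≤ι6* 1≤q = *-mono-≤ 0≤1 (ℚ.≤-trans 0≤1 1≤q) (ℚ.≤-trans (p≤p+q (ℚ.nonNegative⁻¹ (ι 5))) ℚ.≤-refl) 1≤q

      inv₆ : inv₀ ((ℤ.+ 6 / 1) * S) ≡ r 6 * u
      inv₆ = inv₀-unique (1≤ι6* 1≤S) (trans
        (solve 2 (λ u S → con (r 6) :* u :* (con (ℤ.+ 6 / 1) :* S) := u :* S) refl u S) uS≡1)

      inv₆² : inv₀ ((ℤ.+ 6 / 1) * (S * S)) ≡ r 6 * (u * u)
      inv₆² = inv₀-unique (1≤ι6* (*-mono-≤ 0≤1 0≤S 1≤S 1≤S)) (trans
        (solve 2 (λ u S → con (r 6) :* (u :* u) :* (con (ℤ.+ 6 / 1) :* (S :* S)) := (u :* S) :* (u :* S)) refl u S)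
        (cong (λ z → z * z) uS≡1))

      ∣1-e-u∣≤1 : ∣ 1ℚ - e - u ∣ ≤ 1ℚ
      ∣1-e-u∣≤1 = ∣∣-≤
        (0≤q-p⇒p≤q (subst (0ℚ ≤_) (solve 2 (λ e u → e :+ u := con 1ℚ :- (con 1ℚ :- e :- u)) refl e u) (0≤+ 0≤e 0≤u)))
        (0≤q-p⇒p≤q (subst (0ℚ ≤_) (solve 2 (λ e u → (con 1ℚ :- e) :+ (con 1ℚ :- u) := con 1ℚ :- :- (con 1ℚ :- e :- u)) refl e u)
          (0≤+ (p≤q⇒0≤q-p e≤1) (p≤q⇒0≤q-p u≤1))))

    -- With u = 1/S, (e - e²) - (u - u²) = (1 - e - u)(e - u) and e - u = u(e S - 1); every factor
    -- other than e S - 1 has absolute value at most 1.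
    ∣6⁻¹[e-e²]-s∣≤ :
      ∣ r 6 * (e - e * e) - (inv₀ ((ℤ.+ 6 / 1) * S) + - inv₀ ((ℤ.+ 6 / 1) * (S * S))) ∣ ≤ ∣ e * S - 1ℚ ∣
    ∣6⁻¹[e-e²]-s∣≤ = begin
      ∣ r 6 * (e - e * e) - (inv₀ ((ℤ.+ 6 / 1) * S) + - inv₀ ((ℤ.+ 6 / 1) * (S * S))) ∣
        ≡⟨ cong₂ (λ s t → ∣ r 6 * (e - e * e) - (s + - t) ∣) inv₆ inv₆² ⟩
      ∣ r 6 * (e - e * e) - (r 6 * u + - (r 6 * (u * u))) ∣
        ≡⟨ cong ∣_∣ (solve 2 (λ e u → con (r 6) :* (e :- e :* e) :- (con (r 6) :* u :+ :- (con (r 6) :* (u :* u)))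
             := con (r 6) :* (con 1ℚ :- e :- u) :* (e :* con 1ℚ :- u)) refl e u) ⟩
      ∣ r 6 * (1ℚ - e - u) * (e * 1ℚ - u) ∣
        ≡⟨ cong (λ z → ∣ r 6 * (1ℚ - e - u) * (e * z - u) ∣) (sym uS≡1) ⟩
      ∣ r 6 * (1ℚ - e - u) * (e * (u * S) - u) ∣
        ≡⟨ cong ∣_∣ (solve 3 (λ e u S → con (r 6) :* (con 1ℚ :- e :- u) :* (e :* (u :* S) :- u)
             := con (r 6) :* u :* (con 1ℚ :- e :- u) :* (e :* S :- con 1ℚ)) refl e u S) ⟩
      ∣ r 6 * u * (1ℚ - e - u) * (e * S - 1ℚ) ∣
        ≡⟨ trans (ℚ.∣p*q∣≡∣p∣*∣q∣ (r 6 * u * (1ℚ - e - u)) (e * S - 1ℚ)) (cong (_* ∣ e * S - 1ℚ ∣) (ℚ.∣p*q∣≡∣p∣*∣q∣ (r 6 * u) (1ℚ - e - u))) ⟩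
      ∣ r 6 * u ∣ * ∣ 1ℚ - e - u ∣ * ∣ e * S - 1ℚ ∣
        ≡⟨ cong (λ z → z * ∣ 1ℚ - e - u ∣ * ∣ e * S - 1ℚ ∣) (ℚ.0≤p⇒∣p∣≡p (0≤* (0≤r 6) 0≤u)) ⟩
      r 6 * u * ∣ 1ℚ - e - u ∣ * ∣ e * S - 1ℚ ∣
        ≤⟨ *-monoʳ (ℚ.0≤∣p∣ (e * S - 1ℚ)) (*-mono-≤ (0≤* (0≤r 6) 0≤u) 0≤1 (*-mono-≤ (0≤r 6) 0≤1 (r≤1 6) u≤1) ∣1-e-u∣≤1) ⟩
      1ℚ * 1ℚ * 1ℚ * ∣ e * S - 1ℚ ∣
        ≡⟨ ℚ.*-identityˡ _ ⟩
      ∣ e * S - 1ℚ ∣ ∎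
      where open ℚ.≤-Reasoning

  triangle : ∀ {δ ε} x y z → ∣ x - y ∣ ≤ δ → ∣ y - z ∣ ≤ ε → ∣ x - z ∣ ≤ δ + ε
  triangle {δ} {ε} x y z p q = begin
    ∣ x - z ∣                ≡⟨ cong ∣_∣ (solve 3 (λ x y z → x :- z := (x :- y) :+ (y :- z)) refl x y z) ⟩
    ∣ (x - y) + (y - z) ∣    ≤⟨ ℚ.∣p+q∣≤∣p∣+∣q∣ (x - y) (y - z) ⟩
    ∣ x - y ∣ + ∣ y - z ∣    ≤⟨ ℚ.+-mono-≤ p q ⟩
    δ + ε                    ∎
    where open ℚ.≤-Reasoning

  1≤ζ₂ : ∀ {K} → 1 ℕ.≤ K → 1ℚ ≤ ζ₂ K
  1≤ζ₂ = ζ₂-mono {1}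

  -- Finite sums compared with the truncated Euler product

  term² : ℕ × ℕ → ℚ
  term² (m , n) = term m n

  term-0ˡ : ∀ m n → μℚ m ≡ 0ℚ → term m n ≡ 0ℚ
  term-0ˡ m n μm≡0 = trans (cong (λ z → z * μℚ n * (w m * w n * κ m n)) μm≡0)
    (solve 2 (λ a b → con 0ℚ :* a :* b := con 0ℚ) refl (μℚ n) (w m * w n * κ m n))

  term-0ʳ : ∀ m n → μℚ n ≡ 0ℚ → term m n ≡ 0ℚ
  term-0ʳ m n μn≡0 = trans (cong (λ z → μℚ m * z * (w m * w n * κ m n)) μn≡0)
    (solve 2 (λ a b → a :* con 0ℚ :* b := con 0ℚ) refl (μℚ m) (w m * w n * κ m n))

  listSum-0 : ∀ {A : Set} {f : A → ℚ} xs → (∀ {x} → x ∈ xs → f x ≡ 0ℚ) → listSum f xs ≡ 0ℚ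
  listSum-0 []       h = refl
  listSum-0 (x ∷ xs) h = cong₂ _+_ (h (here refl)) (listSum-0 xs (λ i → h (there i)))

  bounded : (G : List (ℕ × ℕ)) → ∃[ B ] (∀ {m n} → (m , n) ∈ G → m ℕ.≤ B × n ℕ.≤ B)
  bounded [] = 0 , λ ()
  bounded ((m , n) ∷ G) with bounded G
  ... | B , h = (m ℕ.⊔ n) ℕ.⊔ B , λ
    { (here refl) → ℕ.≤-trans (ℕ.m≤m⊔n m n) (ℕ.m≤m⊔n (m ℕ.⊔ n) B) , ℕ.≤-trans (ℕ.m≤n⊔m m n) (ℕ.m≤m⊔n (m ℕ.⊔ n) B)
    ; (there x∈)  → ℕ.≤-trans (proj₁ (h x∈)) (ℕ.m≤n⊔m (m ℕ.⊔ n) B) , ℕ.≤-trans (proj₂ (h x∈)) (ℕ.m≤n⊔m (m ℕ.⊔ n) B) }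

  -- `R` is D minus G. The union of G and `R` exceeds D only by elements of G outside D, where f
  -- vanishes.
  listSum-difference : ∀ {A : Set} → DecidableEquality A → ∀ {f : A → ℚ} {G D : List A} → Unique G → Unique D →
    (∀ {x} → x ∈ G → x ∉ D → f x ≡ 0ℚ) →
    ∃[ R ] (Unique R × (∀ {x} → x ∈ R → x ∈ D × x ∉ G) × listSum f G + listSum f R ≡ listSum f D)
  listSum-difference _≟_ {f} {G} {D} uG uD f≡0 = R , uR , R⁻ , sum≡
    where
    ∉G? : ∀ x → Dec (x ∉ G)
    ∉G? x = ¬? (_∈?_ _≟_ x G)
    R = filter ∉G? D
    uR : Unique R
    uR = filter⁺ ∉G? uD
    R⁻ : ∀ {x} → x ∈ R → x ∈ D × x ∉ G
    R⁻ = ∈-filter⁻ ∉G? {xs = D}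
    D⊆G++R : D ⊆ G ++ R
    D⊆G++R {x} x∈ with _∈?_ _≟_ x G
    ... | yes x∈G = ∈-++⁺ˡ x∈G
    ... | no  x∉G = ∈-++⁺ʳ G (∈-filter⁺ ∉G? x∈ x∉G)
    sum≡ : listSum f G + listSum f R ≡ listSum f D
    sum≡ with complement uD (++⁺ uG uR (λ (x∈G , x∈R) → proj₂ (R⁻ x∈R) x∈G)) D⊆G++R
    ... | zs , p , zs⁻ = begin
      listSum f G + listSum f R     ≡⟨ listSum-++ f G R ⟨
      listSum f (G ++ R)            ≡⟨ listSum-↭ f p ⟩
      listSum f (D ++ zs)           ≡⟨ listSum-++ f D zs ⟩
      listSum f D + listSum f zs    ≡⟨ cong (λ z → listSum f D + z) (listSum-0 zs zero-term) ⟩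
      listSum f D + 0ℚ              ≡⟨ ℚ.+-identityʳ (listSum f D) ⟩
      listSum f D                   ∎
      where
      open ≡-Reasoning
      zero-term : ∀ {x} → x ∈ zs → f x ≡ 0ℚ
      zero-term x∈ with ∈-++⁻ G (proj₁ (zs⁻ x∈))
      ... | inj₁ x∈G = f≡0 x∈G (proj₂ (zs⁻ x∈))
      ... | inj₂ x∈R = contradiction (proj₁ (R⁻ x∈R)) (proj₂ (zs⁻ x∈))

  -- Two parameters with separate tasks: the square of side M² inside `G` controls the tail, while
  -- `N`, which bounds the entries of `G` and below which all primes are used, controls the Euler
  -- product.
  module _ (M N : ℕ) {ps : List ℕ} (prime : All Prime ps) (unique : Unique ps) (2∉ : 2 ∉ ps)
    (primes∈ : ∀ {p} → Prime p → p ℕ.≤ N → p ∈ 2 ∷ ps)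
    {G : List (ℕ × ℕ)} (G-unique : Unique G)
    (nonZeros : ∀ {m n} → (m , n) ∈ G → NonZero m × NonZero n)
    (≤N : ∀ {m n} → (m , n) ∈ G → m ℕ.≤ N × n ℕ.≤ N)
    (square : ∀ {m n} .{{_ : NonZero m}} .{{_ : NonZero n}} → m ℕ.≤ M ℕ.* M → n ℕ.≤ M ℕ.* M → (m , n) ∈ G)
    where

    private
      qs = 2 ∷ ps
      qs-prime : All Prime qs
      qs-prime = prime[2] ∷ prime
      qs-unique : Unique qs
      qs-unique = ¬Any⇒All¬ ps 2∉ ∷ unique
      instance
        P≢0 : NonZero (product qs)
        P≢0 = product-nonZero qs-prime
      D = cartesianProduct (subproducts qs) (subproducts qs)
      D-unique : Unique D
      D-unique = cartesianProduct⁺ (subproducts-unique qs-prime qs-unique) (subproducts-unique qs-prime qs-unique)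

      supported : ∀ {m} .{{_ : NonZero m}} → m ℕ.≤ N → μℚ m ≡ 0ℚ ⊎ m ∈ subproducts qs
      supported {m} m≤N = μℚ-support m qs-prime (λ pp p≤m → primes∈ pp (ℕ.≤-trans p≤m m≤N))

      term-0 : ∀ {x} → x ∈ G → x ∉ D → term² x ≡ 0ℚ
      term-0 {m , n} x∈G x∉D = cases (supported {{proj₁ (nonZeros x∈G)}} (proj₁ (≤N x∈G)))
                                     (supported {{proj₂ (nonZeros x∈G)}} (proj₂ (≤N x∈G)))
        where
        cases : μℚ m ≡ 0ℚ ⊎ m ∈ subproducts qs → μℚ n ≡ 0ℚ ⊎ n ∈ subproducts qs → term m n ≡ 0ℚ
        cases (inj₁ μm≡0) _           = term-0ˡ m n μm≡0
        cases (inj₂ _)    (inj₁ μn≡0) = term-0ʳ m n μn≡0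
        cases (inj₂ m∈)   (inj₂ n∈)   = contradiction (∈-cartesianProduct⁺ m∈ n∈) x∉D

      -- Every index of `D` divides `product qs`, so this bounds all of them as well as `M`.
      K = M ℕ.⊔ product qs

      ∣tail∣≤ : ∀ {R} → Unique R → (∀ {x} → x ∈ R → x ∈ D × x ∉ G) →
        ∣ listSum term² R ∣ ≤ ζ₂ K * (ζ₂ K * ζ₂ K) - ζ₂ M * (ζ₂ M * ζ₂ M)
      ∣tail∣≤ {R} R-unique R⁻ = begin
        ∣ listSum term² R ∣               ≤⟨ ∣listSum∣≤ term² R ⟩
        listSum (λ x → ∣ term² x ∣) R     ≤⟨ listSum-mono R (λ x∈ → ∣term∣≤majorant prime unique 2∉ (proj₁ (R⊆ x∈)) (proj₂ (R⊆ x∈))) ⟩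
        listSum majorant R                ≤⟨ majorant-tail {M} {K} (ℕ.m≤m⊔n M (product qs)) R-unique inside outside ⟩
        ζ₂ K * (ζ₂ K * ζ₂ K) - ζ₂ M * (ζ₂ M * ζ₂ M) ∎
        where
        open ℚ.≤-Reasoning
        R⊆ : ∀ {m n} → (m , n) ∈ R → m ∈ subproducts qs × n ∈ subproducts qs
        R⊆ x∈ = ∈-cartesianProduct⁻ (subproducts qs) (subproducts qs) (proj₁ (R⁻ x∈))
        ≤K : ∀ {m} → m ∈ subproducts qs → m ℕ.≤ K
        ≤K m∈ = ℕ.≤-trans (∣⇒≤ (subproducts-∣ qs m∈)) (ℕ.m≤n⊔m M (product qs))
        inside : ∀ {m n} → (m , n) ∈ R → NonZero m × NonZero n × m ℕ.≤ K × n ℕ.≤ K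
        inside x∈ = let m∈ , n∈ = R⊆ x∈ in
          subproducts-nonZero qs-prime m∈ , subproducts-nonZero qs-prime n∈ , ≤K m∈ , ≤K n∈
        outside : ∀ {m n} → (m , n) ∈ R → ¬ (m ℕ.≤ M ℕ.* M × n ℕ.≤ M ℕ.* M)
        outside x∈ (m≤ , n≤) = let m≢0 , n≢0 , _ = inside x∈ in
          proj₂ (R⁻ x∈) (square {{m≢0}} {{n≢0}} m≤ n≤)

    -- The total over `D` is exact by `Σ²-term`, and the pairs of `G` outside `D` contribute
    -- nothing. The error is the sum over D minus G, whose pairs lie outside the square.
    finite-sum : ∃[ L ] (M ℕ.≤ L × ∣ listSum term² G - r 6 * (E qs - E qs * E qs) ∣ ≤
      ζ₂ L * (ζ₂ L * ζ₂ L) - ζ₂ M * (ζ₂ M * ζ₂ M))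
    finite-sum =
      let R , R-unique , R⁻ , G+R≡D = listSum-difference (≡-dec ℕ._≟_ ℕ._≟_) G-unique D-unique term-0
          open ℚ.≤-Reasoning
      in K , ℕ.m≤m⊔n M (product qs) , (begin
      ∣ listSum term² G - r 6 * (E qs - E qs * E qs) ∣
        ≡⟨ cong (λ z → ∣ listSum term² G - z ∣) (trans (sym (Σ²-term prime unique 2∉))
             (trans (sym (listSum-cartesianProduct term² (subproducts qs) (subproducts qs))) (sym G+R≡D))) ⟩
      ∣ listSum term² G - (listSum term² G + listSum term² R) ∣
        ≡⟨ cong ∣_∣ (solve 2 (λ g r → g :- (g :+ r) := :- r) refl (listSum term² G) (listSum term² R)) ⟩
      ∣ - listSum term² R ∣
        ≡⟨ ℚ.∣-p∣≡∣p∣ (listSum term² R) ⟩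
      ∣ listSum term² R ∣
        ≤⟨ ∣tail∣≤ R-unique R⁻ ⟩
      ζ₂ K * (ζ₂ K * ζ₂ K) - ζ₂ M * (ζ₂ M * ζ₂ M) ∎)

    -- The expression subtracted is the k-th rational of the target real. The bound on k may depend
    -- on `G`, because the order on ℝ ignores finitely many terms.
    sum-limit : ∀ ε .{{_ : Positive ε}} .{{_ : NonZero N}} → r N ≤ ε →
      (∀ L → M ℕ.≤ L → ζ₂ L * (ζ₂ L * ζ₂ L) - ζ₂ M * (ζ₂ M * ζ₂ M) ≤ ε) →
      ∃[ K₀ ] (∀ k → K₀ ℕ.≤ k →
        ∣ listSum term² G - (inv₀ ((ℤ.+ 6 / 1) * ζ₂ k) + - inv₀ ((ℤ.+ 6 / 1) * (ζ₂ k * ζ₂ k))) ∣ ≤ ε + ε)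
    sum-limit ε rN≤ε cauchy₃ =
      let L , M≤L , fin = finite-sum
          K₀ , eul      = euler qs-prime qs-unique N (primeDivisor primes∈) ε rN≤ε
      -- The successor guarantees k ≥ 1, hence ζ₂ k ≥ 1 and `inv₀` takes a true inverse.
      in suc K₀ , λ k K₀<k → triangle (listSum term² G) (r 6 * (E qs - E qs * E qs)) _ (ℚ.≤-trans fin (cauchy₃ L M≤L))
        (ℚ.≤-trans (∣6⁻¹[e-e²]-s∣≤ (0≤E qs) (E≤1 qs) (1≤ζ₂ (ℕ.≤-trans (s≤s z≤n) K₀<k))) (eul k (ℕ.<⇒≤ K₀<k)))

  -- The unordered sum over all pairs

  suc² : ℕ × ℕ → ℕ × ℕ
  suc² (i , j) = suc i , suc j

  suc²-injective : ∀ {x y} → suc² x ≡ suc² y → x ≡ y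
  suc²-injective {i , j} {.i , .j} refl = refl

  seq-foldr : ∀ G k →
    seq (foldr ℝ._+_ (fromℚ 0ℚ) (map (λ (i , j) → fromℚ (term (suc i) (suc j))) G)) k ≡ listSum term² (map suc² G)
  seq-foldr []            k = refl
  seq-foldr ((i , j) ∷ G) k = cong (λ z → term (suc i) (suc j) + z) (seq-foldr G k)

  hasSum-term : HasSum {ℕ × ℕ} (λ (i , j) → fromℚ (term (suc i) (suc j)))
    ( ℝ.1/ (fromℚ (ℤ.+ 6 / 1) ℝ.* ζ 2 ℕ.≤-refl)
    ℝ.- ℝ.1/ (fromℚ (ℤ.+ 6 / 1) ℝ.* (ζ 2 ℕ.≤-refl ℝ.* ζ 2 ℕ.≤-refl)))
  hasSum-term ε =
    let instance _ = half-pos ε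
        z = ζ 2 ℕ.≤-refl
        -- Half of ε pays for the tail, through the Cauchy modulus of ζ(2)³, and half for the Euler
        -- product, through 1/N.
        M , close = cauchy (z ℝ.* (z ℝ.* z)) (½ * ε)
        j , r≤ = archimedean (½ * ε)
    -- The side is M² because d, a, b ≤ M bounds a d and b d only by M². `upTo` starts at 0, in step
    -- with the shift `suc²`.
    in cartesianProduct (upTo (M ℕ.* M)) (upTo (M ℕ.* M)) , λ G uG F⊆G ε′ →
      let B , ≤B = bounded (map suc² G)
          -- Chosen after `G`: `B` makes the primes reach every entry of `G`, and `suc j` makes 1/N
          -- small.
          N = suc j ℕ.⊔ B
          K₀ , h = sum-limit M N (oddPrimes-prime N) (oddPrimes-unique N) (2∉oddPrimes N) primes∈ (map⁺ suc²-injective uG) nonZeros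
            (λ x∈ → ℕ.≤-trans (proj₁ (≤B x∈)) (ℕ.m≤n⊔m (suc j) B) , ℕ.≤-trans (proj₂ (≤B x∈)) (ℕ.m≤n⊔m (suc j) B))
            (λ { {suc m} {suc n} m≤ n≤ → ∈-map⁺ suc² (F⊆G (∈-cartesianProduct⁺ (∈-upTo⁺ m≤) (∈-upTo⁺ n≤))) })
            (½ * ε) {{it}} {{ℕ.>-nonZero (ℕ.≤-trans (s≤s z≤n) (ℕ.m≤m⊔n (suc j) B))}}
            (ℚ.≤-trans (r-antitone {suc j} (ℕ.m≤m⊔n (suc j) B)) r≤)
            (λ L M≤L → ℚ.≤-trans (ℚ.≤-trans (p≤∣p∣ _)
              (ℚ.≤-reflexive (cong₂ (λ s t → ∣ s * (s * s) - t * (t * t) ∣) (sym (∑1/n²≡ζ₂ L)) (sym (∑1/n²≡ζ₂ M)))))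
              (close L M M≤L ℕ.≤-refl))
      in K₀ , λ k K₀≤k → ℚ.≤-trans
        (subst₂ (λ g s → ∣ g - (inv₀ ((ℤ.+ 6 / 1) * s) + - inv₀ ((ℤ.+ 6 / 1) * (s * s))) ∣ ≤ ε)
          (sym (seq-foldr G k)) (sym (∑1/n²≡ζ₂ k))
          (subst (_ ≤_) (half+half ε) (h k K₀≤k)))
        (p≤p+q (ℚ.<⇒≤ (ℚ.positive⁻¹ ε′)))
    where
    it : Positive (½ * ε)
    it = half-pos ε
    p≤∣p∣ : ∀ p → p ≤ ∣ p ∣
    p≤∣p∣ p with ℚ.≤-total 0ℚ p
    ... | inj₁ 0≤p = ℚ.≤-reflexive (sym (ℚ.0≤p⇒∣p∣≡p 0≤p))
    ... | inj₂ p≤0 = ℚ.≤-trans p≤0 (ℚ.0≤∣p∣ p)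
    nonZeros : ∀ {G m n} → (m , n) ∈ map suc² G → NonZero m × NonZero n
    nonZeros x∈ with ∈-map⁻ suc² x∈
    ... | _ , _ , refl = _ , _

open import Data.Integer.Base using (+_; 1ℤ)
open import Data.Nat.Base using (ℕ; suc; NonZero)
open import Data.Nat.Properties using (≤-refl)
open import Data.Product.Base using (Σ-syntax; _×_; _,_)
import Data.Rational.Base as ℚ
open import Defs
open Means using (term; summand-limit; hasSum-term)

theorem2p2 : Σ[ L ∈ ((m n : ℕ) .{{_ : NonZero m}} .{{_ : NonZero n}} → ℝ) ]
    ( (∀ (m n : ℕ) .{{_ : NonZero m}} .{{_ : NonZero n}} →
    (λ X → fromℚ (1ℤ ℚ./ X ℚ.* ∑ X (λ x → summand m n x))) ⟶ L m n)
    × HasSum {ℕ × ℕ} (λ (i , j) → L (suc i) (suc j))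
    ( 1/ (fromℚ (+ 6 ℚ./ 1) * ζ 2 ≤-refl)
    - 1/ (fromℚ (+ 6 ℚ./ 1) * (ζ 2 ≤-refl * ζ 2 ≤-refl))))
theorem2p2 = (λ m n → fromℚ (term m n)) , summand-limit , hasSum-term
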